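{- Let $r\ge 3$, $s,t\ge 2$, and $a,b$ be integers with $a+b=r$ and $b<a<r$. Let $T$ be a tree with bipartition $(U,V)$, $|U|=s$, $|V|=t$, and let $\mathcal T=T(a,b)$ be its $(a,b)$-blowup. Then, as $n\to\infty$, every $\mathcal T$-free $r$-graph $H$ on $n$ vertices satisfies \[|H|\le (t-1)\binom{n}{r-1}+o(n^{r-1}).\] Moreover, if $t\le s$, this bound is asymptotically sharp, i.e. ${\rm ex}_r(n,\mathcal T)=(t-1)\binom{n}{r-1}+o(n^{r-1})$.
   Context: An $r$-graph is a family of $r$-element subsets of a finite vertex set; $H$ is $\mathcal T$-free if it contains no copy of $\mathcal T$, and ${\rm ex}_r(n,\mathcal T)$ is the maximum number of edges of a $\mathcal T$-free $r$-graph on $n$ vertices. For a bipartite graph $T$ with parts $U=\{u_1,\dots,u_s\}$ and $V=\{v_1,\dots,v_t\}$ and positive integers $a,b$, the $(a,b)$-blowup $T(a,b)$ is the $(a+b)$-graph obtained by taking pairwise disjoint sets $U_1,\dots,U_s,V_1,\dots,V_t$ with $|U_i|=a$, $|V_j|=b$, and letting the edge set be $\{U_i\cup V_j: u_iv_j\in E(T)\}$. -}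

module Defs where

open import Data.Nat using (ℕ; zero; suc; _+_; _*_; _∸_; _^_; _≤_; _<_)
open import Data.Nat.Combinatorics using (_C_)
open import Data.Fin using (Fin)
open import Data.Fin.Subset using (Subset; ∣_∣) renaming (_∈_ to _∈ₛ_)
open import Data.Bool using (Bool; true)
open import Data.Sum using (_⊎_; inj₁; inj₂)
open import Data.Product using (Σ; ∃; _×_; _,_; proj₁)
open import Data.Empty using (⊥)
open import Data.List using (List; []; _∷_; _++_; length)
open import Data.List.Membership.Propositional using (_∈_)
open import Data.List.Relation.Unary.All using (All)
open import Data.List.Relation.Unary.Unique.Propositional using (Unique)
open import Data.List.Relation.Unary.Linked using (Linked)
open import Relation.Binary.Construct.Closure.ReflexiveTransitive using (Star)
open import Relation.Binary.PropositionalEquality using (_≡_)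
open import Relation.Nullary using (¬_)
open import Function using (_⇔_)
open import Function.Definitions using (Injective)

-- Bipartite graphs T with parts U = Fin s, V = Fin t.
-- The edge set is given by E : Fin s → Fin t → Bool  (u_i v_j ∈ E(T) iff E i j ≡ true).

BVertex : ℕ → ℕ → Set
BVertex s t = Fin s ⊎ Fin t

Adj : {s t : ℕ} → (Fin s → Fin t → Bool) → BVertex s t → BVertex s t → Set
Adj E (inj₁ i) (inj₂ j) = E i j ≡ true
Adj E (inj₂ j) (inj₁ i) = E i j ≡ true
Adj E (inj₁ _) (inj₁ _) = ⊥
Adj E (inj₂ _) (inj₂ _) = ⊥

Connected : {s t : ℕ} → (Fin s → Fin t → Bool) → Set
Connected {s} {t} E = (x y : BVertex s t) → Star (Adj E) x y

IsCycle : {s t : ℕ} → (Fin s → Fin t → Bool) → List (BVertex s t) → Set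
IsCycle E [] = ⊥
IsCycle E (v ∷ vs) = (2 ≤ length vs) × Unique (v ∷ vs) × Linked (Adj E) (v ∷ vs ++ v ∷ [])

Acyclic : {s t : ℕ} → (Fin s → Fin t → Bool) → Set
Acyclic {s} {t} E = (c : List (BVertex s t)) → ¬ IsCycle E c

IsTree : {s t : ℕ} → (Fin s → Fin t → Bool) → Set
IsTree E = Connected E × Acyclic E

record RGraph (r n : ℕ) : Set where
  field
    edges    : List (Subset n)
    distinct : Unique edges
    uniform  : All (λ e → ∣ e ∣ ≡ r) edges

open RGraph public

size : {r n : ℕ} → RGraph r n → ℕ
size H = length (edges H)

-- The (a,b)-blowup T(a,b): vertex set (Fin s × Fin a) ⊎ (Fin t × Fin b)
-- (U_i = {i} × Fin a, V_j = {j} × Fin b); edges U_i ∪ V_j for u_i v_j ∈ E(T).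

BlowVertex : ℕ → ℕ → ℕ → ℕ → Set
BlowVertex s t a b = (Fin s × Fin a) ⊎ (Fin t × Fin b)

ContainsBlowup : {r n : ℕ} (s t a b : ℕ) → (Fin s → Fin t → Bool) → RGraph r n → Set
ContainsBlowup {r} {n} s t a b E H =
  Σ (BlowVertex s t a b → Fin n) λ φ →
    Injective _≡_ _≡_ φ ×
    ((i : Fin s) (j : Fin t) → E i j ≡ true →
      Σ (Subset n) λ e → (e ∈ edges H) ×
        ((v : Fin n) → (v ∈ₛ e) ⇔
           ((Σ (Fin a) λ x → φ (inj₁ (i , x)) ≡ v) ⊎ (Σ (Fin b) λ y → φ (inj₂ (j , y)) ≡ v))))

BlowupFree : {r n : ℕ} (s t a b : ℕ) → (Fin s → Fin t → Bool) → RGraph r n → Set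
BlowupFree s t a b E H = ¬ ContainsBlowup s t a b E H

{-# OPTIONS --safe #-}
module Submission where

-- Lower bound: fix a set S of t − 1 vertices and take all edges meeting S in exactly one vertex.  In a copy
-- of T(a,b) exactly one of the two blobs of every edge meets S, so by connectedness S meets all U-blobs or
-- all V-blobs and has at least t elements.
--
-- Upper bound: call a set of k vertices fat if it lies in at least δ n^(r−k) edges, with δ depending on k.
-- A subfamily of pairs (U,V) of blobs in which each U extends to many disjoint V and each V to many disjoint
-- U contains T(a,b) by greedy embedding; it is found by deleting blobs of small degree.  If more than
-- ε n^(r−1) edges without fat vertex contain a fat a-set, or contain no fat (b+1)-set while b ≥ 2, such a
-- family exists.  Since b < a, almost no edge contains a fat (b+1)-set but no fat a-set.  What remains are the
-- edges with a fat vertex x, and if b = 1 the edges without fat pairs, in which x is arbitrary.  Charge such an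
-- edge F to the (r−1)-set F − x.  An excess over (t−1) C(n,r−1) leaves many (r−1)-sets charged at least t times.
-- There are boundedly many fat vertices, so for b ≥ 2 some t of them are common to ε n^(r−1) of these
-- (r−1)-sets, and a copy of T(a,b−1) in the latter extends to T(a,b).  For b = 1 the tree is again embedded
-- greedily, after placing as many vertices of V as possible on vertices with many common neighbours.

open import Defs
open import Data.Nat using (ℕ; zero; suc; _+_; _*_; _∸_; _^_; _≤_; _<_; z≤n; s≤s; NonZero; >-nonZero; _≤?_; _≤ᵇ_)
open import Data.Nat.Properties
open import Data.Nat.Combinatorics using (_C_; nCk+nC[k+1]≡[n+1]C[k+1])
open import Data.Nat.Tactic.RingSolver using (solve-∀)
open import Data.Fin using (Fin; zero; suc; _↑ˡ_)
import Data.Fin as Fin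
import Data.Fin.Properties as Fin
open import Data.Fin.Subset using (Subset; ∣_∣; ⁅_⁆; _∪_) renaming (_∈_ to _∈ₛ_; ⊥ to ∅)
open import Data.Fin.Subset.Properties using (∪-assoc; ∪-comm; ∪-identityˡ; x∈⁅x⁆; x∈⁅y⁆⇒x≡y; x∈p∪q⁻; x∈p∪q⁺; ∉⊥; ∣⊥∣≡0; ∣⁅x⁆∣≡1)
open import Data.Vec using ([]; _∷_; here; there) renaming (_++_ to _++ᵥ_)
import Data.Vec.Properties as Vec
open import Data.Bool using (Bool; true; false; not; _∧_; _∨_; if_then_else_; T)
import Data.Bool.Properties as Bool
open import Data.Sum using (_⊎_; inj₁; inj₂; [_,_]′)
import Data.Sum.Properties as Sum
import Data.Product.Properties as Product
open import Data.Product using (Σ; _×_; _,_; proj₁; proj₂; ∃-syntax; uncurry)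
open import Data.Empty using (⊥; ⊥-elim)
open import Data.List using (List; []; _∷_; _++_; length; map; concat; take; drop; lookup; filter; allFin; cartesianProduct; cartesianProductWith)
open import Data.List.Properties using (length-map; length-++; length-tabulate; ++-assoc; length-take)
import Data.List.Properties as List
open import Data.List.Membership.Propositional using (_∈_; _∉_; find; lose)
open import Data.List.Membership.Propositional.Properties
open import Data.List.Relation.Unary.Any using (here; there; index)
import Data.List.Relation.Unary.Any as Any
import Data.List.Relation.Unary.Any.Properties as Any
open import Data.List.Relation.Unary.All as All using (All; []; _∷_)
import Data.List.Relation.Unary.All.Properties as All
open import Data.List.Relation.Unary.AllPairs as AllPairs using ([]; _∷_)
open import Data.List.Relation.Unary.Linked using (Linked; []; [-]; _∷_)
open import Data.List.Relation.Unary.Unique.Propositional using (Unique)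
import Data.List.Relation.Unary.Unique.Propositional.Properties as Unique
open import Data.List.Relation.Binary.Disjoint.Propositional using (Disjoint)
open import Data.List.Relation.Binary.Permutation.Propositional as Perm using (_↭_; ↭-sym; ↭-refl; ↭-trans)
import Data.List.Relation.Binary.Permutation.Propositional.Properties as Perm
open import Relation.Binary.Construct.Closure.ReflexiveTransitive using (Star; ε; _◅_)
open import Relation.Binary.PropositionalEquality using (_≡_; _≢_; refl; sym; trans; cong; cong₂; subst; subst₂; module ≡-Reasoning)
open import Relation.Binary.Definitions using (DecidableEquality)
open import Relation.Nullary using (¬_; ¬?; Dec; yes; no; does; contradiction)
open import Relation.Nullary.Decidable using (dec-true; _×-dec_)
open import Function using (_∘_; id; case_of_; mk⇔; Equivalence)
open import Function.Definitions using (Injective)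

-- The error term tolerates constant factors, the main term does not. Negligible classes are
-- therefore counted through ordered words with repetition, where sums split along concatenation and
-- an edge appears at most r^r times, whereas the charging to (r-1)-sets counts genuine subsets. All
-- thresholds are multiplied out to stay in ℕ, with ε in the role of 1/e.
--
-- The case b = 1 needs its own embedding. The r-subsets of ℤ/n with sum 0 number about C(n,r-1)/r,
-- and any (r-1)-set lies in at most one of them; they are T(a,1)-free and for large n have neither
-- fat vertices nor fat pairs. So edges without fat vertex cannot be discarded and have to share the
-- budget (t-1) C(n,r-1) with the others. The charged vertex then ranges over all n vertices, and
-- the pigeonhole argument for t common fat vertices breaks down. The obstacle to a greedy embedding
-- is that the t partners of a new U-blob may be used up already; if this happens persistently, the
-- used vertices responsible for it are themselves good places for vertices of V.
--
-- All embeddings serve to contradict freeness, so the existence statements about such places are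
-- needed only up to double negation.

private variable
  A B K : Set
  n s t : ℕ

-- Finite sums and counting

𝟙 : Bool → ℕ
𝟙 true  = 1
𝟙 false = 0

∑ : List A → (A → ℕ) → ℕ
∑ []       f = 0
∑ (x ∷ xs) f = f x + ∑ xs f

# : List A → (A → Bool) → ℕ
# xs p = ∑ xs (λ x → 𝟙 (p x))

does⇒ : {P : Set} (d : Dec P) → does d ≡ true → P
does⇒ (yes p) _ = p

∧-true : ∀ {x y} → x ∧ y ≡ true → x ≡ true × y ≡ true
∧-true {true} {true} _ = refl , refl

∧-intro : ∀ {x y} → x ≡ true → y ≡ true → x ∧ y ≡ true
∧-intro refl refl = refl

not-true : ∀ {x} → not x ≡ true → x ≡ false
not-true {false} _ = refl

true≢false : ∀ {x} → x ≡ true → x ≡ false → ⊥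
true≢false refl ()

𝟙-mono : ∀ {x y} → (x ≡ true → y ≡ true) → 𝟙 x ≤ 𝟙 y
𝟙-mono {false} _ = z≤n
𝟙-mono {true}  h rewrite h refl = ≤-refl

𝟙-∨ : ∀ x y → 𝟙 (x ∨ y) ≤ 𝟙 x + 𝟙 y
𝟙-∨ true  y = s≤s z≤n
𝟙-∨ false y = ≤-refl

∑-mono : ∀ (xs : List A) {f g} → (∀ {x} → x ∈ xs → f x ≤ g x) → ∑ xs f ≤ ∑ xs g
∑-mono []       h = z≤n
∑-mono (x ∷ xs) h = +-mono-≤ (h (here refl)) (∑-mono xs (h ∘ there))

∑-cong : ∀ (xs : List A) {f g} → (∀ x → f x ≡ g x) → ∑ xs f ≡ ∑ xs g
∑-cong []       h = refl
∑-cong (x ∷ xs) h = cong₂ _+_ (h x) (∑-cong xs h)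

#-mono : ∀ (xs : List A) {p q} → (∀ {x} → x ∈ xs → p x ≡ true → q x ≡ true) → # xs p ≤ # xs q
#-mono xs h = ∑-mono xs (λ x∈ → 𝟙-mono (h x∈))

∑-zero : ∀ (xs : List A) → ∑ xs (λ _ → 0) ≡ 0
∑-zero []       = refl
∑-zero (x ∷ xs) = ∑-zero xs

∑-const : ∀ (xs : List A) c → ∑ xs (λ _ → c) ≡ length xs * c
∑-const []       c = refl
∑-const (x ∷ xs) c = cong (c +_) (∑-const xs c)

∑-+ : ∀ (xs : List A) f g → ∑ xs (λ x → f x + g x) ≡ ∑ xs f + ∑ xs g
∑-+ []       f g = refl
∑-+ (x ∷ xs) f g = begin
  f x + g x + ∑ xs (λ x → f x + g x) ≡⟨ cong (f x + g x +_) (∑-+ xs f g) ⟩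
  f x + g x + (∑ xs f + ∑ xs g)      ≡⟨ interchange (f x) (g x) (∑ xs f) (∑ xs g) ⟩
  f x + ∑ xs f + (g x + ∑ xs g)      ∎
  where
  open ≡-Reasoning
  interchange : ∀ a b c d → a + b + (c + d) ≡ a + c + (b + d)
  interchange = solve-∀

∑-*ˡ : ∀ c (xs : List A) f → c * ∑ xs f ≡ ∑ xs (λ x → c * f x)
∑-*ˡ c []       f = *-zeroʳ c
∑-*ˡ c (x ∷ xs) f = trans (*-distribˡ-+ c (f x) (∑ xs f)) (cong (c * f x +_) (∑-*ˡ c xs f))

∑-++ : ∀ (xs ys : List A) f → ∑ (xs ++ ys) f ≡ ∑ xs f + ∑ ys f
∑-++ []       ys f = refl
∑-++ (x ∷ xs) ys f = trans (cong (f x +_) (∑-++ xs ys f)) (sym (+-assoc (f x) (∑ xs f) (∑ ys f)))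

∑-map : ∀ (g : A → B) xs f → ∑ (map g xs) f ≡ ∑ xs (f ∘ g)
∑-map g []       f = refl
∑-map g (x ∷ xs) f = cong (f (g x) +_) (∑-map g xs f)

∑-swap : ∀ (xs : List A) (ys : List B) (f : A → B → ℕ) → ∑ xs (λ x → ∑ ys (f x)) ≡ ∑ ys (λ y → ∑ xs (λ x → f x y))
∑-swap []       ys f = sym (∑-zero ys)
∑-swap (x ∷ xs) ys f = trans (cong (∑ ys (f x) +_) (∑-swap xs ys f)) (sym (∑-+ ys (f x) _))

∑-cartesianProductWith : ∀ {C : Set} (g : A → B → C) xs ys f →
  ∑ (cartesianProductWith g xs ys) f ≡ ∑ xs (λ x → ∑ ys (λ y → f (g x y)))
∑-cartesianProductWith g []       ys f = refl
∑-cartesianProductWith g (x ∷ xs) ys f =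
  trans (∑-++ (map (g x) ys) _ f) (cong₂ _+_ (∑-map (g x) ys f) (∑-cartesianProductWith g xs ys f))

∑-bound : ∀ (xs : List A) {f c} → (∀ {x} → x ∈ xs → f x ≤ c) → ∑ xs f ≤ length xs * c
∑-bound xs {c = c} h = ≤-trans (∑-mono xs h) (≤-reflexive (∑-const xs c))

term≤∑ : ∀ {xs : List A} {f x} → x ∈ xs → f x ≤ ∑ xs f
term≤∑ {xs = _ ∷ xs} {f} (here refl) = m≤m+n _ (∑ xs f)
term≤∑ {xs = y ∷ xs} {f} (there x∈)  = ≤-trans (term≤∑ x∈) (m≤n+m _ (f y))

#-pos : ∀ (xs : List A) p → 0 < # xs p → ∃[ x ] x ∈ xs × p x ≡ true
#-pos (x ∷ xs) p h with p x in eq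
... | true  = x , here refl , eq
... | false with #-pos xs p h
...   | y , y∈ , py = y , there y∈ , py

-- In most applications `c` is a conditional that equals 0 in a branch incompatible with `p`; an
-- element found here forces the other branch.
#-witness : ∀ (xs : List A) p {c} → (∀ {x} → x ∈ xs → p x ≡ true → # xs p ≤ c) → # xs p ≤ c
#-witness xs p {c} h with 1 ≤? # xs p
... | no ≱1 = ≤-trans (≤-reflexive (n<1⇒n≡0 (≰⇒> ≱1))) z≤n
... | yes 1≤ with #-pos xs p 1≤
...   | x , x∈ , px = h x∈ px

∑-≡-≤1 : (_≟_ : DecidableEquality A) {xs : List A} → Unique xs → ∀ y → # xs (λ x → does (y ≟ x)) ≤ 1
∑-≡-≤1 _≟_ {[]} _ y = z≤n
∑-≡-≤1 _≟_ {x ∷ xs} (x∉ ∷ u) y with y ≟ x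
... | no  _    = ∑-≡-≤1 _≟_ u y
... | yes refl = s≤s (≤-trans (∑-mono xs none) (≤-reflexive (∑-zero xs)))
  where
  none : ∀ {z} → z ∈ xs → 𝟙 (does (y ≟ z)) ≤ 0
  none {z} z∈ with y ≟ z
  ... | yes refl = contradiction refl (All.lookup x∉ z∈)
  ... | no  _    = z≤n

-- Double counting: as `xs` has no repetitions, each `y` is the key of at most one `x`. The form
-- suits the comparison of edges with words, where an edge has many orderings and only one has to be
-- exhibited.
#-injection : (_≟_ : DecidableEquality A) {xs : List A} (ys : List B) (key : B → A) (p : A → Bool) (q : B → Bool) →
  Unique xs → (∀ {x} → x ∈ xs → p x ≡ true → ∃[ y ] y ∈ ys × q y ≡ true × key y ≡ x) → # xs p ≤ # ys q
#-injection _≟_ {xs} ys key p q uniq h = begin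
  # xs p                                               ≤⟨ ∑-mono xs pointwise ⟩
  ∑ xs (λ x → # ys (λ y → q y ∧ does (key y ≟ x)))     ≡⟨ ∑-swap xs ys _ ⟩
  ∑ ys (λ y → # xs (λ x → q y ∧ does (key y ≟ x)))     ≤⟨ ∑-mono ys (λ {y} _ → fibre y) ⟩
  # ys q                                               ∎
  where
  open ≤-Reasoning
  pointwise : ∀ {x} → x ∈ xs → 𝟙 (p x) ≤ # ys (λ y → q y ∧ does (key y ≟ x))
  pointwise {x} x∈ with p x in eq
  ... | false = z≤n
  ... | true with h x∈ eq
  ...   | y , y∈ , qy , refl = ≤-trans (≤-reflexive (cong 𝟙 (sym (∧-intro qy (dec-true (key y ≟ key y) refl)))))
                                 (term≤∑ {f = λ y → 𝟙 (q y ∧ does (key y ≟ x))} y∈)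
  fibre : ∀ y → # xs (λ x → q y ∧ does (key y ≟ x)) ≤ 𝟙 (q y)
  fibre y with q y
  ... | true  = ∑-≡-≤1 _≟_ uniq (key y)
  ... | false = ≤-reflexive (∑-zero xs)

Unique-length-≤ : DecidableEquality A → {xs ys : List A} → Unique xs → (∀ {x} → x ∈ xs → x ∈ ys) → length xs ≤ length ys
Unique-length-≤ _≟_ {xs} {ys} u h = subst₂ _≤_ (#-true xs) (#-true ys)
  (#-injection _≟_ ys id (λ _ → true) (λ _ → true) u (λ {x} x∈ _ → x , h x∈ , refl , refl))
  where
  #-true : ∀ (zs : List _) → # zs (λ _ → true) ≡ length zs
  #-true zs = trans (∑-const zs 1) (*-identityʳ (length zs))

-- The factor `D` is the denominator of the thresholds `Θ κ / D`. They depend on the key so that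
-- blobs of both sides, or vertices and (r-1)-sets, can be cleaned simultaneously.
Cleaned : ℕ → List A → (K → A → Bool) → (K → ℕ) → List K → (A → Bool) → Set
Cleaned D univ has Θ ks p =
  ∃[ p′ ] (∀ x → p′ x ≡ true → p x ≡ true) ×
          D * # univ p ≤ D * # univ p′ + ∑ ks Θ ×
          (∀ {κ} → κ ∈ ks → ∀ {x} → p′ x ≡ true → has κ x ≡ true → Θ κ < D * # univ (λ x → p′ x ∧ has κ x))

-- Keys occurring at most Θ κ / D times among the items satisfying p are deleted one after another;
-- a deleted key never comes back, so the total loss is at most ∑ Θ / D.
abstract
  clean : ∀ D (univ : List A) (has : K → A → Bool) (Θ : K → ℕ) (ks : List K) (p : A → Bool) → Cleaned D univ has Θ ks p
  clean {A = A} {K = K} D univ has Θ ks p = go (length ks) ks refl p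
    where
    cnt : (A → Bool) → K → ℕ
    cnt p κ = # univ (λ x → p x ∧ has κ x)

    search : ∀ p (ks : List K) → (∃[ xs ] ∃[ κ ] ∃[ ys ] ks ≡ xs ++ κ ∷ ys × D * cnt p κ ≤ Θ κ)
                               ⊎ (∀ {κ} → κ ∈ ks → Θ κ < D * cnt p κ)
    search p []       = inj₂ λ ()
    search p (κ ∷ ks) with D * cnt p κ ≤? Θ κ
    ... | yes h = inj₁ ([] , κ , ks , refl , h)
    ... | no  h with search p ks
    ...   | inj₁ (xs , κ′ , ys , refl , h′) = inj₁ (κ ∷ xs , κ′ , ys , refl , h′)
    ...   | inj₂ all = inj₂ λ { (here refl) → ≰⇒> h ; (there κ∈) → all κ∈ }

    split : ∀ (x y : Bool) → 𝟙 x ≡ 𝟙 (x ∧ not y) + 𝟙 (x ∧ y)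
    split false _     = refl
    split true  false = refl
    split true  true  = refl

    go : ∀ fuel (ks : List K) → length ks ≡ fuel → (p : A → Bool) → Cleaned D univ has Θ ks p
    go fuel ks len p with search p ks
    ... | inj₂ all = p , (λ _ px → px) , m≤m+n _ _ , λ κ∈ _ _ → all κ∈
    go zero .(xs ++ κ ∷ ys) len p | inj₁ (xs , κ , ys , refl , h)
      with () ← trans (sym len) (trans (length-++ xs) (+-suc (length xs) (length ys)))
    go (suc fuel) .(xs ++ κ ∷ ys) len p | inj₁ (xs , κ , ys , refl , h)
      with go fuel (xs ++ ys) (suc-injective (trans (sym (trans (length-++ xs) (trans (+-suc (length xs) (length ys)) (cong suc (sym (length-++ xs)))))) len))
              (λ x → p x ∧ not (has κ x))
    ... | p′ , p′⇒p₁ , bound , kept = p′ , (λ x → proj₁ ∘ ∧-true ∘ p′⇒p₁ x) , bound′ , kept′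
      where
      bound′ : D * # univ p ≤ D * # univ p′ + ∑ (xs ++ κ ∷ ys) Θ
      bound′ = begin
        D * # univ p                                                 ≡⟨ cong (D *_) (trans (∑-cong univ (λ x → split (p x) (has κ x))) (∑-+ univ _ _)) ⟩
        D * (# univ (λ x → p x ∧ not (has κ x)) + cnt p κ)           ≡⟨ *-distribˡ-+ D _ _ ⟩
        D * # univ (λ x → p x ∧ not (has κ x)) + D * cnt p κ         ≤⟨ +-mono-≤ bound h ⟩
        D * # univ p′ + ∑ (xs ++ ys) Θ + Θ κ                         ≡⟨ cong (λ s → D * # univ p′ + s + Θ κ) (∑-++ xs ys Θ) ⟩
        D * # univ p′ + (∑ xs Θ + ∑ ys Θ) + Θ κ                      ≡⟨ rearrange (D * # univ p′) (∑ xs Θ) (∑ ys Θ) (Θ κ) ⟩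
        D * # univ p′ + (∑ xs Θ + (Θ κ + ∑ ys Θ))                    ≡⟨ cong (D * # univ p′ +_) (sym (∑-++ xs (κ ∷ ys) Θ)) ⟩
        D * # univ p′ + ∑ (xs ++ κ ∷ ys) Θ                           ∎
        where
        open ≤-Reasoning
        rearrange : ∀ a b c d → a + (b + c) + d ≡ a + (b + (d + c))
        rearrange = solve-∀
      kept′ : ∀ {κ′} → κ′ ∈ xs ++ κ ∷ ys → ∀ {x} → p′ x ≡ true → has κ′ x ≡ true → Θ κ′ < D * # univ (λ x → p′ x ∧ has κ′ x)
      kept′ κ′∈ {x} p′x hasx with ∈-++⁻ xs κ′∈
      ... | inj₁ ∈xs          = kept (∈-++⁺ˡ ∈xs) p′x hasx
      ... | inj₂ (there ∈ys)  = kept (∈-++⁺ʳ xs ∈ys) p′x hasx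
      -- The key deleted in this round is absent from all survivors.
      ... | inj₂ (here refl)  = ⊥-elim (true≢false hasx (not-true (proj₂ (∧-true {p x} (p′⇒p₁ x p′x)))))

-- Words and subsets

words : List A → ℕ → List (List A)
words as zero    = [] ∷ []
words as (suc k) = cartesianProductWith _∷_ as (words as k)

W : ∀ n → ℕ → List (List (Fin n))
W n = words (allFin n)

∑-words-suc : ∀ (as : List A) k f → ∑ (words as (suc k)) f ≡ ∑ as (λ a → ∑ (words as k) (λ w → f (a ∷ w)))
∑-words-suc as k f = ∑-cartesianProductWith _∷_ as (words as k) f

∑-words-+ : ∀ (as : List A) j k f → ∑ (words as (j + k)) f ≡ ∑ (words as j) (λ u → ∑ (words as k) (λ v → f (u ++ v)))
∑-words-+ as zero    k f = sym (+-identityʳ _)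
∑-words-+ as (suc j) k f = begin
  ∑ (words as (suc (j + k))) f
    ≡⟨ ∑-words-suc as (j + k) f ⟩
  ∑ as (λ a → ∑ (words as (j + k)) (λ w → f (a ∷ w)))
    ≡⟨ ∑-cong as (λ a → ∑-words-+ as j k (λ w → f (a ∷ w))) ⟩
  ∑ as (λ a → ∑ (words as j) (λ u → ∑ (words as k) (λ v → f (a ∷ u ++ v))))
    ≡⟨ sym (∑-words-suc as j (λ u → ∑ (words as k) (λ v → f (u ++ v)))) ⟩
  ∑ (words as (suc j)) (λ u → ∑ (words as k) (λ v → f (u ++ v))) ∎
  where open ≡-Reasoning

length-words : ∀ (as : List A) k → length (words as k) ≡ length as ^ k
length-words as k = trans (trans (sym (*-identityʳ _)) (sym (∑-const (words as k) 1))) (go k)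
  where
  go : ∀ k → ∑ (words as k) (λ _ → 1) ≡ length as ^ k
  go zero    = refl
  go (suc k) = trans (∑-words-suc as k _) (trans (∑-cong as (λ _ → go k)) (∑-const as _))

length-W : ∀ n k → length (W n k) ≡ n ^ k
length-W n k = trans (length-words (allFin n) k) (cong (_^ k) (length-tabulate id))

∈-words : ∀ {as : List A} {w} → All (_∈ as) w → w ∈ words as (length w)
∈-words []        = here refl
∈-words (a∈ ∷ w∈) = ∈-cartesianProductWith⁺ _∷_ a∈ (∈-words w∈)

∈-words⇒length : ∀ {as : List A} k {w} → w ∈ words as k → length w ≡ k
∈-words⇒length zero    (here refl) = refl
∈-words⇒length {as = as} (suc k) w∈ with ∈-cartesianProductWith⁻ _∷_ as (words as k) w∈
... | a , w′ , _ , w′∈ , refl = cong suc (∈-words⇒length k w′∈)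

∈-W : ∀ {k} (w : List (Fin n)) → length w ≡ k → w ∈ W n k
∈-W w refl = ∈-words (All.tabulate (λ {x} _ → ∈-allFin x))

words-unique : ∀ {as : List A} k → Unique as → Unique (words as k)
words-unique zero    u = [] ∷ []
words-unique (suc k) u = Unique.cartesianProductWith⁺ _∷_ List.∷-injective u (words-unique k u)

W-unique : ∀ n k → Unique (W n k)
W-unique n k = words-unique k (Unique.allFin⁺ n)

_≟ʷ_ : DecidableEquality (List (Fin n))
_≟ʷ_ = List.≡-dec Fin._≟_

_∈ᵇ_ : Fin n → List (Fin n) → Bool
x ∈ᵇ w = does (Any.any? (x Fin.≟_) w)

∈ᵇ⇒∈ : ∀ (x : Fin n) w → x ∈ᵇ w ≡ true → x ∈ w
∈ᵇ⇒∈ x w = does⇒ (Any.any? (x Fin.≟_) w)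

∈⇒∈ᵇ : ∀ {x : Fin n} {w} → x ∈ w → x ∈ᵇ w ≡ true
∈⇒∈ᵇ {x = x} {w} = dec-true (Any.any? (x Fin.≟_) w)

#-head : ∀ {n} (x : Fin n) (f : Fin n → ℕ) → ∑ (allFin n) (λ y → 𝟙 (does (x Fin.≟ y)) * f y) ≤ f x
#-head {n} x f = begin
  ∑ (allFin n) (λ y → 𝟙 (does (x Fin.≟ y)) * f y) ≤⟨ ∑-mono (allFin n) (λ {y} _ → at y) ⟩
  ∑ (allFin n) (λ y → f x * 𝟙 (does (x Fin.≟ y))) ≡⟨ ∑-*ˡ (f x) (allFin n) _ ⟨
  f x * # (allFin n) (λ y → does (x Fin.≟ y))     ≤⟨ *-monoʳ-≤ (f x) (∑-≡-≤1 Fin._≟_ (Unique.allFin⁺ n) x) ⟩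
  f x * 1                                         ≡⟨ *-identityʳ (f x) ⟩
  f x                                             ∎
  where
  open ≤-Reasoning
  at : ∀ y → 𝟙 (does (x Fin.≟ y)) * f y ≤ f x * 𝟙 (does (x Fin.≟ y))
  at y with x Fin.≟ y
  ... | yes refl = ≤-reflexive (*-comm 1 (f x))
  ... | no  _    = z≤n

Symmetric : (List (Fin n) → Bool) → Set
Symmetric f = ∀ {u v} → u ↭ v → f u ≡ f v

-- The letter `x` occupies one of `k` positions, and symmetry moves it to the front. For `k = 0`
-- both sides vanish, so the truncation in `k ∸ 1` is harmless.
#-containing : ∀ k (f : List (Fin n) → Bool) → Symmetric f → ∀ x →
  # (W n k) (λ v → f v ∧ (x ∈ᵇ v)) ≤ k * # (W n (k ∸ 1)) (λ v → f (x ∷ v))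
#-containing zero f sf x with f []
... | true  = ≤-refl
... | false = ≤-refl
#-containing {n} (suc k) f sf x = begin
  # (W n (suc k)) (λ v → f v ∧ (x ∈ᵇ v))
    ≡⟨ ∑-words-suc (allFin n) k _ ⟩
  ∑ (allFin n) (λ y → ∑ (W n k) (λ v → 𝟙 (f (y ∷ v) ∧ (x ∈ᵇ (y ∷ v)))))
    ≤⟨ ∑-mono (allFin n) (λ {y} _ → ∑-mono (W n k) (λ {v} _ → split y v)) ⟩
  ∑ (allFin n) (λ y → ∑ (W n k) (λ v → 𝟙 (does (x Fin.≟ y)) * 𝟙 (f (y ∷ v)) + 𝟙 (f (y ∷ v) ∧ (x ∈ᵇ v))))
    ≡⟨ ∑-cong (allFin n) (λ y → trans (∑-+ (W n k) _ _) (cong (_+ # (W n k) (λ v → f (y ∷ v) ∧ (x ∈ᵇ v))) (sym (∑-*ˡ (𝟙 (does (x Fin.≟ y))) (W n k) _)))) ⟩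
  ∑ (allFin n) (λ y → 𝟙 (does (x Fin.≟ y)) * # (W n k) (λ v → f (y ∷ v)) + # (W n k) (λ v → f (y ∷ v) ∧ (x ∈ᵇ v)))
    ≡⟨ ∑-+ (allFin n) _ _ ⟩
  ∑ (allFin n) (λ y → 𝟙 (does (x Fin.≟ y)) * # (W n k) (λ v → f (y ∷ v))) +
    ∑ (allFin n) (λ y → # (W n k) (λ v → f (y ∷ v) ∧ (x ∈ᵇ v)))
    ≤⟨ +-mono-≤ (#-head x (λ y → # (W n k) (λ v → f (y ∷ v)))) rest ⟩
  # (W n k) (λ v → f (x ∷ v)) + k * # (W n k) (λ v → f (x ∷ v)) ∎
  where
  open ≤-Reasoning
  split : ∀ y v → 𝟙 (f (y ∷ v) ∧ (x ∈ᵇ (y ∷ v))) ≤ 𝟙 (does (x Fin.≟ y)) * 𝟙 (f (y ∷ v)) + 𝟙 (f (y ∷ v) ∧ (x ∈ᵇ v))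
  split y v with x Fin.≟ y
  ... | no _  = ≤-refl
  ... | yes _ with f (y ∷ v)
  ...   | true  = s≤s z≤n
  ...   | false = z≤n
  rest : ∑ (allFin n) (λ y → # (W n k) (λ v → f (y ∷ v) ∧ (x ∈ᵇ v))) ≤ k * # (W n k) (λ v → f (x ∷ v))
  rest = begin
    ∑ (allFin n) (λ y → # (W n k) (λ v → f (y ∷ v) ∧ (x ∈ᵇ v)))
      ≤⟨ ∑-mono (allFin n) (λ {y} _ → #-containing k (λ v → f (y ∷ v)) (λ p → sf (Perm.prep y p)) x) ⟩
    ∑ (allFin n) (λ y → k * # (W n (k ∸ 1)) (λ v → f (y ∷ x ∷ v)))
      ≡⟨ ∑-*ˡ k (allFin n) _ ⟨
    k * ∑ (allFin n) (λ y → # (W n (k ∸ 1)) (λ v → f (y ∷ x ∷ v)))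
      ≤⟨ step k ⟩
    k * # (W n k) (λ v → f (x ∷ v)) ∎
    where
    step : ∀ k → k * ∑ (allFin n) (λ y → # (W n (k ∸ 1)) (λ v → f (y ∷ x ∷ v))) ≤ k * # (W n k) (λ v → f (x ∷ v))
    step zero    = z≤n
    step (suc k) = *-monoʳ-≤ (suc k) (≤-reflexive (trans
      (∑-cong (allFin n) (λ y → ∑-cong (W n k) (λ v → cong 𝟙 (sf (Perm.swap y x ↭-refl)))))
      (sym (∑-words-suc (allFin n) k (λ v → 𝟙 (f (x ∷ v)))))))

toSubset : List (Fin n) → Subset n
toSubset []      = ∅
toSubset (x ∷ w) = ⁅ x ⁆ ∪ toSubset w

∈-toSubset⁻ : ∀ {x : Fin n} w → x ∈ₛ toSubset w → x ∈ w
∈-toSubset⁻ []      x∈ = ⊥-elim (∉⊥ x∈)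
∈-toSubset⁻ (y ∷ w) x∈ with x∈p∪q⁻ ⁅ y ⁆ (toSubset w) x∈
... | inj₁ x∈y = here (x∈⁅y⁆⇒x≡y y x∈y)
... | inj₂ x∈w = there (∈-toSubset⁻ w x∈w)

∈-toSubset⁺ : ∀ {x : Fin n} {w} → x ∈ w → x ∈ₛ toSubset w
∈-toSubset⁺ {x = x} (here refl) = x∈p∪q⁺ (inj₁ (x∈⁅x⁆ x))
∈-toSubset⁺ (there x∈)  = x∈p∪q⁺ (inj₂ (∈-toSubset⁺ x∈))

toSubset-↭ : ∀ {u v : List (Fin n)} → u ↭ v → toSubset u ≡ toSubset v
toSubset-↭ Perm.refl = refl
toSubset-↭ (Perm.prep x p) = cong (⁅ x ⁆ ∪_) (toSubset-↭ p)
toSubset-↭ {n} {u = x ∷ y ∷ u} {v = y ∷ x ∷ v} (Perm.swap x y p) = begin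
  ⁅ x ⁆ ∪ (⁅ y ⁆ ∪ toSubset u)  ≡⟨ ∪-assoc ⁅ x ⁆ ⁅ y ⁆ (toSubset u) ⟨
  (⁅ x ⁆ ∪ ⁅ y ⁆) ∪ toSubset u  ≡⟨ cong₂ _∪_ (∪-comm ⁅ x ⁆ ⁅ y ⁆) (toSubset-↭ p) ⟩
  (⁅ y ⁆ ∪ ⁅ x ⁆) ∪ toSubset v  ≡⟨ ∪-assoc ⁅ y ⁆ ⁅ x ⁆ (toSubset v) ⟩
  ⁅ y ⁆ ∪ (⁅ x ⁆ ∪ toSubset v)  ∎
  where open ≡-Reasoning
toSubset-↭ (Perm.trans p q) = trans (toSubset-↭ p) (toSubset-↭ q)

∣⁅x⁆∪p∣≤ : ∀ (x : Fin n) p → ∣ ⁅ x ⁆ ∪ p ∣ ≤ suc ∣ p ∣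
∣⁅x⁆∪p∣≤ zero    (true  ∷ p) = m≤n⇒m≤1+n (≤-reflexive (cong (suc ∘ ∣_∣) (∪-identityˡ p)))
∣⁅x⁆∪p∣≤ zero    (false ∷ p) = ≤-reflexive (cong (suc ∘ ∣_∣) (∪-identityˡ p))
∣⁅x⁆∪p∣≤ (suc x) (true  ∷ p) = s≤s (∣⁅x⁆∪p∣≤ x p)
∣⁅x⁆∪p∣≤ (suc x) (false ∷ p) = ∣⁅x⁆∪p∣≤ x p

⁅x⁆∪p≡p : ∀ {x : Fin n} {p} → x ∈ₛ p → ⁅ x ⁆ ∪ p ≡ p
⁅x⁆∪p≡p {p = _ ∷ p} here       = cong (true ∷_) (∪-identityˡ p)
⁅x⁆∪p≡p {p = s ∷ p} (there x∈) = cong (s ∷_) (⁅x⁆∪p≡p x∈)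

∣toSubset∣≤ : ∀ (w : List (Fin n)) → ∣ toSubset w ∣ ≤ length w
∣toSubset∣≤ {n} []  = ≤-reflexive (∣⊥∣≡0 n)
∣toSubset∣≤ (x ∷ w) = ≤-trans (∣⁅x⁆∪p∣≤ x (toSubset w)) (s≤s (∣toSubset∣≤ w))

-- Each letter adds at most one element, so a repetition leaves the set too small. Hence words that
-- order an edge are automatically free of repetitions.
∣toSubset∣≡⇒Unique : ∀ (w : List (Fin n)) → ∣ toSubset w ∣ ≡ length w → Unique w
∣toSubset∣≡⇒Unique []      _  = []
∣toSubset∣≡⇒Unique (x ∷ w) eq =
  All.tabulate (λ { y∈ refl → <-irrefl refl (begin-strict
    length w            <⟨ n<1+n _ ⟩
    suc (length w)      ≡⟨ eq ⟨
    ∣ toSubset (x ∷ w) ∣ ≡⟨ cong ∣_∣ (⁅x⁆∪p≡p (∈-toSubset⁺ y∈)) ⟩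
    ∣ toSubset w ∣       ≤⟨ ∣toSubset∣≤ w ⟩
    length w            ∎) })
  ∷ ∣toSubset∣≡⇒Unique w (≤-antisym (∣toSubset∣≤ w) (≤-pred (≤-trans (≤-reflexive (sym eq)) (∣⁅x⁆∪p∣≤ x (toSubset w)))))
  where open ≤-Reasoning

elems : Subset n → List (Fin n)
elems []          = []
elems (true  ∷ p) = zero ∷ map suc (elems p)
elems (false ∷ p) = map suc (elems p)

length-elems : ∀ (p : Subset n) → length (elems p) ≡ ∣ p ∣
length-elems []          = refl
length-elems (true  ∷ p) = cong suc (trans (length-map suc (elems p)) (length-elems p))
length-elems (false ∷ p) = trans (length-map suc (elems p)) (length-elems p)

toSubset-elems : ∀ (p : Subset n) → toSubset (elems p) ≡ p
toSubset-elems []          = refl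
toSubset-elems (s ∷ p) = aux s
  where
  shift : ∀ w → toSubset (map suc w) ≡ false ∷ toSubset w
  shift []      = refl
  shift (x ∷ w) = cong (⁅ suc x ⁆ ∪_) (shift w)
  aux : ∀ s → toSubset (elems (s ∷ p)) ≡ s ∷ p
  aux false = trans (shift (elems p)) (cong (false ∷_) (toSubset-elems p))
  aux true  = trans (cong (⁅ zero ⁆ ∪_) (shift (elems p))) (cong (true ∷_) (trans (∪-identityˡ _) (toSubset-elems p)))

_≟ₛ_ : DecidableEquality (Subset n)
_≟ₛ_ = Vec.≡-dec Bool._≟_

-- Growing a tree vertex by vertex

_≟ᵥ_ : DecidableEquality (BVertex s t)
_≟ᵥ_ = Sum.≡-dec Fin._≟_ Fin._≟_

_∈ᵥ?_ : (z : BVertex s t) (P : List (BVertex s t)) → Dec (z ∈ P)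
z ∈ᵥ? P = Any.any? (z ≟ᵥ_) P

Adj-sym : (E : Fin s → Fin t → Bool) → ∀ x y → Adj E x y → Adj E y x
Adj-sym E (inj₁ _) (inj₂ _) e = e
Adj-sym E (inj₂ _) (inj₁ _) e = e

-- A subtree listed with its newest vertex first. Since the parent is the only earlier neighbour, a
-- new blob has to fit a single placed blob. The root lies in U because the embedding with
-- single-vertex blobs starts from a word that has t partners.
data Grow {s t} (E : Fin s → Fin t → Bool) : List (BVertex s t) → Set where
  root : ∀ i → Grow E (inj₁ i ∷ [])
  grow : ∀ {P p z} → Grow E P → p ∈ P → z ∉ P → Adj E p z → (∀ {q} → q ∈ P → Adj E q z → q ≡ p) → Grow E (z ∷ P)

module _ {s t} (E : Fin s → Fin t → Bool) where

  data Path : BVertex s t → List (BVertex s t) → BVertex s t → Set where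
    [_]  : ∀ x → Path x (x ∷ []) x
    _∷_ : ∀ {x y vs z} → Adj E x y → Path y vs z → Path x (x ∷ vs) z

  snoc : ∀ {x vs y z} → Path x vs y → Adj E y z → Path x (vs ++ z ∷ []) z
  snoc [ x ]   e = e ∷ [ _ ]
  snoc (d ∷ p) e = d ∷ snoc p e

  closed : ∀ {w x vs y z} → Adj E w x → Path x vs y → Adj E y z → Linked (Adj E) (w ∷ vs ++ z ∷ [])
  closed d [ x ]   e = d ∷ e ∷ [-]
  closed d (c ∷ p) e = d ∷ closed c p e

  2≤length : ∀ {x vs y} → Path x vs y → x ≢ y → 2 ≤ length vs
  2≤length [ x ]         x≢y = contradiction refl x≢y
  2≤length (_ ∷ [ _ ])   _   = s≤s (s≤s z≤n)
  2≤length (_ ∷ (_ ∷ _)) _   = s≤s (s≤s z≤n)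

  SimplyConnected : List (BVertex s t) → Set
  SimplyConnected P = ∀ {x y} → x ∈ P → y ∈ P → ∃[ vs ] Path x vs y × Unique vs × All (_∈ P) vs

  grow-connected : ∀ {P} → Grow E P → SimplyConnected P
  grow-connected (root i) (here refl) (here refl) = _ , [ _ ] , [] ∷ [] , here refl ∷ []
  grow-connected (grow g p∈ z∉ e u) (here refl) (here refl) = _ , [ _ ] , [] ∷ [] , here refl ∷ []
  grow-connected (grow {p = p} {z} g p∈ z∉ e u) (here refl) (there y∈) with grow-connected g p∈ y∈
  ... | vs , path , uniq , in-P = _ , Adj-sym E p z e ∷ path ,
        All.map (λ { v∈ refl → z∉ v∈ }) in-P ∷ uniq , here refl ∷ All.map there in-P
  grow-connected (grow {p = p} {z} g p∈ z∉ e u) (there x∈) (here refl) with grow-connected g x∈ p∈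
  ... | vs , path , uniq , in-P = _ , snoc path e ,
        Unique.++⁺ uniq ([] ∷ []) (λ { (v∈ , here refl) → z∉ (All.lookup in-P v∈) }) ,
        All.++⁺ (All.map there in-P) (here refl ∷ [])
  grow-connected (grow g p∈ z∉ e u) (there x∈) (there y∈) with grow-connected g x∈ y∈
  ... | vs , path , uniq , in-P = vs , path , uniq , All.map there in-P

  module _ (acyclic : Acyclic E) where

    -- A second neighbour `q`, joined to `p` by a simple path inside `P`, would close a cycle
    -- through `z`.
    unique-parent : ∀ {P p z} → Grow E P → p ∈ P → z ∉ P → Adj E p z → ∀ {q} → q ∈ P → Adj E q z → q ≡ p
    unique-parent {P} {p} {z} g p∈ z∉ e {q} q∈ d with q ≟ᵥ p
    ... | yes q≡p = q≡p
    ... | no  q≢p with grow-connected g p∈ q∈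
    ...   | vs , path , uniq , in-P = contradiction
            (2≤length path (q≢p ∘ sym) , All.map (λ { v∈ refl → z∉ v∈ }) in-P ∷ uniq , closed (Adj-sym E p z e) path d)
            (acyclic (z ∷ vs))

    reach : ∀ {P x y} → Grow E P → x ∈ P → Star (Adj E) x y → ∃[ Q ] Grow E Q × (∀ {z} → z ∈ P → z ∈ Q) × y ∈ Q
    reach g x∈ ε = _ , g , id , x∈
    reach {P} g x∈ (_◅_ {j = w} e path) with w ∈ᵥ? P
    ... | yes w∈ = reach g w∈ path
    ... | no  w∉ with reach (grow g x∈ w∉ e (unique-parent g x∈ w∉ e)) (here refl) path
    ...   | Q , g′ , P⊆Q , y∈ = Q , g′ , P⊆Q ∘ there , y∈

    spanning : Connected E → Fin s → ∃[ Q ] Grow E Q × (∀ z → z ∈ Q)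
    spanning connected i = let Q , g , _ , all = go vertices in Q , g , λ z → all (∈-vertices z)
      where
      vertices : List (BVertex s t)
      vertices = map inj₁ (allFin s) ++ map inj₂ (allFin t)
      ∈-vertices : ∀ z → z ∈ vertices
      ∈-vertices (inj₁ x) = ∈-++⁺ˡ (∈-map⁺ inj₁ (∈-allFin x))
      ∈-vertices (inj₂ y) = ∈-++⁺ʳ (map inj₁ (allFin s)) (∈-map⁺ inj₂ (∈-allFin y))
      go : ∀ zs → ∃[ Q ] Grow E Q × inj₁ i ∈ Q × (∀ {z} → z ∈ zs → z ∈ Q)
      go []       = _ , root i , here refl , λ ()
      go (z ∷ zs) with go zs
      ... | Q , g , i∈ , zs⊆ with reach g i∈ (connected (inj₁ i) z)
      ...   | Q′ , g′ , Q⊆ , z∈ = Q′ , g′ , Q⊆ i∈ , λ { (here refl) → z∈ ; (there z′∈) → Q⊆ (zs⊆ z′∈) }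

-- Placing the vertices of a tree on pairwise disjoint words

module _ {n s t : ℕ} where

  Placement : Set
  Placement = BVertex s t → List (Fin n)

  PairwiseDisjoint : Placement → List (BVertex s t) → Set
  PairwiseDisjoint emb P = ∀ {x y} → x ∈ P → y ∈ P → x ≢ y → Disjoint (emb x) (emb y)

  used : Placement → List (BVertex s t) → List (Fin n)
  used emb P = concat (map emb P)

  ∈-used : ∀ emb {P z x} → z ∈ P → x ∈ emb z → x ∈ used emb P
  ∈-used emb z∈ x∈ = ∈-concat⁺′ x∈ (∈-map⁺ emb z∈)

  used⁻ : ∀ emb P {x} → x ∈ used emb P → ∃[ z ] z ∈ P × x ∈ emb z
  used⁻ emb P x∈ with ∈-concat⁻′ (map emb P) x∈
  ... | w , x∈w , w∈ with ∈-map⁻ emb w∈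
  ...   | z , z∈ , refl = z , z∈ , x∈w

  length-used : ∀ emb P {ℓ} → (∀ {z} → z ∈ P → length (emb z) ≤ ℓ) → length (used emb P) ≤ length P * ℓ
  length-used emb []      h = z≤n
  length-used emb (z ∷ P) h = ≤-trans (≤-reflexive (length-++ (emb z))) (+-mono-≤ (h (here refl)) (length-used emb P (h ∘ there)))

  update : Placement → BVertex s t → List (Fin n) → Placement
  update emb z w y with y ≟ᵥ z
  ... | yes _ = w
  ... | no  _ = emb y

  update-≡ : ∀ emb z w → update emb z w z ≡ w
  update-≡ emb z w with z ≟ᵥ z
  ... | yes _   = refl
  ... | no  z≢z = contradiction refl z≢z

  update-∈ : ∀ emb {P z} w → z ∉ P → ∀ {y} → y ∈ P → update emb z w y ≡ emb y
  update-∈ emb {z = z} w z∉ {y} y∈ with y ≟ᵥ z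
  ... | yes refl = contradiction y∈ z∉
  ... | no  _    = refl

  update-disjoint : ∀ {emb P z w} → PairwiseDisjoint emb P → z ∉ P → Disjoint w (used emb P) →
    PairwiseDisjoint (update emb z w) (z ∷ P)
  update-disjoint pd z∉ dj (here refl) (here refl) x≢y = contradiction refl x≢y
  update-disjoint {emb} {z = z} {w} pd z∉ dj (here refl) (there y∈) _
    rewrite update-≡ emb z w | update-∈ emb w z∉ y∈ = λ (v∈ , v∈y) → dj (v∈ , ∈-used emb y∈ v∈y)
  update-disjoint {emb} {z = z} {w} pd z∉ dj (there x∈) (here refl) _
    rewrite update-≡ emb z w | update-∈ emb w z∉ x∈ = λ (v∈x , v∈) → dj (v∈ , ∈-used emb x∈ v∈x)
  update-disjoint {emb} {z = z} {w} pd z∉ dj (there x∈) (there y∈) x≢y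
    rewrite update-∈ emb w z∉ x∈ | update-∈ emb w z∉ y∈ = pd x∈ y∈ x≢y

  Embedding : (Fin s → Fin t → Bool) → (List (Fin n) → List (Fin n) → Set) → Set
  Embedding E R = Σ Placement λ emb → (∀ {x y : BVertex s t} → x ≢ y → Disjoint (emb x) (emb y)) ×
                           (∀ i j → E i j ≡ true → R (emb (inj₁ i)) (emb (inj₂ j)))

  -- Greedy embedding: the two moves supply a partner off any `m` given vertices, and
  -- `length P * ℓ ≤ m` leaves room for all words of the tree.
  module PureEmbedding (E : Fin s → Fin t → Bool) (R : List (Fin n) → List (Fin n) → Set) (ℓ m : ℕ)
    (lengths : ∀ {u v} → R u v → length u ≤ ℓ × length v ≤ ℓ)
    (moveᵥ : ∀ {u v} → R u v → ∀ w → length w ≤ m → ∃[ v′ ] R u v′ × Disjoint v′ w)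
    (moveᵤ : ∀ {u v} → R u v → ∀ w → length w ≤ m → ∃[ u′ ] R u′ v × Disjoint u′ w)
    where

    -- To place the next neighbour of a word it suffices that the word belongs to some related pair;
    -- this is the invariant.
    Occurs : BVertex s t → List (Fin n) → Set
    Occurs (inj₁ _) u = ∃[ v ] R u v
    Occurs (inj₂ _) v = ∃[ u ] R u v

    Occurs⇒length : ∀ z {w} → Occurs z w → length w ≤ ℓ
    Occurs⇒length (inj₁ _) (_ , r) = proj₁ (lengths r)
    Occurs⇒length (inj₂ _) (_ , r) = proj₂ (lengths r)

    Related : BVertex s t → BVertex s t → List (Fin n) → List (Fin n) → Set
    Related (inj₁ _) (inj₂ _) u v = R u v
    Related (inj₂ _) (inj₁ _) v u = R u v
    Related _        _        _ _ = ⊥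

    Related-sym : ∀ x y {u v} → Related x y u v → Related y x v u
    Related-sym (inj₁ _) (inj₂ _) r = r
    Related-sym (inj₂ _) (inj₁ _) r = r

    State : List (BVertex s t) → Set
    State P = ∃[ emb ] PairwiseDisjoint emb P × (∀ {z} → z ∈ P → Occurs z (emb z)) ×
                       (∀ {x y} → x ∈ P → y ∈ P → Adj E x y → Related x y (emb x) (emb y))

    extend : ∀ p z {w} → Adj E p z → Occurs p w → ∀ us → length us ≤ m → ∃[ w′ ] Occurs z w′ × Related p z w w′ × Disjoint w′ us
    extend (inj₁ _) (inj₂ _) e (v , r) us len with moveᵥ r us len
    ... | v′ , r′ , dj = v′ , (_ , r′) , r′ , dj
    extend (inj₂ _) (inj₁ _) e (u , r) us len with moveᵤ r us len
    ... | u′ , r′ , dj = u′ , (_ , r′) , r′ , dj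

    Adj-irrefl : ∀ z → ¬ Adj E z z
    Adj-irrefl (inj₁ _) ()
    Adj-irrefl (inj₂ _) ()

    place : ∀ {u v} → R u v → ∀ {P} → Grow E P → length P * ℓ ≤ m → State P
    place {u} r (root i) _ = (λ _ → u) , (λ { (here refl) (here refl) x≢y → contradiction refl x≢y }) ,
      (λ { (here refl) → _ , r }) , λ { (here refl) (here refl) () }
    place r (grow {P} {p} {z} g p∈ z∉ e unique) len with place r g (≤-trans (m≤n+m _ ℓ) len)
    ... | emb , pd , occ , rel
      with extend p z e (occ p∈) (used emb P)
             (≤-trans (length-used emb P (λ z∈ → Occurs⇒length _ (occ z∈))) (≤-trans (m≤n+m _ ℓ) len))
    ...   | w , occ-w , rel-w , dj = update emb z w , update-disjoint pd z∉ dj , occ′ , rel′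
      where
      occ′ : ∀ {y} → y ∈ z ∷ P → Occurs y (update emb z w y)
      occ′ (here refl) rewrite update-≡ emb z w = occ-w
      occ′ (there y∈)  rewrite update-∈ emb w z∉ y∈ = occ y∈
      rel′ : ∀ {x y} → x ∈ z ∷ P → y ∈ z ∷ P → Adj E x y → Related x y (update emb z w x) (update emb z w y)
      rel′ (here refl) (here refl) d = ⊥-elim (Adj-irrefl z d)
      rel′ {y = y} (here refl) (there y∈) d with refl ← unique y∈ (Adj-sym E z y d)
        rewrite update-≡ emb z w | update-∈ emb w z∉ y∈ = Related-sym p z rel-w
      rel′ (there x∈) (here refl) d with refl ← unique x∈ d
        rewrite update-≡ emb z w | update-∈ emb w z∉ x∈ = rel-w
      rel′ (there x∈) (there y∈) d rewrite update-∈ emb w z∉ x∈ | update-∈ emb w z∉ y∈ = rel x∈ y∈ d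

    embed : ∀ {u v} → R u v → ∀ {P} → Grow E P → length P * ℓ ≤ m → (∀ z → z ∈ P) → Embedding E R
    embed r g len all with place r g len
    ... | emb , pd , _ , rel = emb , (λ {x} {y} → pd (all x) (all y)) , λ i j → rel (all (inj₁ i)) (all (inj₂ j))

-- From blobs given as words to a copy of the blowup

lookup-injective : ∀ {xs : List A} → Unique xs → ∀ i j → lookup xs i ≡ lookup xs j → i ≡ j
lookup-injective (_ ∷ _)  zero    zero    _  = refl
lookup-injective (x∉ ∷ _) zero    (suc j) eq = contradiction eq (All.lookup x∉ (∈-lookup j))
lookup-injective (x∉ ∷ _) (suc i) zero    eq = contradiction (sym eq) (All.lookup x∉ (∈-lookup i))
lookup-injective (_ ∷ u)  (suc i) (suc j) eq = cong suc (lookup-injective u i j eq)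

cast-injective : ∀ {k l} (eq : k ≡ l) {x y} → Fin.cast eq x ≡ Fin.cast eq y → x ≡ y
cast-injective refl {x} {y} h = trans (sym (Fin.cast-is-id refl x)) (trans h (Fin.cast-is-id refl y))

++-unique⁻ : ∀ (xs : List A) {ys} → Unique (xs ++ ys) → Unique xs × Unique ys
++-unique⁻ []       u        = [] , u
++-unique⁻ (x ∷ xs) (x∉ ∷ u) = let u₁ , u₂ = ++-unique⁻ xs u in All.++⁻ˡ xs x∉ ∷ u₁ , u₂

IsEdge : List (Subset n) → ℕ → ℕ → List (Fin n) → List (Fin n) → Set
IsEdge Es a b u v = length u ≡ a × length v ≡ b × toSubset (u ++ v) ∈ Es

neighbour : ∀ {E : Fin s → Fin t → Bool} {x y : BVertex s t} → Star (Adj E) x y → x ≢ y → ∃[ z ] Adj E x z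
neighbour ε       x≢y = contradiction refl x≢y
neighbour (e ◅ _) _   = _ , e

module _ {n s t a b : ℕ} (E : Fin s → Fin t → Bool) (connected : Connected E) (i₀ : Fin s) (j₀ : Fin t)
  (H : RGraph (a + b) n) where

  -- Every tree vertex has a neighbour, so its blob is part of an ordering of an edge with a + b
  -- distinct vertices. This yields the length of the blob and injectivity within it.
  embedding⇒blowup : Embedding E (IsEdge (edges H) a b) → ContainsBlowup s t a b E H
  embedding⇒blowup (emb , disjoint , edge) = φ , φ-injective , φ-edge
    where
    unique : ∀ u v → IsEdge (edges H) a b u v → Unique (u ++ v)
    unique u v (lu , lv , e∈) = ∣toSubset∣≡⇒Unique (u ++ v)
      (trans (All.lookup (uniform H) e∈) (sym (trans (length-++ u) (cong₂ _+_ lu lv))))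

    blobᵤ : ∀ i → length (emb (inj₁ i)) ≡ a × Unique (emb (inj₁ i))
    blobᵤ i with neighbour (connected (inj₁ i) (inj₂ j₀)) (λ ())
    ... | inj₂ j , e with edge i j e
    ...   | is@(lu , _) = lu , proj₁ (++-unique⁻ (emb (inj₁ i)) (unique (emb (inj₁ i)) (emb (inj₂ j)) is))

    blobᵥ : ∀ j → length (emb (inj₂ j)) ≡ b × Unique (emb (inj₂ j))
    blobᵥ j with neighbour (connected (inj₂ j) (inj₁ i₀)) (λ ())
    ... | inj₁ i , e with edge i j e
    ...   | is@(_ , lv , _) = lv , proj₂ (++-unique⁻ (emb (inj₁ i)) (unique (emb (inj₁ i)) (emb (inj₂ j)) is))

    φ : BlowVertex s t a b → Fin n
    φ (inj₁ (i , x)) = lookup (emb (inj₁ i)) (Fin.cast (sym (proj₁ (blobᵤ i))) x)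
    φ (inj₂ (j , y)) = lookup (emb (inj₂ j)) (Fin.cast (sym (proj₁ (blobᵥ j))) y)

    φ-injective : Injective _≡_ _≡_ φ
    φ-injective {inj₁ (i , x)} {inj₁ (i′ , x′)} eq with i Fin.≟ i′
    ... | yes refl = cong (λ z → inj₁ (i , z)) (cast-injective (sym (proj₁ (blobᵤ i))) (lookup-injective (proj₂ (blobᵤ i)) _ _ eq))
    ... | no i≢i′ = ⊥-elim (disjoint (i≢i′ ∘ Sum.inj₁-injective) (∈-lookup _ , subst (_∈ emb (inj₁ i′)) (sym eq) (∈-lookup _)))
    φ-injective {inj₂ (j , y)} {inj₂ (j′ , y′)} eq with j Fin.≟ j′
    ... | yes refl = cong (λ z → inj₂ (j , z)) (cast-injective (sym (proj₁ (blobᵥ j))) (lookup-injective (proj₂ (blobᵥ j)) _ _ eq))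
    ... | no j≢j′ = ⊥-elim (disjoint (j≢j′ ∘ Sum.inj₂-injective) (∈-lookup _ , subst (_∈ emb (inj₂ j′)) (sym eq) (∈-lookup _)))
    φ-injective {inj₁ (i , x)} {inj₂ (j , y)} eq = ⊥-elim (disjoint {inj₁ i} {inj₂ j} (λ ()) (∈-lookup _ , subst (_∈ emb (inj₂ j)) (sym eq) (∈-lookup _)))
    φ-injective {inj₂ (j , y)} {inj₁ (i , x)} eq = ⊥-elim (disjoint {inj₂ j} {inj₁ i} (λ ()) (∈-lookup _ , subst (_∈ emb (inj₁ i)) (sym eq) (∈-lookup _)))

    lookup-surjective : ∀ {k} {w : List (Fin n)} (eq : length w ≡ k) {v} → v ∈ w → ∃[ x ] lookup w (Fin.cast (sym eq) x) ≡ v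
    lookup-surjective {w = w} refl v∈ = index v∈ , trans (cong (lookup w) (Fin.cast-is-id refl _)) (sym (Any.lookup-index v∈))

    φ-edge : ∀ i j → E i j ≡ true → _
    φ-edge i j e = toSubset (emb (inj₁ i) ++ emb (inj₂ j)) , proj₂ (proj₂ (edge i j e)) , λ v → mk⇔ (to v) (from v)
      where
      to : ∀ v → v ∈ₛ toSubset (emb (inj₁ i) ++ emb (inj₂ j)) → _
      to v v∈ with ∈-++⁻ (emb (inj₁ i)) (∈-toSubset⁻ _ v∈)
      ... | inj₁ ∈u = inj₁ (lookup-surjective (proj₁ (blobᵤ i)) ∈u)
      ... | inj₂ ∈v = inj₂ (lookup-surjective (proj₁ (blobᵥ j)) ∈v)
      from : ∀ v → (Σ (Fin a) λ x → φ (inj₁ (i , x)) ≡ v) ⊎ (Σ (Fin b) λ y → φ (inj₂ (j , y)) ≡ v) → v ∈ₛ toSubset (emb (inj₁ i) ++ emb (inj₂ j))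
      from v (inj₁ (x , refl)) = ∈-toSubset⁺ (∈-++⁺ˡ {xs = emb (inj₁ i)} (∈-lookup _))
      from v (inj₂ (y , refl)) = ∈-toSubset⁺ (∈-++⁺ʳ (emb (inj₁ i)) (∈-lookup _))

-- Embedding with single-vertex blobs on one side

-- Finite choice under double negation; it provides blocking words for all candidates of a larger
-- core at once.
¬¬-All : ∀ {P : A → Set} (xs : List A) → (∀ x → ¬ ¬ P x) → ¬ ¬ (∀ {x} → x ∈ xs → P x)
¬¬-All []       h k = k λ ()
¬¬-All (x ∷ xs) h k = h x λ px → ¬¬-All xs h λ pxs → k λ { (here refl) → px ; (there x∈) → pxs x∈ }

module _ {P : A → Set} (P? : ∀ x → Dec (P x)) where

  length-filter-¬filter : ∀ xs → length (filter P? xs) + length (filter (¬? ∘ P?) xs) ≡ length xs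
  length-filter-¬filter [] = refl
  length-filter-¬filter (x ∷ xs) with P? x
  ... | yes _ = cong suc (length-filter-¬filter xs)
  ... | no  _ = trans (+-suc _ _) (cong suc (length-filter-¬filter xs))

remove : Fin n → List (Fin n) → List (Fin n)
remove x = filter (λ y → ¬? (x Fin.≟ y))

length-remove : ∀ (x : Fin n) {ys} → Unique ys → length ys ≤ suc (length (remove x ys))
length-remove x [] = z≤n
length-remove x {y ∷ ys} (y∉ ∷ u) with x Fin.≟ y
... | yes refl = s≤s (≤-reflexive (cong length (sym (List.filter-all (λ y → ¬? (x Fin.≟ y)) y∉))))
... | no  _    = s≤s (length-remove x u)

∈-remove : ∀ (x : Fin n) ys {y} → y ∈ remove x ys → y ∈ ys × x ≢ y
∈-remove x ys = ∈-filter⁻ (λ y → ¬? (x Fin.≟ y)) {xs = ys}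

Grow-unique : ∀ {E : Fin s → Fin t → Bool} {P} → Grow E P → Unique P
Grow-unique (root i) = [] ∷ []
Grow-unique (grow g _ z∉ _ _) = All.tabulate (λ { y∈ refl → z∉ y∈ }) ∷ Grow-unique g

rights : List (BVertex s t) → List (Fin t)
rights []           = []
rights (inj₁ _ ∷ P) = rights P
rights (inj₂ j ∷ P) = j ∷ rights P

∈-rights : ∀ (P : List (BVertex s t)) {j} → j ∈ rights P → inj₂ j ∈ P
∈-rights (inj₁ _ ∷ P) j∈          = there (∈-rights P j∈)
∈-rights (inj₂ _ ∷ P) (here refl) = here refl
∈-rights (inj₂ _ ∷ P) (there j∈)  = there (∈-rights P j∈)

rights-unique : ∀ {P : List (BVertex s t)} → Unique P → Unique (rights P)
rights-unique {P = []} [] = []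
rights-unique {P = inj₁ _ ∷ P} (_  ∷ u) = rights-unique u
rights-unique {P = inj₂ j ∷ P} (j∉ ∷ u) = All.tabulate (λ { j′∈ refl → All.lookup j∉ (∈-rights P j′∈) refl }) ∷ rights-unique u

rights-< : ∀ {P : List (BVertex s t)} {j} → Unique P → inj₂ j ∉ P → length (rights P) < t
rights-< {t = t} {P} {j} u j∉ = subst (length (j ∷ rights P) ≤_) (length-tabulate id)
  (Unique-length-≤ Fin._≟_ {ys = allFin t}
    (All.tabulate (λ { j′∈ refl → j∉ (∈-rights P j′∈) }) ∷ rights-unique u) (λ {x} _ → ∈-allFin x))

-- Room for all that a new word must avoid: at most `N` placed words of length at most `suc a`, a
-- core of at most `t` vertices, and `N` spare lists of length at most `t + t`. The leading `suc`
-- keeps powers of the reserve positive.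
coreReserve : ℕ → ℕ → ℕ → ℕ
coreReserve t a N = suc (N * suc a + (t + N * (t + t)))

-- Besides the reserve, a word must avoid one blocking word for each candidate of a core of size
-- `suc c` among the reserved vertices; there are at most `coreReserve t a N ^ suc c` candidates.
coreBound : ℕ → ℕ → ℕ → ℕ → ℕ → ℕ
coreBound t a N c zero    = coreReserve t a N
coreBound t a N c (suc d) = coreReserve t a N + coreReserve t a N ^ suc c * coreBound t a N (suc c) d

-- R u x says that the word u extended by the vertex x is an edge.  A set A of c vertices that have many
-- common partners u (Core A) serves as the image of the first c vertices of V.  Afterwards every new u
-- leaves t − c of its t partners outside the used vertices, unless many u share c + 1 used
-- partners; in that case these c + 1 vertices form a larger core.
module CoreEmbedding {n s t} (E : Fin s → Fin t → Bool) (R : List (Fin n) → Fin n → Set) (a N : ℕ)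
  (R-∉ : ∀ {u x} → R u x → x ∉ u) where

  Rich : List (Fin n) → Set
  Rich u = length u ≤ a × (∃[ S ] Unique S × length S ≡ t × All (R u) S)

  -- Avoiding every short `w` expresses without counting that the common partners of `A` are
  -- numerous. Existence is doubly negated because being a core is never decided.
  Core : List (Fin n) → ℕ → Set
  Core A m = ∀ w → length w ≤ m → ¬ (∀ u → Disjoint u w → Rich u → All (R u) A → ⊥)

  w₀ : ℕ
  w₀ = coreReserve t a N

  bound : ℕ → ℕ → ℕ
  bound = coreBound t a N

  -- At most `c` of the `t` partners are lost to `w`; the upper bound on `F` keeps the spare lists
  -- short.
  Fresh : ℕ → List (Fin n) → List (Fin n) → Set
  Fresh c A w = ∃[ u ] ∃[ F ] Disjoint u w × length u ≤ a × All (R u) A ×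
                Unique F × t ≤ length F + c × length F ≤ t × All (R u) F × Disjoint F w

  _∈?_ : ∀ (x : Fin n) w → Dec (x ∈ w)
  x ∈? w = Any.any? (x Fin.≟_) w

  -- Without a larger core, each list of `suc c` distinct vertices of `w` has a blocking word. Let
  -- `u` avoid `w` and all these words: more than `c` partners of `u` in `w` would contain a blocked
  -- list although `u` avoids its blocking word. For `d = 0` nothing has to be saved, as `c = t`.
  fresh-or-core : ∀ c d → c + d ≡ t → (∀ A d′ → d ≡ suc d′ → Unique A → length A ≡ suc c → ¬ Core A (bound (suc c) d′)) →
    ∀ A → Core A (bound c d) → ∀ w → length w ≤ w₀ → ¬ ¬ Fresh c A w
  fresh-or-core c zero c+d≡t _ A core w len k = core w len λ u u#w (lu , S , uS , lS , RS) rA →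
    k (u , filter (λ x → ¬? (x ∈? w)) S , u#w , lu , rA , Unique.filter⁺ _ uS ,
       ≤-trans (≤-reflexive (trans (sym c+d≡t) (+-identityʳ c))) (m≤n+m c _) ,
       ≤-trans (List.length-filter _ S) (≤-reflexive lS) ,
       All.filter⁺ _ RS , λ (x∈F , x∈w) → proj₂ (∈-filter⁻ (λ x → ¬? (x ∈? w)) {xs = S} x∈F) x∈w)
  fresh-or-core c (suc d) c+d≡t nocore A core w len k = ¬¬-All {P = Blocked} (words w (suc c)) blocked λ blocks →
    core (w ++ gather blocks) (length-w blocks) λ u u#w (lu , S , uS , lS , RS) rA →
      decide blocks u u#w lu S uS lS RS rA
    where
    Blocked : List (Fin n) → Set
    Blocked A′ = ∃[ v ] length v ≤ bound (suc c) d ×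
                 (Unique A′ → length A′ ≡ suc c → ∀ u → Disjoint u v → Rich u → All (R u) A′ → ⊥)
    blocked : ∀ A′ → ¬ ¬ Blocked A′
    -- The empty word is a default for lists that are no candidates. For a candidate, the refutation
    -- `h` would turn it into a core, against `nocore`.
    blocked A′ h = h ([] , z≤n , λ uA lA → ⊥-elim (nocore A′ d refl uA lA λ v lv k′ → h (v , lv , λ _ _ → k′)))

    gather-from : ∀ ws → (∀ {A′} → A′ ∈ ws → Blocked A′) → List (Fin n)
    gather-from []       _ = []
    gather-from (x ∷ ws) b = proj₁ (b (here refl)) ++ gather-from ws (b ∘ there)

    length-gather : ∀ ws (b : ∀ {A′} → A′ ∈ ws → Blocked A′) → length (gather-from ws b) ≤ length ws * bound (suc c) d
    length-gather []       b = z≤n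
    length-gather (x ∷ ws) b = ≤-trans (≤-reflexive (length-++ (proj₁ (b (here refl)))))
      (+-mono-≤ (proj₁ (proj₂ (b (here refl)))) (length-gather ws (b ∘ there)))

    ∈-gather : ∀ ws (b : ∀ {A′} → A′ ∈ ws → Blocked A′) {A′} (A′∈ : A′ ∈ ws) {x} → x ∈ proj₁ (b A′∈) → x ∈ gather-from ws b
    ∈-gather (_ ∷ ws) b (here refl) x∈ = ∈-++⁺ˡ x∈
    ∈-gather (_ ∷ ws) b (there A′∈) x∈ = ∈-++⁺ʳ (proj₁ (b (here refl))) (∈-gather ws (b ∘ there) A′∈ x∈)

    gather : (∀ {A′} → A′ ∈ words w (suc c) → Blocked A′) → List (Fin n)
    gather = gather-from (words w (suc c))

    length-w : (b : ∀ {A′} → A′ ∈ words w (suc c) → Blocked A′) → length (w ++ gather b) ≤ bound c (suc d)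
    length-w b = ≤-trans (≤-reflexive (length-++ w)) (+-mono-≤ len (≤-trans (length-gather (words w (suc c)) b)
      (*-monoˡ-≤ (bound (suc c) d) (≤-trans (≤-reflexive (length-words w (suc c))) (^-monoˡ-≤ (suc c) len)))))

    decide : (b : ∀ {A′} → A′ ∈ words w (suc c) → Blocked A′) → ∀ u → Disjoint u (w ++ gather b) → length u ≤ a → ∀ S → Unique S → length S ≡ t → All (R u) S → All (R u) A → ⊥
    decide b u u#w lu S uS lS RS rA = case length C ≤? c of λ where
        (yes ≤c) → k (u , F , (λ (x∈u , x∈w) → u#w (x∈u , ∈-++⁺ˡ x∈w)) , lu , rA , Unique.filter⁺ _ uS ,
          (begin
             t                     ≡⟨ lS ⟨
             length S              ≡⟨ length-filter-¬filter (λ x → x ∈? w) S ⟨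
             length C + length F   ≤⟨ +-monoˡ-≤ (length F) ≤c ⟩
             c + length F          ≡⟨ +-comm c (length F) ⟩
             length F + c          ∎) ,
          ≤-trans (List.length-filter _ S) (≤-reflexive lS) , All.filter⁺ _ RS ,
          λ (x∈F , x∈w) → proj₂ (∈-filter⁻ (λ x → ¬? (x ∈? w)) {xs = S} x∈F) x∈w)
        (no ≰c) →
          let lA′ : length (take (suc c) C) ≡ suc c
              lA′ = trans (length-take (suc c) C) (m≤n⇒m⊓n≡m (≰⇒> ≰c))
              A′∈ : take (suc c) C ∈ words w (suc c)
              A′∈ = subst (λ l → take (suc c) C ∈ words w l) lA′ (∈-words (All.take⁺ (suc c) (All.all-filter (λ x → x ∈? w) S)))
          in proj₂ (proj₂ (b A′∈)) (Unique.take⁺ (suc c) (Unique.filter⁺ _ uS)) lA′ u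
               (λ (x∈u , x∈v) → u#w (x∈u , ∈-++⁺ʳ w (∈-gather (words w (suc c)) b A′∈ x∈v)))
               (lu , S , uS , lS , RS) (All.take⁺ (suc c) (All.filter⁺ _ RS))
      where
      open ≤-Reasoning
      C F : List (Fin n)
      C = filter (λ x → x ∈? w) S
      F = filter (λ x → ¬? (x ∈? w)) S

  module Greedy (c : ℕ) (A : List (Fin n)) (A-unique : Unique A) (length-A : length A ≡ c) (c≤t : c ≤ t)
    (fresh : ∀ w → length w ≤ w₀ → ¬ ¬ Fresh c A w)
    (kernel : ∀ {u x} → R u x → ∀ w → length w ≤ w₀ → ¬ ¬ Fresh c (x ∷ []) w) where

    record State (P : List (BVertex s t)) : Set where
      field
        emb spare : Placement {n} {s} {t}
        disjoint  : PairwiseDisjoint emb P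
        short     : ∀ {z} → z ∈ P → length (emb z) ≤ suc a × length (spare z) ≤ t + t
        vertex    : ∀ {j} → inj₂ j ∈ P → ∃[ x ] emb (inj₂ j) ≡ x ∷ [] × ∃[ u ] R u x
        related   : ∀ {i j} → inj₁ i ∈ P → inj₂ j ∈ P → E i j ≡ true → All (R (emb (inj₁ i))) (emb (inj₂ j))
        spare-ok  : ∀ {i} → inj₁ i ∈ P → Unique (spare (inj₁ i)) × t ≤ length (spare (inj₁ i)) + length (rights P) ×
                    All (R (emb (inj₁ i))) (spare (inj₁ i)) × Disjoint (spare (inj₁ i)) (used emb P)
        phase     : c ≤ length (rights P) ⊎
                    (∃[ rem ] Unique rem × All (_∈ A) rem × length rem ≤ t × c ≤ length rem + length (rights P) × Disjoint rem (used emb P) ×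
                      (∀ {i} → inj₁ i ∈ P → All (R (emb (inj₁ i))) rem) ×
                      (∀ {j} → inj₂ j ∈ P → All (_∈ A) (emb (inj₂ j))))

    open State

    start : ∀ i → 1 ≤ N → ¬ ¬ State (inj₁ i ∷ [])
    -- Avoiding `A` itself makes `A ++ F` a list of at least `t` distinct partners.
    start i 1≤N k = fresh A (≤-trans (≤-reflexive length-A) (≤-trans c≤t (m≤n⇒m≤1+n (≤-trans (m≤m+n t _) (m≤n+m _ (N * suc a))))))
      λ (u , F , u#A , lu , rA , uF , t≤ , F≤t , rF , F#A) → k record
        { emb      = λ _ → u
        ; spare    = λ _ → A ++ F
        ; disjoint = λ { (here refl) (here refl) x≢y → contradiction refl x≢y }
        ; short    = λ _ → m≤n⇒m≤1+n lu , ≤-trans (≤-reflexive (trans (length-++ A) (cong (_+ length F) length-A))) (+-mono-≤ c≤t F≤t)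
        ; vertex   = λ { (here ()) ; (there ()) }
        ; related  = λ { _ (here ()) ; _ (there ()) }
        ; spare-ok = λ _ → Unique.++⁺ A-unique uF (λ (x∈A , x∈F) → F#A (x∈F , x∈A)) ,
                     ≤-trans t≤ (≤-reflexive (trans (+-comm (length F) c) (trans (cong (_+ length F) (sym length-A)) (trans (sym (length-++ A)) (sym (+-identityʳ _)))))) ,
                     All.++⁺ rA rF ,
                     λ { (x∈AF , x∈u) → [ (λ x∈A → u#A (∈-u u x∈u , x∈A)) , (λ x∈F → R-∉ (All.lookup rF x∈F) (∈-u u x∈u)) ]′ (∈-++⁻ A x∈AF) }
        ; phase    = inj₂ (A , A-unique , All.tabulate id , ≤-trans (≤-reflexive length-A) c≤t , ≤-reflexive (trans (sym length-A) (sym (+-identityʳ _))) ,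
                     (λ (x∈A , x∈u) → u#A (∈-u u x∈u , x∈A)) , (λ _ → rA) , λ { (here ()) ; (there ()) })
        }
      where
      ∈-u : ∀ (u : List (Fin n)) {x} → x ∈ u ++ [] → x ∈ u
      ∈-u u {x} = subst (x ∈_) (List.++-identityʳ u)

    module _ {P} (st : State P) where

      reserved : List (Fin n)
      reserved = used (emb st) P ++ A ++ used (spare st) P

      length-reserved : length P ≤ N → length reserved ≤ w₀
      length-reserved P≤N = m≤n⇒m≤1+n (≤-trans (≤-reflexive (trans (length-++ (used (emb st) P)) (cong (length (used (emb st) P) +_) (length-++ A))))
        (+-mono-≤ (≤-trans (length-used (emb st) P (proj₁ ∘ short st)) (*-monoˡ-≤ (suc a) P≤N))
          (+-mono-≤ (≤-trans (≤-reflexive length-A) c≤t) (≤-trans (length-used (spare st) P (proj₂ ∘ short st)) (*-monoˡ-≤ (t + t) P≤N)))))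

      grow-left : ∀ {i j} → length P ≤ N → inj₂ j ∈ P → inj₁ i ∉ P → (∀ {q} → q ∈ P → Adj E q (inj₁ i) → q ≡ inj₂ j) →
        ¬ ¬ State (inj₁ i ∷ P)
      grow-left {i} {j} P≤N j∈ i∉ unique k with vertex st j∈
      ... | x , emb-j , u₀ , r₀ = case phase st of λ where
          -- Here `F` alone meets the balance, since `c` vertices of V are already placed.
          (inj₁ c≤) → kernel r₀ reserved (length-reserved P≤N)
            λ (u , F , u#w , lu , rx , uF , t≤ , F≤t , rF , F#w) →
              add u (All.head rx) F u#w lu F≤t rF F#w [] [] [] [] z≤n (λ ()) uF
                (≤-trans t≤ (+-monoʳ-≤ (length F) c≤)) (inj₁ c≤)
          -- The parent sits on a core vertex, so a word related to the whole core fits it, and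
          -- `rem` counts among its spare partners.
          (inj₂ (rem , urem , rem⊆A , rem≤t , c≤ , rem#used , rrem , V⊆A)) → fresh reserved (length-reserved P≤N)
            λ (u , F , u#w , lu , rA , uF , t≤ , F≤t , rF , F#w) →
              let r-rem = All.map (All.lookup rA) rem⊆A in
              add u (All.lookup rA (All.head (subst (All (_∈ A)) emb-j (V⊆A j∈)))) F u#w lu F≤t rF F#w rem urem r-rem rem⊆A rem≤t rem#used uF
                (≤-trans t≤ (≤-trans (+-monoʳ-≤ (length F) c≤) (≤-reflexive (rotate (length F) (length rem) (length (rights P))))))
                (inj₂ (rem , urem , rem⊆A , rem≤t , c≤ ,
                       disjoint-used u u#w rem#used rem⊆A ,
                       (λ { (here refl) → subst (λ e → All (R e) rem) (sym (update-≡ (emb st) (inj₁ i) u)) r-rem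
                          ; (there i′∈) → subst (λ e → All (R e) rem) (sym (update-∈ (emb st) u i∉ i′∈)) (rrem i′∈) }) ,
                       λ { (there j′∈) → subst (All (_∈ A)) (sym (update-∈ (emb st) u i∉ j′∈)) (V⊆A j′∈) }))
        where
        rotate : ∀ f r v → f + (r + v) ≡ r + f + v
        rotate = solve-∀

        used-update : ∀ u {y} → y ∈ used (update (emb st) (inj₁ i) u) (inj₁ i ∷ P) → y ∈ u ⊎ y ∈ used (emb st) P
        used-update u y∈ with used⁻ _ (inj₁ i ∷ P) y∈
        ... | _ , here refl , y∈z = inj₁ (subst (_ ∈_) (update-≡ (emb st) (inj₁ i) u) y∈z)
        ... | _ , there z∈  , y∈z = inj₂ (∈-used (emb st) z∈ (subst (_ ∈_) (update-∈ (emb st) u i∉ z∈) y∈z))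

        disjoint-used : ∀ u → Disjoint u reserved → ∀ {rem} → Disjoint rem (used (emb st) P) → All (_∈ A) rem →
          Disjoint rem (used (update (emb st) (inj₁ i) u) (inj₁ i ∷ P))
        disjoint-used u u#w rem# rem⊆A (y∈rem , y∈) with used-update u y∈
        ... | inj₁ y∈u = u#w (y∈u , ∈-++⁺ʳ (used (emb st) P) (∈-++⁺ˡ (All.lookup rem⊆A y∈rem)))
        ... | inj₂ y∈P = rem# (y∈rem , y∈P)

        add : ∀ u → R u x → ∀ F → Disjoint u reserved → length u ≤ a → length F ≤ t → All (R u) F → Disjoint F reserved →
          ∀ rem → Unique rem → All (R u) rem → All (_∈ A) rem → length rem ≤ t → Disjoint rem (used (emb st) P) → Unique F →
          t ≤ length rem + length F + length (rights P) → _ → ⊥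
        add u r F u#w lu F≤t rF F#w rem urem rrem rem⊆A rem≤t rem# uF t≤ ph = k record
          { emb      = emb′
          ; spare    = spare′
          ; disjoint = update-disjoint (disjoint st) i∉ (λ (y∈u , y∈P) → u#w (y∈u , ∈-++⁺ˡ y∈P))
          ; short    = λ { (here refl) → ≤-trans (≤-reflexive (cong length emb-i)) (m≤n⇒m≤1+n lu) ,
                                         ≤-trans (≤-reflexive (trans (cong length spare-i) (length-++ rem))) (+-mono-≤ rem≤t F≤t)
                         ; (there z∈)  → ≤-trans (≤-reflexive (cong length (emb-old z∈))) (proj₁ (short st z∈)) ,
                                         ≤-trans (≤-reflexive (cong length (spare-old z∈))) (proj₂ (short st z∈)) }
          ; vertex   = λ { (there j′∈) → let x′ , eq , rest = vertex st j′∈ in x′ , trans (emb-old j′∈) eq , rest }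
          ; related  = λ { (here refl) (there j′∈) e → case unique j′∈ e of λ { refl →
                             subst₂ (λ p q → All (R p) q) (sym emb-i) (sym (trans (emb-old j′∈) emb-j)) (r ∷ []) }
                         ; (there i′∈) (there j′∈) e → subst₂ (λ p q → All (R p) q) (sym (emb-old i′∈)) (sym (emb-old j′∈)) (related st i′∈ j′∈ e) }
          ; spare-ok = λ { (here refl) → subst₂ (λ p q → Unique q × t ≤ length q + length (rights P) × All (R p) q × Disjoint q (used emb′ (inj₁ i ∷ P))) (sym emb-i) (sym spare-i)
                             (Unique.++⁺ urem uF (λ (y∈rem , y∈F) → F#w (y∈F , ∈-++⁺ʳ (used (emb st) P) (∈-++⁺ˡ (All.lookup rem⊆A y∈rem)))) ,
                              ≤-trans t≤ (≤-reflexive (cong (_+ length (rights P)) (sym (length-++ rem)))) ,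
                              All.++⁺ rrem rF ,
                              λ (y∈ , y∈used) → [ (λ y∈rem → disjoint-used u u#w rem# rem⊆A (y∈rem , y∈used)) ,
                                (λ y∈F → [ R-∉ (All.lookup rF y∈F) , (λ y∈P → F#w (y∈F , ∈-++⁺ˡ y∈P)) ]′ (used-update u y∈used)) ]′ (∈-++⁻ rem y∈))
                         ; (there i′∈) → let uq , tq , rq , dq = spare-ok st i′∈ in
                             subst₂ (λ p q → Unique q × t ≤ length q + length (rights P) × All (R p) q × Disjoint q (used emb′ (inj₁ i ∷ P))) (sym (emb-old i′∈)) (sym (spare-old i′∈))
                             (uq , tq , rq , λ (y∈ , y∈used) → [ (λ y∈u → u#w (y∈u , ∈-++⁺ʳ (used (emb st) P) (∈-++⁺ʳ A (∈-used (spare st) i′∈ y∈)))) ,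
                               (λ y∈P → dq (y∈ , y∈P)) ]′ (used-update u y∈used)) }
          ; phase    = ph
          }
          where
          emb′ spare′ : Placement {n} {s} {t}
          emb′   = update (emb st) (inj₁ i) u
          spare′ = update (spare st) (inj₁ i) (rem ++ F)
          emb-i : emb′ (inj₁ i) ≡ u
          emb-i = update-≡ (emb st) (inj₁ i) u
          emb-old : ∀ {z} → z ∈ P → emb′ z ≡ emb st z
          emb-old = update-∈ (emb st) u i∉
          spare-i : spare′ (inj₁ i) ≡ rem ++ F
          spare-i = update-≡ (spare st) (inj₁ i) (rem ++ F)
          spare-old : ∀ {z} → z ∈ P → spare′ z ≡ spare st z
          spare-old = update-∈ (spare st) (rem ++ F) i∉

      grow-right : ∀ {i j} → Unique P → inj₁ i ∈ P → inj₂ j ∉ P → (∀ {q} → q ∈ P → Adj E q (inj₂ j) → q ≡ inj₁ i) →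
        State (inj₂ j ∷ P)
      grow-right {i} {j} uP i∈ j∉ unique = choose (phase st)
        where
        module _ (x : Fin n) where
          emb′ : Placement {n} {s} {t}
          emb′ = update (emb st) (inj₂ j) (x ∷ [])
          emb-j : emb′ (inj₂ j) ≡ x ∷ []
          emb-j = update-≡ (emb st) (inj₂ j) (x ∷ [])
          emb-old : ∀ {z} → z ∈ P → emb′ z ≡ emb st z
          emb-old = update-∈ (emb st) (x ∷ []) j∉

          used-update : ∀ {y} → y ∈ used emb′ (inj₂ j ∷ P) → x ≡ y ⊎ y ∈ used (emb st) P
          used-update y∈ with used⁻ _ (inj₂ j ∷ P) y∈
          ... | _ , there z∈  , y∈z = inj₂ (∈-used (emb st) z∈ (subst (_ ∈_) (emb-old z∈) y∈z))
          ... | _ , here refl , y∈z with subst (_ ∈_) emb-j y∈z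
          ...   | here refl = inj₁ refl

          add : R (emb st (inj₁ i)) x → x ∉ used (emb st) P → _ → State (inj₂ j ∷ P)
          add r x∉ ph = record
            { emb      = emb′
            ; spare    = λ z → remove x (spare′ z)
            ; disjoint = update-disjoint (disjoint st) j∉ (λ { (here refl , y∈) → x∉ y∈ })
            ; short    = λ { (here refl) → ≤-trans (≤-reflexive (cong length emb-j)) (s≤s z≤n) , z≤n
                           ; {z} (there z∈)  → ≤-trans (≤-reflexive (cong length (emb-old z∈))) (proj₁ (short st z∈)) ,
                                           ≤-trans (List.length-filter (λ y → ¬? (x Fin.≟ y)) (spare′ z)) (spare′≤ z (proj₂ (short st z∈))) }
            ; vertex   = λ { (here refl) → x , emb-j , _ , r
                           ; (there j′∈) → let x′ , eq , rest = vertex st j′∈ in x′ , trans (emb-old j′∈) eq , rest }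
            ; related  = λ { (there i′∈) (here refl) e → case unique i′∈ e of λ { refl →
                               subst₂ (λ p q → All (R p) q) (sym (emb-old i′∈)) (sym emb-j) (r ∷ []) }
                           ; (there i′∈) (there j′∈) e → subst₂ (λ p q → All (R p) q) (sym (emb-old i′∈)) (sym (emb-old j′∈)) (related st i′∈ j′∈ e) }
            ; spare-ok = λ { {i′} (there i′∈) → let uq , tq , rq , dq = spare-ok st i′∈ in
                               Unique.filter⁺ _ uq ,
                               ≤-trans tq (≤-trans (+-monoˡ-≤ (length (rights P)) (length-remove x uq)) (≤-reflexive (sym (+-suc _ _)))) ,
                               subst (λ e → All (R e) _) (sym (emb-old i′∈)) (All.filter⁺ _ rq) ,
                               λ (y∈ , y∈used) → let y∈sp , x≢y = ∈-remove x (spare st (inj₁ i′)) y∈ in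
                                 [ x≢y , (λ y∈P → dq (y∈sp , y∈P)) ]′ (used-update y∈used) }
            ; phase    = ph
            }
            where
            -- Vertices of V need no spare partners; emptying their lists makes the length bound
            -- immediate.
            spare′ : Placement {n} {s} {t}
            spare′ (inj₁ i) = spare st (inj₁ i)
            spare′ (inj₂ j) = []
            spare′≤ : ∀ z → length (spare st z) ≤ t + t → length (spare′ z) ≤ t + t
            spare′≤ (inj₁ _) h = h
            spare′≤ (inj₂ _) _ = z≤n

        late : c ≤ length (rights P) → State (inj₂ j ∷ P)
        late c≤ with spare st (inj₁ i) | spare-ok st i∈
        -- As `j` is not placed yet, fewer than `t` vertices of V are, and the balance excludes an
        -- empty list.
        ... | []     | _ , t≤ , _           = contradiction t≤ (<⇒≱ (rights-< uP j∉))
        ... | x ∷ xs | _ , _ , r ∷ _ , xs# = add x r (λ x∈ → xs# (here refl , x∈)) (inj₁ (m≤n⇒m≤1+n c≤))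

        choose : _ → State (inj₂ j ∷ P)
        choose (inj₁ c≤) = late c≤
        choose (inj₂ ([] , _ , _ , _ , c≤ , _)) = late c≤
        choose (inj₂ (x ∷ rem , x∉rem ∷ urem , x∈A ∷ rem⊆A , rem≤t , c≤ , rem# , rrem , V⊆A)) =
          add x (All.head (rrem i∈)) (λ x∈ → rem# (here refl , x∈))
            (inj₂ (rem , urem , rem⊆A , ≤-trans (n≤1+n _) rem≤t , ≤-trans c≤ (≤-reflexive (sym (+-suc _ _))) ,
              (λ (y∈rem , y∈used) → [ All.lookup x∉rem y∈rem , (λ y∈P → rem# (there y∈rem , y∈P)) ]′ (used-update x y∈used)) ,
              (λ { (there i′∈) → subst (λ e → All (R e) rem) (sym (emb-old x i′∈)) (All.tail (rrem i′∈)) }) ,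
              λ { (here refl) → subst (All (_∈ A)) (sym (emb-j x)) (x∈A ∷ [])
                ; (there j′∈) → subst (All (_∈ A)) (sym (emb-old x j′∈)) (V⊆A j′∈) }))

    place : ∀ {P} → Grow E P → length P ≤ N → ¬ ¬ State P
    place (root i) 1≤N = start i 1≤N
    place (grow {P} {inj₂ j} {inj₁ i} g p∈ z∉ e unique) P<N k =
      place g (<⇒≤ P<N) λ st → grow-left st (<⇒≤ P<N) p∈ z∉ unique k
    place (grow {P} {inj₁ i} {inj₂ j} g p∈ z∉ e unique) P<N k =
      place g (<⇒≤ P<N) λ st → k (grow-right st (Grow-unique g) p∈ z∉ unique)

    embed : ∀ {P} → Grow E P → length P ≤ N → (∀ z → z ∈ P) → ¬ ¬ Embedding E (λ u v → ∃[ x ] v ≡ x ∷ [] × R u x)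
    embed g P≤N all k = place g P≤N λ st → k (emb st , (λ {x} {y} → disjoint st (all x) (all y)) ,
      λ i j e → let x , eq , _ = vertex st (all (inj₂ j)) in
        x , eq , All.head (subst (All (R (emb st (inj₁ i)))) eq (related st (all (inj₁ i)) (all (inj₂ j)) e)))

  -- Induction on `d = t − c`: a core of size `c` admits the greedy embedding if no larger core
  -- exists, and a larger one is refuted by the recursive call. The induction starts at the empty
  -- core, whose partners come from `kernel`; its bound `bound 0 t` dominates all later ones.
  core-embed : ∀ {P} → Grow E P → length P ≤ N → (∀ z → z ∈ P) →
    (kernel : ∀ {u x} → R u x → Core (x ∷ []) (bound 0 t)) →
    ∀ {u x} → R u x → ¬ ¬ Embedding E (λ u v → ∃[ x ] v ≡ x ∷ [] × R u x)
  core-embed g P≤N all kernel {x = x} r k = go 0 t refl [] [] refl (λ w len k′ → kernel r w len λ u u#w rich rx → k′ u u#w rich [])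
    where
    bound-mono : ∀ c d → bound (suc c) d ≤ bound c (suc d)
    bound-mono c d = ≤-trans (≤-trans (≤-reflexive (sym (*-identityˡ _))) (*-monoˡ-≤ (bound (suc c) d) (m^n>0 w₀ (suc c)))) (m≤n+m _ w₀)
    bound≤ : ∀ c d → bound c d ≤ bound 0 (c + d)
    bound≤ zero    d = ≤-refl
    bound≤ (suc c) d = ≤-trans (bound-mono c d) (subst (λ e → bound c (suc d) ≤ bound 0 e) (+-suc c d) (bound≤ c (suc d)))
    go : ∀ c d → c + d ≡ t → ∀ A → Unique A → length A ≡ c → Core A (bound c d) → ⊥
    go c d c+d≡t A uA lA core = Greedy.embed c A uA lA (≤-trans (m≤m+n c d) (≤-reflexive c+d≡t))
      (λ w len → fresh-or-core c d c+d≡t nocore A core w len)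
      (λ {u} {y} r w len → fresh-or-core c d c+d≡t nocore (y ∷ []) (λ w′ len′ → kernel r w′ (≤-trans len′ (subst (λ e → bound c d ≤ bound 0 e) c+d≡t (bound≤ c d)))) w len)
      g P≤N all k
      where
      nocore : ∀ A d′ → d ≡ suc d′ → Unique A → length A ≡ suc c → ¬ Core A (bound (suc c) d′)
      nocore A′ d′ refl uA′ lA′ core′ = go (suc c) d′ (trans (sym (+-suc c d′)) c+d≡t) A′ uA′ lA′ core′

-- Subsets of given size and the lower bound

subsets : ∀ n → ℕ → List (Subset n)
subsets n       zero    = ∅ ∷ []
subsets zero    (suc k) = []
subsets (suc n) (suc k) = map (true ∷_) (subsets n k) ++ map (false ∷_) (subsets n (suc k))

length-subsets : ∀ n k → length (subsets n k) ≡ n C k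
length-subsets n       zero    = refl
length-subsets zero    (suc k) = refl
length-subsets (suc n) (suc k) = begin
  length (map (true ∷_) (subsets n k) ++ map (false ∷_) (subsets n (suc k)))
    ≡⟨ length-++ (map (true ∷_) (subsets n k)) ⟩
  length (map (true ∷_) (subsets n k)) + length (map (false ∷_) (subsets n (suc k)))
    ≡⟨ cong₂ _+_ (trans (length-map _ (subsets n k)) (length-subsets n k)) (trans (length-map _ (subsets n (suc k))) (length-subsets n (suc k))) ⟩
  n C k + n C suc k
    ≡⟨ nCk+nC[k+1]≡[n+1]C[k+1] n k ⟩
  suc n C suc k ∎
  where open ≡-Reasoning

subsets-unique : ∀ n k → Unique (subsets n k)
subsets-unique n       zero    = [] ∷ []
subsets-unique zero    (suc k) = []
subsets-unique (suc n) (suc k) = Unique.++⁺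
  (Unique.map⁺ Vec.∷-injectiveʳ (subsets-unique n k)) (Unique.map⁺ Vec.∷-injectiveʳ (subsets-unique n (suc k)))
  λ (p∈ , q∈) → case ∈-map⁻ _ p∈ , ∈-map⁻ _ q∈ of λ { ((_ , _ , refl) , (_ , _ , ())) }

∈-subsets : ∀ {n} (p : Subset n) → p ∈ subsets n ∣ p ∣
∈-subsets []          = here refl
∈-subsets (true  ∷ p) = ∈-++⁺ˡ (∈-map⁺ (true ∷_) (∈-subsets p))
∈-subsets (false ∷ p) with ∣ p ∣ | ∈-subsets p
... | zero  | here refl = here refl
... | suc k | p∈        = ∈-++⁺ʳ (map (true ∷_) (subsets _ k)) (∈-map⁺ (false ∷_) p∈)

∣subsets∣ : ∀ n k {p} → p ∈ subsets n k → ∣ p ∣ ≡ k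
∣subsets∣ n       zero    (here refl) = ∣⊥∣≡0 n
∣subsets∣ (suc n) (suc k) p∈ with ∈-++⁻ (map (true ∷_) (subsets n k)) p∈
... | inj₁ p∈₁ with ∈-map⁻ (true ∷_) p∈₁
...   | q , q∈ , refl = cong suc (∣subsets∣ n k q∈)
∣subsets∣ (suc n) (suc k) p∈ | inj₂ p∈₂ with ∈-map⁻ (false ∷_) p∈₂
...   | q , q∈ , refl = ∣subsets∣ n (suc k) q∈

C≤^ : ∀ n k → n C k ≤ n ^ k
C≤^ n       zero    = ≤-refl
C≤^ zero    (suc k) = z≤n
C≤^ (suc n) (suc k) = begin
  suc n C suc k         ≡⟨ nCk+nC[k+1]≡[n+1]C[k+1] n k ⟨
  n C k + n C suc k     ≤⟨ +-mono-≤ (C≤^ n k) (C≤^ n (suc k)) ⟩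
  n ^ k + n * n ^ k     ≤⟨ *-monoʳ-≤ (suc n) (^-monoˡ-≤ k (n≤1+n n)) ⟩
  suc n * suc n ^ k     ∎
  where open ≤-Reasoning

-- Pascal's rule, applied `q` times, with a cost of at most (q + n)^j each time.
C-shift : ∀ q n j → (q + n) C suc j ≤ n C suc j + q * (q + n) ^ j
C-shift zero    n j = m≤m+n _ _
C-shift (suc q) n j = begin
  (suc q + n) C suc j                                          ≡⟨ nCk+nC[k+1]≡[n+1]C[k+1] (q + n) j ⟨
  (q + n) C j + (q + n) C suc j                                ≤⟨ +-mono-≤ (C≤^ (q + n) j) (C-shift q n j) ⟩
  (q + n) ^ j + (n C suc j + q * (q + n) ^ j)                  ≡⟨ rearrange ((q + n) ^ j) (n C suc j) q ⟩
  n C suc j + suc q * (q + n) ^ j                              ≤⟨ +-monoʳ-≤ (n C suc j) (*-monoʳ-≤ (suc q) (^-monoˡ-≤ j (n≤1+n (q + n)))) ⟩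
  n C suc j + suc q * (suc q + n) ^ j                          ∎
  where
  open ≤-Reasoning
  rearrange : ∀ p c q → p + (c + q * p) ≡ c + suc q * p
  rearrange = solve-∀

∣++∣ : ∀ {m n} (p : Subset m) (q : Subset n) → ∣ p ++ᵥ q ∣ ≡ ∣ p ∣ + ∣ q ∣
∣++∣ []          q = refl
∣++∣ (true  ∷ p) q = cong suc (∣++∣ p q)
∣++∣ (false ∷ p) q = ∣++∣ p q

↑ˡ-∈⁺ : ∀ {m n} {x : Fin m} {p : Subset m} (q : Subset n) → x ∈ₛ p → (x ↑ˡ n) ∈ₛ (p ++ᵥ q)
↑ˡ-∈⁺ q here       = here
↑ˡ-∈⁺ q (there x∈) = there (↑ˡ-∈⁺ q x∈)

↑ˡ-∈⁻ : ∀ {m n} (x : Fin m) (p : Subset m) (q : Subset n) → (x ↑ˡ n) ∈ₛ (p ++ᵥ q) → x ∈ₛ p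
↑ˡ-∈⁻ zero    (_ ∷ p) q here       = here
↑ˡ-∈⁻ (suc x) (_ ∷ p) q (there x∈) = there (↑ˡ-∈⁻ x p q x∈)

⁅⁆-injective : ∀ {x y : Fin n} → ⁅ x ⁆ ≡ ⁅ y ⁆ → x ≡ y
⁅⁆-injective {x = x} {y} eq = x∈⁅y⁆⇒x≡y y (subst (x ∈ₛ_) eq (x∈⁅x⁆ x))

length-cartesianProductWith : ∀ {C : Set} (f : A → B → C) xs ys → length (cartesianProductWith f xs ys) ≡ length xs * length ys
length-cartesianProductWith f []       ys = refl
length-cartesianProductWith f (x ∷ xs) ys =
  trans (length-++ (map (f x) ys)) (cong₂ _+_ (length-map (f x) ys) (length-cartesianProductWith f xs ys))

crosscut : ∀ q m j → RGraph (suc j) (q + m)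
crosscut q m j = record
  { edges    = cartesianProductWith join (allFin q) (subsets m j)
  ; distinct = Unique.cartesianProductWith⁺ join (λ eq → let e₁ , e₂ = Vec.++-injective _ _ eq in ⁅⁆-injective e₁ , e₂)
                 (Unique.allFin⁺ q) (subsets-unique m j)
  ; uniform  = All.tabulate λ e∈ → case ∈-cartesianProductWith⁻ join (allFin q) (subsets m j) e∈ of
                 λ { (x , p , _ , p∈ , refl) → trans (∣++∣ ⁅ x ⁆ p) (cong₂ _+_ (∣⁅x⁆∣≡1 x) (∣subsets∣ m j p∈)) }
  }
  where
  join : Fin q → Subset m → Subset (q + m)
  join x p = ⁅ x ⁆ ++ᵥ p

crosscut-size : ∀ q m j → size (crosscut q m j) ≡ q * (m C j)
crosscut-size q m j = trans (length-cartesianProductWith _ (allFin q) (subsets m j)) (cong₂ _*_ (length-tabulate {n = q} id) (length-subsets m j))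

-- The properties `Left` and `Right` alternate along edges, so the state of one U-blob decides all
-- blobs. As distinct blobs are disjoint, a choice of one vertex of S in each blob of a side is an
-- injection into `Fin q`.
crosscut-free : ∀ {s t a b q} m l (E : Fin s → Fin t → Bool) → Connected E → Fin s → q < s → q < t →
  BlowupFree s t a b E (crosscut q m l)
crosscut-free {s} {t} {a} {b} {q} m l E connected i₀ q<s q<t (φ , φ-inj , φ-edge) = case Meets? (inj₁ i₀) of λ where
    (yes h) → <⇒≱ q<s (Fin.injective⇒≤ {f = λ i → proj₁ (proj₂ (allᵤ h i))} (λ {i} {i′} → injᵤ h {i} {i′}))
    (no ¬h) → <⇒≱ q<t (Fin.injective⇒≤ {f = λ j → proj₁ (proj₂ (allᵥ ¬h j))} (λ {j} {j′} → injᵥ ¬h {j} {j′}))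
  where
  Meets : BVertex s t → Set
  Meets (inj₁ i) = ∃[ x ] ∃[ c ] φ (inj₁ (i , x)) ≡ c ↑ˡ m
  Meets (inj₂ j) = ∃[ y ] ∃[ c ] φ (inj₂ (j , y)) ≡ c ↑ˡ m

  Meets? : ∀ z → Dec (Meets z)
  Meets? (inj₁ i) = Fin.any? λ x → Fin.any? λ c → φ (inj₁ (i , x)) Fin.≟ c ↑ˡ m
  Meets? (inj₂ j) = Fin.any? λ y → Fin.any? λ c → φ (inj₂ (j , y)) Fin.≟ c ↑ˡ m

  one : ∀ i j → E i j ≡ true → Meets (inj₁ i) ⊎ Meets (inj₂ j)
  one i j e with φ-edge i j e
  ... | f , f∈ , f⇔ with ∈-cartesianProductWith⁻ _ (allFin q) (subsets m l) f∈
  ...   | c , p , _ , _ , refl with Equivalence.to (f⇔ (c ↑ˡ m)) (↑ˡ-∈⁺ p (x∈⁅x⁆ c))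
  ...     | inj₁ (x , eq) = inj₁ (x , c , eq)
  ...     | inj₂ (y , eq) = inj₂ (y , c , eq)

  not-both : ∀ i j → E i j ≡ true → Meets (inj₁ i) → Meets (inj₂ j) → ⊥
  not-both i j e (x , c , eq) (y , d , eq′) with φ-edge i j e
  ... | f , f∈ , f⇔ with ∈-cartesianProductWith⁻ _ (allFin q) (subsets m l) f∈
  ...   | c₀ , p , _ , _ , refl = case φ-inj {inj₁ (i , x)} {inj₂ (j , y)} (trans eq (trans (cong (_↑ˡ m) (trans c≡ (sym d≡))) (sym eq′))) of λ ()
    where
    c≡ : c ≡ c₀
    c≡ = x∈⁅y⁆⇒x≡y c₀ (↑ˡ-∈⁻ c ⁅ c₀ ⁆ p (Equivalence.from (f⇔ (c ↑ˡ m)) (inj₁ (x , eq))))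
    d≡ : d ≡ c₀
    d≡ = x∈⁅y⁆⇒x≡y c₀ (↑ˡ-∈⁻ d ⁅ c₀ ⁆ p (Equivalence.from (f⇔ (d ↑ˡ m)) (inj₂ (y , eq′))))

  propagate : ∀ (Q : BVertex s t → Set) → (∀ {x y} → Adj E x y → Q x → Q y) → ∀ {x y} → Star (Adj E) x y → Q x → Q y
  propagate Q step ε        qx = qx
  propagate Q step (e ◅ es) qx = propagate Q step es (step e qx)

  Left Right : BVertex s t → Set
  Left (inj₁ i) = Meets (inj₁ i)
  Left (inj₂ j) = ¬ Meets (inj₂ j)
  Right (inj₁ i) = ¬ Meets (inj₁ i)
  Right (inj₂ j) = Meets (inj₂ j)

  left-step : ∀ {x y} → Adj E x y → Left x → Left y
  left-step {inj₁ i} {inj₂ j} e h = not-both i j e h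
  left-step {inj₂ j} {inj₁ i} e h = [ id , (λ h′ → contradiction h′ h) ]′ (one i j e)

  right-step : ∀ {x y} → Adj E x y → Right x → Right y
  right-step {inj₁ i} {inj₂ j} e h = [ (λ h′ → contradiction h′ h) , id ]′ (one i j e)
  right-step {inj₂ j} {inj₁ i} e h h′ = not-both i j e h′ h

  allᵤ : Meets (inj₁ i₀) → ∀ i → Meets (inj₁ i)
  allᵤ h i = propagate Left (λ {x} {y} → left-step {x} {y}) (connected (inj₁ i₀) (inj₁ i)) h

  allᵥ : ¬ Meets (inj₁ i₀) → ∀ j → Meets (inj₂ j)
  allᵥ h j = propagate Right (λ {x} {y} → right-step {x} {y}) (connected (inj₁ i₀) (inj₂ j)) h

  injᵤ : ∀ h {i i′} → proj₁ (proj₂ (allᵤ h i)) ≡ proj₁ (proj₂ (allᵤ h i′)) → i ≡ i′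
  injᵤ h {i} {i′} eq with allᵤ h i | allᵤ h i′
  ... | x , c , p | x′ , c′ , p′ with φ-inj {inj₁ (i , x)} {inj₁ (i′ , x′)} (trans p (trans (cong (_↑ˡ m) eq) (sym p′)))
  ...   | refl = refl

  injᵥ : ∀ h {j j′} → proj₁ (proj₂ (allᵥ h j)) ≡ proj₁ (proj₂ (allᵥ h j′)) → j ≡ j′
  injᵥ h {j} {j′} eq with allᵥ h j | allᵥ h j′
  ... | y , c , p | y′ , c′ , p′ with φ-inj {inj₂ (j , y)} {inj₂ (j′ , y′)} (trans p (trans (cong (_↑ˡ m) eq) (sym p′)))
  ...   | refl = refl

-- The crosscut has q·C(n-q,r-1) edges. Replacing n - q by n costs at most q·q·n^(r-2), and n ≥
-- (k+1)q² absorbs this into n^(r-1)/(k+1).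
lower-bound : ∀ {s a b} j q (E : Fin s → Fin (suc q) → Bool) → Connected E → suc q ≤ s → ∀ k n → q + suc k * (q * q) ≤ n →
  Σ (RGraph (suc (suc j)) n) λ H → BlowupFree s (suc q) a b E H × suc k * (q * (n C suc j)) ≤ suc k * size H + n ^ suc j
lower-bound {s = suc _} j q E connected q<s k n N≤n with m≤n⇒∃[o]m+o≡n (≤-trans (m≤m+n q _) N≤n)
... | m , refl = crosscut q m (suc j) , crosscut-free m (suc j) E connected zero q<s ≤-refl , (begin
  suc k * (q * ((q + m) C suc j))                                   ≤⟨ *-monoʳ-≤ (suc k) (*-monoʳ-≤ q (C-shift q m j)) ⟩
  suc k * (q * (m C suc j + q * (q + m) ^ j))                       ≡⟨ expand (suc k) q (m C suc j) ((q + m) ^ j) ⟩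
  suc k * (q * (m C suc j)) + suc k * (q * q) * (q + m) ^ j         ≤⟨ +-monoʳ-≤ _ (*-monoˡ-≤ ((q + m) ^ j) (≤-trans (m≤n+m _ q) N≤n)) ⟩
  suc k * (q * (m C suc j)) + (q + m) ^ suc j                       ≡⟨ cong (λ e → suc k * e + (q + m) ^ suc j) (crosscut-size q m (suc j)) ⟨
  suc k * size (crosscut q m (suc j)) + (q + m) ^ suc j             ∎)
  where
  open ≤-Reasoning
  expand : ∀ k q c p → k * (q * (c + q * p)) ≡ k * (q * c) + k * (q * q) * p
  expand = solve-∀

-- Pairs of words that are abundant in both coordinates

hits : List (Fin n) → List (Fin n) → Bool
hits []       v = false
hits (w ∷ ws) v = (w ∈ᵇ v) ∨ hits ws v

hits-disjoint : ∀ (ws : List (Fin n)) {v} → hits ws v ≡ false → Disjoint v ws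
hits-disjoint (w ∷ ws) {v} eq (x∈v , x∈ws) with w ∈ᵇ v in eq′ | x∈ws
... | false | here refl = true≢false (∈⇒∈ᵇ x∈v) eq′
... | false | there x∈  = hits-disjoint ws eq (x∈v , x∈)

#-hits : ∀ (vs : List (List (Fin n))) (q : List (Fin n) → Bool) ws → # vs (λ v → q v ∧ hits ws v) ≤ ∑ ws (λ w → # vs (λ v → q v ∧ (w ∈ᵇ v)))
#-hits vs q []       = ≤-trans (∑-mono vs (λ {v} _ → none (q v))) (≤-reflexive (∑-zero vs))
  where
  none : ∀ x → 𝟙 (x ∧ false) ≤ 0
  none true  = z≤n
  none false = z≤n
#-hits vs q (w ∷ ws) = begin
  # vs (λ v → q v ∧ ((w ∈ᵇ v) ∨ hits ws v))                          ≤⟨ ∑-mono vs (λ {v} _ → split (q v) (w ∈ᵇ v) (hits ws v)) ⟩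
  ∑ vs (λ v → 𝟙 (q v ∧ (w ∈ᵇ v)) + 𝟙 (q v ∧ hits ws v))             ≡⟨ ∑-+ vs _ _ ⟩
  # vs (λ v → q v ∧ (w ∈ᵇ v)) + # vs (λ v → q v ∧ hits ws v)         ≤⟨ +-monoʳ-≤ _ (#-hits vs q ws) ⟩
  # vs (λ v → q v ∧ (w ∈ᵇ v)) + ∑ ws (λ w → # vs (λ v → q v ∧ (w ∈ᵇ v))) ∎
  where
  open ≤-Reasoning
  split : ∀ x y z → 𝟙 (x ∧ (y ∨ z)) ≤ 𝟙 (x ∧ y) + 𝟙 (x ∧ z)
  split false _ _ = z≤n
  split true  y z = 𝟙-∨ y z

-- Union bound: a single vertex lies in less than the fraction 1/(m+1) of the counted words, so `m`
-- vertices cannot meet them all.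
#-avoid : ∀ (vs : List (List (Fin n))) (q : List (Fin n) → Bool) D m Θ → Θ < D * # vs q →
  (∀ w → D * suc m * # vs (λ v → q v ∧ (w ∈ᵇ v)) ≤ Θ) →
  ∀ ws → length ws ≤ m → ∃[ v ] v ∈ vs × q v ≡ true × Disjoint v ws
#-avoid vs q D m Θ big few ws len with 1 ≤? # vs (λ v → q v ∧ not (hits ws v))
... | yes 1≤ with #-pos vs _ 1≤
...   | v , v∈ , qv = v , v∈ , proj₁ (∧-true {q v} qv) , hits-disjoint ws (not-true (proj₂ (∧-true {q v} qv)))
#-avoid vs q D m Θ big few ws len | no ≱1 = contradiction (begin-strict
  suc m * Θ                                                              <⟨ *-monoʳ-< (suc m) big ⟩
  suc m * (D * # vs q)                                                   ≤⟨ *-monoʳ-≤ (suc m) (*-monoʳ-≤ D covered) ⟩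
  suc m * (D * ∑ ws (λ w → # vs (λ v → q v ∧ (w ∈ᵇ v))))                 ≡⟨ reorder (suc m) D (∑ ws (λ w → # vs (λ v → q v ∧ (w ∈ᵇ v)))) ⟩
  D * suc m * ∑ ws (λ w → # vs (λ v → q v ∧ (w ∈ᵇ v)))                   ≡⟨ ∑-*ˡ (D * suc m) ws _ ⟩
  ∑ ws (λ w → D * suc m * # vs (λ v → q v ∧ (w ∈ᵇ v)))                   ≤⟨ ∑-bound ws (λ {w} _ → few w) ⟩
  length ws * Θ                                                          ≤⟨ *-monoˡ-≤ Θ (m≤n⇒m≤1+n len) ⟩
  suc m * Θ                                                              ∎) (<-irrefl refl)
  where
  open ≤-Reasoning
  reorder : ∀ x y z → x * (y * z) ≡ y * x * z
  reorder = solve-∀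
  split : ∀ x y → 𝟙 x ≤ 𝟙 (x ∧ not y) + 𝟙 (x ∧ y)
  split false _     = z≤n
  split true  true  = ≤-refl
  split true  false = s≤s z≤n
  covered : # vs q ≤ ∑ ws (λ w → # vs (λ v → q v ∧ (w ∈ᵇ v)))
  covered = begin
    # vs q                                                               ≤⟨ ∑-mono vs (λ {v} _ → split (q v) (hits ws v)) ⟩
    ∑ vs (λ v → 𝟙 (q v ∧ not (hits ws v)) + 𝟙 (q v ∧ hits ws v))         ≡⟨ ∑-+ vs _ _ ⟩
    # vs (λ v → q v ∧ not (hits ws v)) + # vs (λ v → q v ∧ hits ws v)    ≡⟨ cong (_+ # vs (λ v → q v ∧ hits ws v)) (n<1⇒n≡0 (≰⇒> ≱1)) ⟩
    # vs (λ v → q v ∧ hits ws v)                                         ≤⟨ #-hits vs q ws ⟩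
    ∑ ws (λ w → # vs (λ v → q v ∧ (w ∈ᵇ v)))                             ∎

-- By `cost`, deleting every key at its threshold does not exhaust the pairs. A word that survives
-- has more than Θ/D partners, while the spread conditions let a single vertex meet at most
-- Θ/(D(m+1)) of them. Key lists shorter than all words are how the scarcity of fat sets is
-- exploited.
record Abundant (n a b : ℕ) (p : List (Fin n) → List (Fin n) → Bool) (m : ℕ) : Set where
  field
    D Θᵤ Θᵥ   : ℕ
    keysᵤ keysᵥ : List (List (Fin n))
    keyᵤ      : ∀ {u v} → u ∈ W n a → v ∈ W n b → p u v ≡ true → u ∈ keysᵤ
    keyᵥ      : ∀ {u v} → u ∈ W n a → v ∈ W n b → p u v ≡ true → v ∈ keysᵥ
    cost      : length keysᵤ * Θᵤ + length keysᵥ * Θᵥ < D * ∑ (W n a) (λ u → # (W n b) (p u))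
    spreadᵥ   : ∀ u → u ∈ W n a → ∀ w → D * suc m * # (W n b) (λ v → p u v ∧ (w ∈ᵇ v)) ≤ Θᵤ
    spreadᵤ   : ∀ v → v ∈ W n b → ∀ w → D * suc m * # (W n a) (λ u → p u v ∧ (w ∈ᵇ u)) ≤ Θᵥ

module _ {n a b s t : ℕ} {p : List (Fin n) → List (Fin n) → Bool} {m : ℕ} (E : Fin s → Fin t → Bool) (ab : Abundant n a b p m) where
  open Abundant ab

  private
    Pair : Set
    Pair = List (Fin n) × List (Fin n)

    pairs : List Pair
    pairs = cartesianProduct (W n a) (W n b)

    pairs-unique : Unique pairs
    pairs-unique = Unique.cartesianProduct⁺ (W-unique n a) (W-unique n b)

    _≟ₚ_ : DecidableEquality Pair
    _≟ₚ_ = Product.≡-dec _≟ʷ_ _≟ʷ_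

    -- Membership becomes part of the predicate, so that surviving pairs are known to have the right
    -- lengths.
    inPairs : Pair → Bool
    inPairs x = does (Any.any? (x ≟ₚ_) pairs)

    p₀ : Pair → Bool
    p₀ x = inPairs x ∧ p (proj₁ x) (proj₂ x)

    Key : Set
    Key = List (Fin n) ⊎ List (Fin n)

    has : Key → Pair → Bool
    has (inj₁ u) x = does (proj₁ x ≟ʷ u)
    has (inj₂ v) x = does (proj₂ x ≟ʷ v)

    Θ : Key → ℕ
    Θ (inj₁ _) = Θᵤ
    Θ (inj₂ _) = Θᵥ

    keys : List Key
    keys = map inj₁ keysᵤ ++ map inj₂ keysᵥ

    ∑Θ : ∑ keys Θ ≡ length keysᵤ * Θᵤ + length keysᵥ * Θᵥ
    ∑Θ = trans (∑-++ (map inj₁ keysᵤ) (map inj₂ keysᵥ) Θ)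
      (cong₂ _+_ (trans (∑-map inj₁ keysᵤ Θ) (∑-const keysᵤ Θᵤ)) (trans (∑-map inj₂ keysᵥ Θ) (∑-const keysᵥ Θᵥ)))

    total : # pairs p₀ ≡ ∑ (W n a) (λ u → # (W n b) (p u))
    total = trans (≤-antisym (#-mono pairs (λ {x} _ h → proj₂ (∧-true {inPairs x} h)))
                             (#-mono pairs (λ {x} x∈ h → ∧-intro (dec-true (Any.any? (x ≟ₚ_) pairs) x∈) h)))
      (∑-cartesianProductWith _,_ (W n a) (W n b) (λ x → 𝟙 (p (proj₁ x) (proj₂ x))))

  abstract
    -- The spread conditions pass from `p` to the cleaned family `p′`, whose degrees `kept` bounds
    -- from below; comparing the two gives both moves of `PureEmbedding`.
    abundant-embed : ∀ {P ℓ} → a ≤ ℓ → b ≤ ℓ → Grow E P → length P * ℓ ≤ m → (∀ z → z ∈ P) →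
      Embedding E (λ u v → length u ≡ a × length v ≡ b × p u v ≡ true)
    abundant-embed {P} {ℓ} a≤ℓ b≤ℓ g len all with clean D pairs has Θ keys p₀
    ... | p′ , p′⇒p₀ , bound , kept = let emb , dj , rel = embedding in
          emb , dj , λ i j e → let u∈ , v∈ , puv = from (rel i j e) in ∈-words⇒length a u∈ , ∈-words⇒length b v∈ , puv
      where
      R : List (Fin n) → List (Fin n) → Set
      R u v = p′ (u , v) ≡ true

      from : ∀ {u v} → R u v → u ∈ W n a × v ∈ W n b × p u v ≡ true
      from {u} {v} r = let in-pairs , puv = ∧-true (p′⇒p₀ (u , v) r)
                           u∈ , v∈ = ∈-cartesianProduct⁻ (W n a) (W n b) (does⇒ (Any.any? ((u , v) ≟ₚ_) pairs) in-pairs)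
                       in u∈ , v∈ , puv

      sub : ∀ u v (w : Fin n) (ws : List (Fin n)) → p′ (u , v) ∧ (w ∈ᵇ ws) ≡ true → p u v ∧ (w ∈ᵇ ws) ≡ true
      sub u v w ws h = let h₁ , h₂ = ∧-true {p′ (u , v)} h in ∧-intro (proj₂ (proj₂ (from h₁))) h₂

      moveᵥ : ∀ {u v} → R u v → ∀ w → length w ≤ m → ∃[ v′ ] R u v′ × Disjoint v′ w
      moveᵥ {u} {v} r w lw with from r
      ... | u∈ , v∈ , puv with #-avoid (W n b) (λ v → p′ (u , v)) D m Θᵤ
            (≤-trans (kept {inj₁ u} (∈-++⁺ˡ (∈-map⁺ inj₁ (keyᵤ u∈ v∈ puv))) r (dec-true (u ≟ʷ u) refl))
              (*-monoʳ-≤ D (#-injection _≟ₚ_ (W n b) (u ,_) _ (λ v → p′ (u , v)) pairs-unique fibre)))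
            (λ x → ≤-trans (*-monoʳ-≤ (D * suc m) (#-mono (W n b) (λ {v′} _ → sub u v′ x v′))) (spreadᵥ u u∈ x)) w lw
        where
        fibre : ∀ {x} → x ∈ pairs → p′ x ∧ does (proj₁ x ≟ʷ u) ≡ true → ∃[ v ] v ∈ W n b × p′ (u , v) ≡ true × (u , v) ≡ x
        fibre {u′ , v′} x∈ h with ∧-true {p′ (u′ , v′)} h
        ... | px , eq with does⇒ (u′ ≟ʷ u) eq
        ...   | refl = v′ , proj₂ (∈-cartesianProduct⁻ (W n a) (W n b) x∈) , px , refl
      ...   | v′ , _ , r′ , dj = v′ , r′ , dj

      moveᵤ : ∀ {u v} → R u v → ∀ w → length w ≤ m → ∃[ u′ ] R u′ v × Disjoint u′ w
      moveᵤ {u} {v} r w lw with from r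
      ... | u∈ , v∈ , puv with #-avoid (W n a) (λ u → p′ (u , v)) D m Θᵥ
            (≤-trans (kept {inj₂ v} (∈-++⁺ʳ (map inj₁ keysᵤ) (∈-map⁺ inj₂ (keyᵥ u∈ v∈ puv))) r (dec-true (v ≟ʷ v) refl))
              (*-monoʳ-≤ D (#-injection _≟ₚ_ (W n a) (_, v) _ (λ u → p′ (u , v)) pairs-unique fibre)))
            (λ x → ≤-trans (*-monoʳ-≤ (D * suc m) (#-mono (W n a) (λ {u′} _ → sub u′ v x u′))) (spreadᵤ v v∈ x)) w lw
        where
        fibre : ∀ {x} → x ∈ pairs → p′ x ∧ does (proj₂ x ≟ʷ v) ≡ true → ∃[ u ] u ∈ W n a × p′ (u , v) ≡ true × (u , v) ≡ x
        fibre {u′ , v′} x∈ h with ∧-true {p′ (u′ , v′)} h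
        ... | px , eq with does⇒ (v′ ≟ʷ v) eq
        ...   | refl = u′ , proj₁ (∈-cartesianProduct⁻ (W n a) (W n b) x∈) , px , refl
      ...   | u′ , _ , r′ , dj = u′ , r′ , dj

      nonempty : 0 < # pairs p′
      nonempty = ≰⇒> λ ≤0 → <⇒≱ (subst (λ e → _ < D * e) (sym total) cost)
        (≤-trans bound (≤-reflexive (trans (cong (λ e → D * e + ∑ keys Θ) (n≤0⇒n≡0 ≤0)) (trans (cong (_+ ∑ keys Θ) (*-zeroʳ D)) ∑Θ))))

      embedding : Embedding E R
      embedding with #-pos pairs p′ nonempty
      ... | (u , v) , _ , r = PureEmbedding.embed E R ℓ m
              (λ r → let u∈ , v∈ , _ = from r in ≤-trans (≤-reflexive (∈-words⇒length a u∈)) a≤ℓ , ≤-trans (≤-reflexive (∈-words⇒length b v∈)) b≤ℓ)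
              moveᵥ moveᵤ r g len all

-- Degrees

module Degree {n : ℕ} (Es : List (Subset n)) where

  G : List (Fin n) → Bool
  G w = does (Any.any? (toSubset w ≟ₛ_) Es)

  G⇒∈ : ∀ w → G w ≡ true → toSubset w ∈ Es
  G⇒∈ w = does⇒ (Any.any? (toSubset w ≟ₛ_) Es)

  ∈⇒G : ∀ w → toSubset w ∈ Es → G w ≡ true
  ∈⇒G w = dec-true (Any.any? (toSubset w ≟ₛ_) Es)

  G-↭ : Symmetric G
  G-↭ p rewrite toSubset-↭ p = refl

  dg : ℕ → List (Fin n) → ℕ
  dg j z = # (W n j) (λ w → G (z ++ w))

  dg-↭ : ∀ j {z z′} → z ↭ z′ → dg j z ≡ dg j z′
  dg-↭ j p = ∑-cong (W n j) (λ w → cong 𝟙 (G-↭ (Perm.++⁺ʳ w p)))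

  dg-split : ∀ i j z → dg (i + j) z ≡ ∑ (W n i) (λ u → dg j (z ++ u))
  dg-split i j z = trans (∑-words-+ (allFin n) i j _)
    (∑-cong (W n i) (λ u → ∑-cong (W n j) (λ v → cong (𝟙 ∘ G) (sym (++-assoc z u v)))))

  -- z is fat if its degree has the largest possible order of magnitude, n ^ j, where j = r ∸ length z.
  fat : ℕ → ℕ → List (Fin n) → Bool
  fat j K z = n ^ j ≤ᵇ K * dg j z

  fat-↭ : ∀ j K → Symmetric (fat j K)
  fat-↭ j K p rewrite dg-↭ j p = refl

  fat⇒ : ∀ j K z → fat j K z ≡ true → n ^ j ≤ K * dg j z
  fat⇒ j K z h = ≤ᵇ⇒≤ _ _ (subst T (sym h) _)

  ¬fat⇒ : ∀ j K z → fat j K z ≡ false → K * dg j z < n ^ j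
  ¬fat⇒ j K z h = ≰⇒> λ le → subst T h (≤⇒≤ᵇ le)

  -- Markov's inequality: each fat extension of `z` accounts for at least n^j/K of the degree of
  -- `z`.
  #-fat : ∀ i j K z → n ^ j * # (W n i) (λ u → fat j K (z ++ u)) ≤ K * dg (i + j) z
  #-fat i j K z = begin
    n ^ j * # (W n i) (λ u → fat j K (z ++ u))          ≡⟨ ∑-*ˡ (n ^ j) (W n i) _ ⟩
    ∑ (W n i) (λ u → n ^ j * 𝟙 (fat j K (z ++ u)))      ≤⟨ ∑-mono (W n i) (λ {u} _ → at (z ++ u)) ⟩
    ∑ (W n i) (λ u → K * dg j (z ++ u))                 ≡⟨ ∑-*ˡ K (W n i) _ ⟨
    K * ∑ (W n i) (λ u → dg j (z ++ u))                 ≡⟨ cong (K *_) (dg-split i j z) ⟨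
    K * dg (i + j) z                                    ∎
    where
    open ≤-Reasoning
    at : ∀ z → n ^ j * 𝟙 (fat j K z) ≤ K * dg j z
    at z with fat j K z in eq
    ... | true  = ≤-trans (≤-reflexive (*-identityʳ _)) (fat⇒ j K z eq)
    ... | false = ≤-trans (≤-reflexive (*-zeroʳ (n ^ j))) z≤n

  -- A word ordering an edge uses only the r vertices of that edge.
  dg-total : ∀ r → All (λ e → ∣ e ∣ ≡ r) Es → dg r [] ≤ length Es * r ^ r
  dg-total r unif = begin
    # (W n r) G                                                       ≤⟨ ∑-mono (W n r) (λ {w} _ → at w) ⟩
    ∑ (W n r) (λ w → ∑ Es (λ e → 𝟙 (does (toSubset w ≟ₛ e))))         ≡⟨ ∑-swap (W n r) Es _ ⟩
    ∑ Es (λ e → # (W n r) (λ w → does (toSubset w ≟ₛ e)))             ≤⟨ ∑-bound Es orderings ⟩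
    length Es * r ^ r                                                 ∎
    where
    open ≤-Reasoning
    at : ∀ w → 𝟙 (G w) ≤ ∑ Es (λ e → 𝟙 (does (toSubset w ≟ₛ e)))
    at w with G w in eq
    ... | false = z≤n
    ... | true  = ≤-trans (≤-reflexive (cong 𝟙 (sym (dec-true (toSubset w ≟ₛ toSubset w) refl))))
                    (term≤∑ {f = λ e → 𝟙 (does (toSubset w ≟ₛ e))} (G⇒∈ w eq))
    orderings : ∀ {e} → e ∈ Es → # (W n r) (λ w → does (toSubset w ≟ₛ e)) ≤ r ^ r
    orderings {e} e∈ = ≤-trans
      (#-injection _≟ʷ_ (words (elems e) r) id _ (λ _ → true) (W-unique n r) inside)
      (≤-reflexive (trans (∑-const (words (elems e) r) 1) (trans (*-identityʳ _) (trans (length-words (elems e) r)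
        (cong (_^ r) (trans (length-elems e) (All.lookup unif e∈)))))))
      where
      inside : ∀ {w} → w ∈ W n r → does (toSubset w ≟ₛ e) ≡ true → ∃[ w′ ] w′ ∈ words (elems e) r × true ≡ true × w′ ≡ w
      inside {w} w∈ h = w , subst (λ k → w ∈ words (elems e) k) (∈-words⇒length r w∈)
        (∈-words (All.tabulate λ x∈ → ∈-toSubset⁻ (elems e)
          (subst (_ ∈ₛ_) (trans (does⇒ (toSubset w ≟ₛ e) h) (sym (toSubset-elems e))) (∈-toSubset⁺ x∈)))) , refl , refl

-- The upper bound

select : (A → Bool) → List A → List A
select p = filter (λ x → p x Bool.≟ true)

length-select : ∀ (p : A → Bool) xs → length (select p xs) ≡ # xs p
length-select p []       = refl
length-select p (x ∷ xs) with p x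
... | true  = cong suc (length-select p xs)
... | false = length-select p xs

∈-select⁺ : ∀ (p : A → Bool) {xs x} → x ∈ xs → p x ≡ true → x ∈ select p xs
∈-select⁺ p = ∈-filter⁺ (λ x → p x Bool.≟ true)

∈-select⁻ : ∀ (p : A → Bool) {xs x} → x ∈ select p xs → x ∈ xs × p x ≡ true
∈-select⁻ p {xs} = ∈-filter⁻ (λ x → p x Bool.≟ true) {xs = xs}

bring : ∀ {x : A} {w} → x ∈ w → ∃[ w′ ] w ↭ x ∷ w′
bring x∈ with ∈-∃++ x∈
... | ys , zs , refl = ys ++ zs , Perm.shift _ ys zs

#-containing-any : ∀ {n} k (q : List (Fin n) → Bool) c .{{_ : NonZero n}} → c * k ≤ n → ∀ x →
  c * # (W n k) (λ v → q v ∧ (x ∈ᵇ v)) ≤ n ^ k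
#-containing-any {n} k q c ck≤n x = ≤-trans (*-monoʳ-≤ c (≤-trans
    (#-mono (W n k) (λ {v} _ h → proj₂ (∧-true {q v} h)))
    (#-containing k (λ _ → true) (λ _ → refl) x)))
  (go k ck≤n)
  where
  open ≤-Reasoning
  go : ∀ k → c * k ≤ n → c * (k * # (W n (k ∸ 1)) (λ _ → true)) ≤ n ^ k
  go zero    _    = ≤-trans (≤-reflexive (*-zeroʳ c)) z≤n
  go (suc k) ck≤n = begin
    c * (suc k * # (W n k) (λ _ → true)) ≡⟨ *-assoc c (suc k) _ ⟨
    c * suc k * # (W n k) (λ _ → true)   ≤⟨ *-mono-≤ ck≤n (≤-reflexive (trans (∑-const (W n k) 1) (trans (*-identityʳ _) (length-W n k)))) ⟩
    n * n ^ k                            ∎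

module _ {n : ℕ} .{{_ : NonZero n}} (Es : List (Subset n)) where
  open Degree Es

  -- If w₁u₀ is not fat, Markov leaves at most Ka1·n/Ka letters w₂ for which w₁w₂u₀ is fat. Thus w =
  -- w₁, and by symmetry w = w₂, allows Ka1·n/Ka choices of the other letter times n^b₂ words v₀. If
  -- w lies in v₀, there are n choices of w₁ with as many w₂, but only b₂·n^(b₂-1) words v₀. The sum
  -- has the factor 2 + b₂ = suc b₁.
  #-pair-spread : ∀ b₁ b₂ → b₁ ≡ suc b₂ → ∀ Ka Ka1 u₀ (q : List (Fin n) → Bool) →
    (∀ w₁ w₂ v₀ → suc (length v₀) ≡ b₁ → q (w₁ ∷ w₂ ∷ v₀) ≡ true → fat b₁ Ka1 (w₁ ∷ w₂ ∷ u₀) ≡ true ×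
       fat (suc b₁) Ka (w₁ ∷ u₀) ≡ false × fat (suc b₁) Ka (w₂ ∷ u₀) ≡ false) →
    ∀ w → Ka * # (W n (suc b₁)) (λ v → q v ∧ (w ∈ᵇ v)) ≤ suc b₁ * Ka1 * n ^ b₁
  #-pair-spread .(suc b₂) b₂ refl Ka Ka1 u₀ q hq w = begin
    Ka * # (W n (2 + b₂)) (λ v → q v ∧ (w ∈ᵇ v))
      ≡⟨ cong (Ka *_) (trans (∑-words-suc V (suc b₂) _) (∑-cong V (λ w₁ → ∑-words-suc V b₂ _))) ⟩
    Ka * ∑ V (λ w₁ → ∑ V (λ w₂ → # (W n b₂) (λ v₀ → q (w₁ ∷ w₂ ∷ v₀) ∧ (w ∈ᵇ (w₁ ∷ w₂ ∷ v₀)))))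
      ≤⟨ *-monoʳ-≤ Ka (∑-mono V (λ {w₁} _ → ∑-mono V (λ {w₂} _ → inner w₁ w₂))) ⟩
    Ka * ∑ V (λ w₁ → ∑ V (λ w₂ → δ w₁ * (Y * 𝟙 (f w₁ w₂)) + δ w₂ * (Y * 𝟙 (f w₁ w₂)) + c * 𝟙 (f w₁ w₂)))
      ≡⟨ cong (Ka *_) (∑-cong V (λ w₁ → trans (∑-+ V _ _) (cong₂ _+_ (∑-+ V _ _) (sym (∑-*ˡ c V (λ w₂ → 𝟙 (f w₁ w₂))))))) ⟩
    Ka * ∑ V (λ w₁ → ∑ V (λ w₂ → δ w₁ * (Y * 𝟙 (f w₁ w₂))) + ∑ V (λ w₂ → δ w₂ * (Y * 𝟙 (f w₁ w₂))) + c * # V (f w₁))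
      ≤⟨ *-monoʳ-≤ Ka (∑-mono V (λ {w₁} _ → +-monoˡ-≤ (c * # V (f w₁)) (+-mono-≤ (≤-reflexive (trans (sym (∑-*ˡ (δ w₁) V _)) (cong (δ w₁ *_) (sym (∑-*ˡ Y V _))))) (#-head w (λ w₂ → Y * 𝟙 (f w₁ w₂)))))) ⟩
    Ka * ∑ V (λ w₁ → δ w₁ * (Y * # V (f w₁)) + Y * 𝟙 (f w₁ w) + c * # V (f w₁))
      ≡⟨ cong (Ka *_) (trans (∑-+ V _ _) (cong (_+ ∑ V (λ w₁ → c * # V (f w₁))) (∑-+ V _ _))) ⟩
    Ka * (∑ V (λ w₁ → δ w₁ * (Y * # V (f w₁))) + ∑ V (λ w₁ → Y * 𝟙 (f w₁ w)) + ∑ V (λ w₁ → c * # V (f w₁)))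
      ≤⟨ *-monoʳ-≤ Ka (+-monoˡ-≤ (∑ V (λ w₁ → c * # V (f w₁))) (+-mono-≤ (#-head w (λ w₁ → Y * # V (f w₁)))
           (≤-reflexive (trans (sym (∑-*ˡ Y V (λ w₁ → 𝟙 (f w₁ w)))) (cong (Y *_) (∑-cong V (λ w₁ → cong 𝟙 (f-sym w₁ w)))))))) ⟩
    Ka * (Y * # V (f w) + Y * # V (f w) + ∑ V (λ w₁ → c * # V (f w₁)))
      ≡⟨ trans (expand Ka Y (# V (f w)) _) (cong (Y * (Ka * # V (f w)) + Y * (Ka * # V (f w)) +_) (trans (∑-*ˡ Ka V _) (∑-cong V (λ w₁ → swap₁ Ka c _)))) ⟩
    Y * (Ka * # V (f w)) + Y * (Ka * # V (f w)) + ∑ V (λ w₁ → c * (Ka * # V (f w₁)))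
      ≤⟨ +-mono-≤ (+-mono-≤ (*-monoʳ-≤ Y (row w)) (*-monoʳ-≤ Y (row w))) (∑-bound V (λ {w₁} _ → *-monoʳ-≤ c (row w₁))) ⟩
    Y * (Ka1 * n) + Y * (Ka1 * n) + length V * (c * (Ka1 * n))
      ≡⟨ cong (λ l → Y * (Ka1 * n) + Y * (Ka1 * n) + l * (c * (Ka1 * n))) (length-tabulate {n = n} id) ⟩
    Y * (Ka1 * n) + Y * (Ka1 * n) + n * (c * (Ka1 * n))
      ≡⟨ regroup Y (Ka1 * n) n c ⟩
    (Y + Y + n * c) * (Ka1 * n)
      ≤⟨ *-monoˡ-≤ (Ka1 * n) (+-monoʳ-≤ (Y + Y) (nc≤ b₂)) ⟩
    (Y + Y + b₂ * Y) * (Ka1 * n)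
      ≡⟨ final b₂ Y Ka1 n ⟩
    (2 + b₂) * Ka1 * (n * Y) ∎
    where
    open ≤-Reasoning
    V : List (Fin n)
    V = allFin n
    Y c : ℕ
    Y = n ^ b₂
    c = # (W n b₂) (λ v → w ∈ᵇ v)
    δ : Fin n → ℕ
    δ y = 𝟙 (does (w Fin.≟ y))
    f : Fin n → Fin n → Bool
    f w₁ w₂ = fat (suc b₂) Ka1 (w₁ ∷ w₂ ∷ u₀) ∧ (not (fat (2 + b₂) Ka (w₁ ∷ u₀)) ∧ not (fat (2 + b₂) Ka (w₂ ∷ u₀)))
    f-sym : ∀ w₁ w₂ → f w₁ w₂ ≡ f w₂ w₁
    f-sym w₁ w₂ = cong₂ _∧_ (fat-↭ (suc b₂) Ka1 {w₁ ∷ w₂ ∷ u₀} {w₂ ∷ w₁ ∷ u₀} (Perm.swap w₁ w₂ ↭-refl)) (Bool.∧-comm (not (fat (2 + b₂) Ka (w₁ ∷ u₀))) _)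
    expand : ∀ k y x z → k * (y * x + y * x + z) ≡ y * (k * x) + y * (k * x) + k * z
    expand = solve-∀
    swap₁ : ∀ x y z → x * (y * z) ≡ y * (x * z)
    swap₁ = solve-∀
    regroup : ∀ y k n c → y * k + y * k + n * (c * k) ≡ (y + y + n * c) * k
    regroup = solve-∀
    final : ∀ b y k n → (y + y + b * y) * (k * n) ≡ (2 + b) * k * (n * y)
    final = solve-∀
    nc≤ : ∀ k → n * # (W n k) (λ v → w ∈ᵇ v) ≤ k * n ^ k
    nc≤ k = ≤-trans (*-monoʳ-≤ n (#-containing k (λ _ → true) (λ _ → refl) w)) (go k)
      where
      go : ∀ k → n * (k * # (W n (k ∸ 1)) (λ _ → true)) ≤ k * n ^ k
      go zero    = ≤-reflexive (*-zeroʳ n)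
      go (suc k) = ≤-reflexive (trans (cong (λ x → n * (suc k * x)) (trans (∑-const (W n k) 1) (trans (*-identityʳ _) (length-W n k)))) (swap₁ n (suc k) (n ^ k)))
    row : ∀ w₁ → Ka * # V (f w₁) ≤ Ka1 * n
    row w₁ = ≤-trans (*-monoʳ-≤ Ka (#-witness V (f w₁) {c = cnt} few)) bounded
      where
      nonfat = fat (2 + b₂) Ka (w₁ ∷ u₀)
      cnt = if nonfat then 0 else # V (λ w₂ → fat (suc b₂) Ka1 (w₁ ∷ w₂ ∷ u₀))
      few : ∀ {w₂} → w₂ ∈ V → f w₁ w₂ ≡ true → # V (f w₁) ≤ cnt
      few {w₂} _ h with fat (2 + b₂) Ka (w₁ ∷ u₀) | proj₁ (∧-true {not (fat (2 + b₂) Ka (w₁ ∷ u₀))} (proj₂ (∧-true {fat (suc b₂) Ka1 (w₁ ∷ w₂ ∷ u₀)} h)))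
      ... | false | _ = #-mono V (λ {x} _ h′ → proj₁ (∧-true {fat (suc b₂) Ka1 (w₁ ∷ x ∷ u₀)} h′))
      bounded : Ka * cnt ≤ Ka1 * n
      bounded with fat (2 + b₂) Ka (w₁ ∷ u₀) in eq
      ... | true  = ≤-trans (≤-reflexive (*-zeroʳ Ka)) z≤n
      ... | false = *-cancelˡ-≤ (n ^ suc b₂) {{m^n≢0 n (suc b₂)}} (begin
        n ^ suc b₂ * (Ka * # V (λ w₂ → fat (suc b₂) Ka1 (w₁ ∷ w₂ ∷ u₀)))
          ≡⟨ swap₁ (n ^ suc b₂) Ka _ ⟩
        Ka * (n ^ suc b₂ * # V (λ w₂ → fat (suc b₂) Ka1 (w₁ ∷ w₂ ∷ u₀)))
          ≡⟨ cong (λ x → Ka * (n ^ suc b₂ * x)) (trans (∑-cong V (λ w₂ → trans (cong 𝟙 (fat-↭ (suc b₂) Ka1 (Perm.prep w₁ (Perm.∷↭∷ʳ w₂ u₀)))) (sym (+-identityʳ _))))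
               (sym (∑-words-suc V 0 (λ u → 𝟙 (fat (suc b₂) Ka1 ((w₁ ∷ u₀) ++ u)))))) ⟩
        Ka * (n ^ suc b₂ * # (W n 1) (λ u → fat (suc b₂) Ka1 ((w₁ ∷ u₀) ++ u)))
          ≤⟨ *-monoʳ-≤ Ka (#-fat 1 (suc b₂) Ka1 (w₁ ∷ u₀)) ⟩
        Ka * (Ka1 * dg (2 + b₂) (w₁ ∷ u₀))
          ≡⟨ swap₁ Ka Ka1 _ ⟩
        Ka1 * (Ka * dg (2 + b₂) (w₁ ∷ u₀))
          ≤⟨ *-monoʳ-≤ Ka1 (<⇒≤ (¬fat⇒ (2 + b₂) Ka (w₁ ∷ u₀) eq)) ⟩
        Ka1 * (n * n ^ suc b₂)
          ≡⟨ rotate Ka1 n (n ^ suc b₂) ⟩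
        n ^ suc b₂ * (Ka1 * n) ∎)
        where
        rotate : ∀ x y z → x * (y * z) ≡ z * (x * y)
        rotate = solve-∀
    inner : ∀ w₁ w₂ → # (W n b₂) (λ v₀ → q (w₁ ∷ w₂ ∷ v₀) ∧ (w ∈ᵇ (w₁ ∷ w₂ ∷ v₀)))
                    ≤ δ w₁ * (Y * 𝟙 (f w₁ w₂)) + δ w₂ * (Y * 𝟙 (f w₁ w₂)) + c * 𝟙 (f w₁ w₂)
    inner w₁ w₂ = begin
      # (W n b₂) (λ v₀ → q (w₁ ∷ w₂ ∷ v₀) ∧ (w ∈ᵇ (w₁ ∷ w₂ ∷ v₀)))
        ≤⟨ ∑-mono (W n b₂) (λ {v₀} v₀∈ → at v₀ (cong suc (∈-words⇒length b₂ v₀∈))) ⟩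
      ∑ (W n b₂) (λ v₀ → (δ w₁ + δ w₂) * φ + φ * 𝟙 (w ∈ᵇ v₀))
        ≡⟨ trans (∑-+ (W n b₂) _ _) (cong₂ _+_ (trans (∑-const (W n b₂) _) (cong (_* ((δ w₁ + δ w₂) * φ)) (length-W n b₂))) (sym (∑-*ˡ φ (W n b₂) (λ v₀ → 𝟙 (w ∈ᵇ v₀))))) ⟩
      Y * ((δ w₁ + δ w₂) * φ) + φ * c
        ≡⟨ rearrange Y (δ w₁) (δ w₂) φ c ⟩
      δ w₁ * (Y * φ) + δ w₂ * (Y * φ) + c * φ ∎
      where
      φ = 𝟙 (f w₁ w₂)
      rearrange : ∀ y a b f c → y * ((a + b) * f) + f * c ≡ a * (y * f) + b * (y * f) + c * f
      rearrange = solve-∀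
      at : ∀ v₀ → suc (length v₀) ≡ suc b₂ → 𝟙 (q (w₁ ∷ w₂ ∷ v₀) ∧ (w ∈ᵇ (w₁ ∷ w₂ ∷ v₀))) ≤ (δ w₁ + δ w₂) * φ + φ * 𝟙 (w ∈ᵇ v₀)
      at v₀ lv with q (w₁ ∷ w₂ ∷ v₀) in eq
      ... | false = z≤n
      ... | true with hq w₁ w₂ v₀ lv eq
      ...   | f₁ , f₂ , f₃ rewrite f₁ | f₂ | f₃ with w Fin.≟ w₁ | w Fin.≟ w₂
      ...     | yes _ | _     = s≤s z≤n
      ...     | no _  | yes _ = s≤s z≤n
      ...     | no _  | no _  = ≤-reflexive (sym (+-identityʳ _))

-- Negligible classes of edges

module Cases {n s t a₁ b₁ : ℕ} .{{_ : NonZero n}} (E : Fin s → Fin t → Bool) (connected : Connected E) (i₀ : Fin s) (j₀ : Fin t)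
  {P} (g : Grow E P) (all : ∀ z → z ∈ P)
  (Es : List (Subset n)) (distinct : Unique Es) (uniform : All (λ F → ∣ F ∣ ≡ suc a₁ + suc b₁) Es)
  (free : ¬ Embedding E (IsEdge Es (suc a₁) (suc b₁)))
  (e m Z Ka Ka1 Kb1 K1 M : ℕ) .{{_ : NonZero Z}} .{{_ : NonZero Ka}} .{{_ : NonZero Ka1}} .{{_ : NonZero Kb1}} .{{_ : NonZero M}}
  (total : length Es * (suc a₁ + suc b₁) ^ (suc a₁ + suc b₁) ≤ Z * n ^ (a₁ + suc b₁))
  (P≤m : length P * (suc a₁ + suc b₁) ≤ m)
  where

  open Degree Es

  -- The unit of error is `X` = n^(r-1); each negligible class is shown to have at most X/e edges.
  a b r r₁ X : ℕ
  a  = suc a₁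
  b  = suc b₁
  r  = a + b
  r₁ = a₁ + b
  X  = n ^ r₁

  len : ∀ k {w} → w ∈ W n k → length w ≡ k
  len k w∈ = ∈-words⇒length {as = allFin n} k w∈

  X≡ₐ : X ≡ n ^ a₁ * n ^ b
  X≡ₐ = ^-distribˡ-+-* n a₁ b

  X≡ᵦ : X ≡ n ^ a * n ^ b₁
  X≡ᵦ = trans (cong (n ^_) (+-suc a₁ b₁)) (^-distribˡ-+-* n a b₁)

  dg-r : dg r [] ≤ Z * X
  dg-r = ≤-trans (dg-total r uniform) total

  -- One ordering per edge is enough, so `q` may prescribe which part of an edge goes to which blob.
  edge-count : ∀ j k (c : Subset n → Bool) (q : List (Fin n) → List (Fin n) → Bool) →
    (∀ {F} → F ∈ Es → c F ≡ true → ∃[ u ] ∃[ v ] length u ≡ j × length v ≡ k × toSubset (u ++ v) ≡ F × q u v ≡ true) →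
    # Es c ≤ ∑ (W n j) (λ u → # (W n k) (q u))
  edge-count j k c q h = ≤-trans
    (#-injection _≟ₛ_ (cartesianProduct (W n j) (W n k)) (λ (u , v) → toSubset (u ++ v)) c (uncurry q) distinct
      (λ F∈ cF → let u , v , lu , lv , eq , quv = h F∈ cF in (u , v) , ∈-cartesianProduct⁺ (∈-W u lu) (∈-W v lv) , quv , eq))
    (≤-reflexive (∑-cartesianProductWith _,_ (W n j) (W n k) _))

  ordering : ∀ j k → j + k ≡ r → ∀ {F} → F ∈ Es → ∃[ u ] ∃[ v ] length u ≡ j × length v ≡ k × toSubset (u ++ v) ≡ F
  ordering j k j+k≡r {F} F∈ = take j w , drop j w ,
      trans (length-take j w) (m≤n⇒m⊓n≡m (≤-trans (m≤m+n j k) (≤-reflexive (sym lw)))) ,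
      trans (List.length-drop j w) (trans (cong (_∸ j) lw) (m+n∸m≡n j k)) ,
      trans (cong toSubset (List.take++drop≡id j w)) (toSubset-elems F)
    where
    w = elems F
    lw : length w ≡ j + k
    lw = trans (length-elems F) (trans (All.lookup uniform F∈) (sym j+k≡r))

  module _ (j k : ℕ) (Q : List (Fin n) → Bool) (F : Subset n) where

    OrderedBy : List (Fin n) × List (Fin n) → Set
    OrderedBy (u , v) = toSubset (u ++ v) ≡ F × Q u ≡ true

    search : Dec (Any.Any OrderedBy (cartesianProduct (W n j) (W n k)))
    search = Any.any? (λ (u , v) → toSubset (u ++ v) ≟ₛ F ×-dec Q u Bool.≟ true) (cartesianProduct (W n j) (W n k))

    -- For symmetric `Q` this says that `F` contains a `j`-subset with `Q`; quantifying over
    -- orderings turns it into a finite search.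
    has : Bool
    has = does search

  has⇒ : ∀ j k Q F → has j k Q F ≡ true → ∃[ u ] ∃[ v ] length u ≡ j × length v ≡ k × toSubset (u ++ v) ≡ F × Q u ≡ true
  has⇒ j k Q F h with find (does⇒ (search j k Q F) h)
  ... | (u , v) , uv∈ , eq , qu = let u∈ , v∈ = ∈-cartesianProduct⁻ (W n j) (W n k) uv∈ in
        u , v , len j u∈ , len k v∈ , eq , qu

  has⁺ : ∀ j k Q {F} u v → length u ≡ j → length v ≡ k → toSubset (u ++ v) ≡ F → Q u ≡ true → has j k Q F ≡ true
  has⁺ j k Q {F} u v lu lv eq qu = dec-true (search j k Q F) (lose (∈-cartesianProduct⁺ (∈-W u lu) (∈-W v lv)) (eq , qu))

  ¬has⇒ : ∀ j k Q {F} → has j k Q F ≡ false → ∀ u v → length u ≡ j → length v ≡ k → toSubset (u ++ v) ≡ F → Q u ≡ false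
  ¬has⇒ j k Q h u v lu lv eq with Q u in qu
  ... | false = refl
  ... | true  = ⊥-elim (true≢false (has⁺ j k Q u v lu lv eq qu) h)

  inL : Fin n → Bool
  inL x = fat r₁ K1 (x ∷ [])

  allL : List (Fin n) → Bool
  allL []      = true
  allL (x ∷ w) = inL x ∧ allL w

  -- The edge contains a fat vertex, a fat a-set, a fat (b + 1)-set, a fat (a + 1)-set, respectively.
  hL h3 h4 h5 : Subset n → Bool
  hL = has 1 r₁ allL
  h3 = has a b (fat b Ka)
  h4 = has (suc b) a₁ (fat a₁ Kb1)
  h5 = has (suc a) b₁ (fat b₁ Ka1)

  -- Markov at the empty word: the total degree is O(n^(r-1)), so the number of fat vertices is
  -- bounded independently of n.
  #L : # (allFin n) inL ≤ K1 * Z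
  #L = *-cancelˡ-≤ X {{m^n≢0 n r₁}} (begin
    X * # (allFin n) inL                             ≡⟨ cong (X *_) (trans (∑-cong (allFin n) (λ x → sym (+-identityʳ _))) (sym (∑-words-suc (allFin n) 0 (λ w → 𝟙 (fat r₁ K1 w))))) ⟩
    X * # (W n 1) (λ w → fat r₁ K1 w)                ≤⟨ #-fat 1 r₁ K1 [] ⟩
    K1 * dg r []                                     ≤⟨ *-monoʳ-≤ K1 dg-r ⟩
    K1 * (Z * X)                                     ≡⟨ reorder K1 Z X ⟩
    X * (K1 * Z)                                     ∎)
    where
    open ≤-Reasoning
    reorder : ∀ x y z → x * (y * z) ≡ z * (x * y)
    reorder = solve-∀

  embed-edges : ∀ {p} → Abundant n a b p m → (∀ {u v} → p u v ≡ true → G (u ++ v) ≡ true) → ⊥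
  embed-edges ab p⇒G = let emb , dj , rel = abundant-embed E ab (m≤m+n a b) (m≤n+m b a) g P≤m all in
    free (emb , dj , λ i j eij → let lu , lv , puv = rel i j eij in lu , lv , G⇒∈ (emb (inj₁ i) ++ emb (inj₂ j)) (p⇒G puv))

  remaining : ∀ {x : Fin n} {w w′ k} → w ↭ x ∷ w′ → length w ≡ suc k → length w′ ≡ k
  remaining p lw = suc-injective (trans (sym (Perm.↭-length p)) lw)

  ¬hL⇒ : ∀ {w x} → length w ≡ r → hL (toSubset w) ≡ false → x ∈ w → inL x ≡ false
  ¬hL⇒ {w} {x} lw h x∈ with bring x∈
  ... | w′ , p with inL x | ¬has⇒ 1 r₁ allL h (x ∷ []) w′ refl (remaining p lw) (toSubset-↭ (↭-sym p))
  ...   | false | _ = refl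

  -- There are O(n ^ a₁) fat words of length a, and only few of them contain a given non-fat vertex.
  heavy-U : ∀ D → D ≡ e * (Ka * Z + 1) → D * suc m * b ≤ n → D * suc m * a * Ka ≤ K1 →
    e * # Es (λ F → not (hL F) ∧ h3 F) ≤ X
  heavy-U D refl Db≤n Da≤K1 = ≮⇒≥ λ big → embed-edges (abundant big) (λ {u} {v} h → proj₁ (∧-true (proj₂ (∧-true {fat b Ka u} h))))
    where
    open ≤-Reasoning
    p : List (Fin n) → List (Fin n) → Bool
    p u v = fat b Ka u ∧ (G (u ++ v) ∧ not (hL (toSubset (u ++ v))))

    keys-cost : length (select (fat b Ka) (W n a)) * n ^ b ≤ Ka * Z * X
    keys-cost = begin
      length (select (fat b Ka) (W n a)) * n ^ b    ≡⟨ cong (_* n ^ b) (length-select (fat b Ka) (W n a)) ⟩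
      # (W n a) (fat b Ka) * n ^ b                  ≡⟨ *-comm _ (n ^ b) ⟩
      n ^ b * # (W n a) (fat b Ka)                  ≤⟨ #-fat a b Ka [] ⟩
      Ka * dg r []                                  ≤⟨ *-monoʳ-≤ Ka dg-r ⟩
      Ka * (Z * X)                                  ≡⟨ *-assoc Ka Z X ⟨
      Ka * Z * X                                    ∎

    spread : ∀ v → v ∈ W n b → ∀ w → D * suc m * # (W n a) (λ u → p u v ∧ (w ∈ᵇ u)) ≤ n ^ a₁
    spread v v∈ w = *-cancelˡ-≤ Ka (begin
      Ka * (D * suc m * # (W n a) (λ u → p u v ∧ (w ∈ᵇ u)))
        ≤⟨ *-monoʳ-≤ Ka (*-monoʳ-≤ (D * suc m) (#-witness (W n a) _ few)) ⟩
      Ka * (D * suc m * (a * cnt))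
        ≡⟨ reorder Ka (D * suc m) a cnt ⟩
      D * suc m * a * Ka * cnt
        ≤⟨ *-monoˡ-≤ cnt Da≤K1 ⟩
      K1 * cnt
        ≤⟨ bound ⟩
      Ka * n ^ a₁ ∎)
      where
      cnt = if inL w then 0 else # (W n a₁) (λ u → fat b Ka (w ∷ u))
      reorder : ∀ k d a c → k * (d * (a * c)) ≡ d * a * k * c
      reorder = solve-∀
      few : ∀ {u} → u ∈ W n a → p u v ∧ (w ∈ᵇ u) ≡ true → # (W n a) (λ u → p u v ∧ (w ∈ᵇ u)) ≤ a * cnt
      few {u} u∈ h with ∧-true {p u v} h
      ... | puv , w∈u with inL w | ¬hL⇒ {u ++ v} {w} (trans (length-++ u) (cong₂ _+_ (len a u∈) (len b v∈)))
                                     (not-true (proj₂ (∧-true {G (u ++ v)} (proj₂ (∧-true {fat b Ka u} puv))))) (∈-++⁺ˡ (∈ᵇ⇒∈ w u w∈u))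
      ...   | false | refl = ≤-trans
                (#-mono (W n a) (λ {u′} _ h′ → let puv′ , w∈ = ∧-true {p u′ v} h′ in ∧-intro (proj₁ (∧-true {fat b Ka u′} puv′)) w∈))
                (#-containing a (fat b Ka) (fat-↭ b Ka) w)
      bound : K1 * cnt ≤ Ka * n ^ a₁
      bound with inL w in eq
      ... | true  = ≤-trans (≤-reflexive (*-zeroʳ K1)) z≤n
      ... | false = *-cancelˡ-≤ (n ^ b) {{m^n≢0 n b}} (begin
        n ^ b * (K1 * # (W n a₁) (λ u → fat b Ka (w ∷ u)))    ≡⟨ swap₁ (n ^ b) K1 _ ⟩
        K1 * (n ^ b * # (W n a₁) (λ u → fat b Ka (w ∷ u)))    ≤⟨ *-monoʳ-≤ K1 (#-fat a₁ b Ka (w ∷ [])) ⟩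
        K1 * (Ka * dg r₁ (w ∷ []))                            ≡⟨ swap₁ K1 Ka _ ⟩
        Ka * (K1 * dg r₁ (w ∷ []))                            ≤⟨ *-monoʳ-≤ Ka (<⇒≤ (¬fat⇒ r₁ K1 (w ∷ []) eq)) ⟩
        Ka * X                                                ≡⟨ trans (cong (Ka *_) X≡ₐ) (swap₂ Ka (n ^ a₁) (n ^ b)) ⟩
        n ^ b * (Ka * n ^ a₁)                                 ∎)
        where
        swap₁ : ∀ x y z → x * (y * z) ≡ y * (x * z)
        swap₁ = solve-∀
        swap₂ : ∀ x y z → x * (y * z) ≡ z * (x * y)
        swap₂ = solve-∀

    abundant : X < e * # Es (λ F → not (hL F) ∧ h3 F) → Abundant n a b p m
    abundant big = record
      -- At most Ka·Z·n^a₁ words are fat, so threshold n^b costs Ka·Z·X on their side; the n^b words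
      -- of the other side cost X at threshold n^a₁. The sum (Ka·Z + 1)·X is the origin of `D`.
      { D = D ; Θᵤ = n ^ b ; Θᵥ = n ^ a₁
      ; keysᵤ = select (fat b Ka) (W n a) ; keysᵥ = W n b
      ; keyᵤ = λ {u} u∈ _ h → ∈-select⁺ (fat b Ka) u∈ (proj₁ (∧-true {fat b Ka u} h))
      ; keyᵥ = λ _ v∈ _ → v∈
      ; cost = begin-strict
          length (select (fat b Ka) (W n a)) * n ^ b + length (W n b) * n ^ a₁
            ≤⟨ +-mono-≤ keys-cost (≤-reflexive (trans (cong (_* n ^ a₁) (length-W n b)) (trans (*-comm (n ^ b) _) (sym X≡ₐ)))) ⟩
          Ka * Z * X + X
            ≡⟨ collect (Ka * Z) X ⟩
          (Ka * Z + 1) * X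
            <⟨ *-monoʳ-< (Ka * Z + 1) {{m+1≢0 (Ka * Z)}} big ⟩
          (Ka * Z + 1) * (e * # Es (λ F → not (hL F) ∧ h3 F))
            ≡⟨ trans (sym (*-assoc (Ka * Z + 1) e _)) (cong (_* # Es (λ F → not (hL F) ∧ h3 F)) (*-comm (Ka * Z + 1) e)) ⟩
          D * # Es (λ F → not (hL F) ∧ h3 F)
            ≤⟨ *-monoʳ-≤ D (edge-count a b _ p classify) ⟩
          D * ∑ (W n a) (λ u → # (W n b) (p u)) ∎
      ; spreadᵥ = λ u _ w → #-containing-any b (p u) (D * suc m) Db≤n w
      ; spreadᵤ = spread
      }
      where
      m+1≢0 : ∀ x → NonZero (x + 1)
      m+1≢0 x = >-nonZero (m≤n+m 1 x)
      collect : ∀ x y → x * y + y ≡ (x + 1) * y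
      collect = solve-∀
      classify : ∀ {F} → F ∈ Es → not (hL F) ∧ h3 F ≡ true →
        ∃[ u ] ∃[ v ] length u ≡ a × length v ≡ b × toSubset (u ++ v) ≡ F × p u v ≡ true
      classify {F} F∈ h with ∧-true {not (hL F)} h
      ... | ¬L , is3 with has⇒ a b (fat b Ka) F is3
      ...   | u , v , lu , lv , refl , fu = u , v , lu , lv , refl , ∧-intro fu (∧-intro (∈⇒G (u ++ v) F∈) ¬L)

  -- A fat (b + 1)-set contained in an a-set would typically make the a-set fat; this is where b < a is needed.
  light-U : ∀ y → y + b ≡ a₁ → e * (Kb1 * Z) ≤ Ka → e * # Es (λ F → not (h3 F) ∧ h4 F) ≤ X
  light-U y y+b≡a₁ small = *-cancelˡ-≤ (Kb1 * Z) {{m*n≢0 Kb1 Z}} (begin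
    Kb1 * Z * (e * # Es (λ F → not (h3 F) ∧ h4 F))                 ≡⟨ reorder (Kb1 * Z) e _ ⟩
    e * (Kb1 * Z) * # Es (λ F → not (h3 F) ∧ h4 F)                 ≤⟨ *-mono-≤ small (edge-count (suc b) a₁ _ q classify) ⟩
    Ka * ∑ (W n (suc b)) (λ z → # (W n a₁) (q z))                  ≡⟨ ∑-*ˡ Ka (W n (suc b)) _ ⟩
    ∑ (W n (suc b)) (λ z → Ka * # (W n a₁) (q z))                  ≤⟨ ∑-mono (W n (suc b)) (λ {z} z∈ → rest z z∈) ⟩
    ∑ (W n (suc b)) (λ z → n ^ a₁ * 𝟙 (fat a₁ Kb1 z))              ≡⟨ ∑-*ˡ (n ^ a₁) (W n (suc b)) _ ⟨
    n ^ a₁ * # (W n (suc b)) (fat a₁ Kb1)                          ≤⟨ #-fat (suc b) a₁ Kb1 [] ⟩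
    Kb1 * dg (suc b + a₁) []                                       ≡⟨ cong (λ k → Kb1 * dg (suc k) []) (+-comm b a₁) ⟩
    Kb1 * dg r []                                                  ≤⟨ *-monoʳ-≤ Kb1 dg-r ⟩
    Kb1 * (Z * X)                                                  ≡⟨ *-assoc Kb1 Z X ⟨
    Kb1 * Z * X                                                    ∎)
    where
    open ≤-Reasoning
    reorder : ∀ x y z → x * (y * z) ≡ y * x * z
    reorder = solve-∀
    q : List (Fin n) → List (Fin n) → Bool
    q z x = fat a₁ Kb1 z ∧ (G (z ++ x) ∧ not (h3 (toSubset (z ++ x))))
    classify : ∀ {F} → F ∈ Es → not (h3 F) ∧ h4 F ≡ true →
      ∃[ u ] ∃[ v ] length u ≡ suc b × length v ≡ a₁ × toSubset (u ++ v) ≡ F × q u v ≡ true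
    classify {F} F∈ h with ∧-true {not (h3 F)} h
    ... | ¬3 , is4 with has⇒ (suc b) a₁ (fat a₁ Kb1) F is4
    ...   | u , v , lu , lv , refl , fu = u , v , lu , lv , refl , ∧-intro fu (∧-intro (∈⇒G (u ++ v) F∈) ¬3)
    -- The first `y` of the remaining a - 1 letters complete `z` to a word of length b + 1 + y = a.
    -- It is not fat, which leaves at most n^b/Ka choices for the last `b` letters.
    rest : ∀ z → z ∈ W n (suc b) → Ka * # (W n a₁) (q z) ≤ n ^ a₁ * 𝟙 (fat a₁ Kb1 z)
    rest z z∈ with fat a₁ Kb1 z
    ... | false = ≤-trans (≤-reflexive (trans (cong (Ka *_) (∑-zero (W n a₁))) (*-zeroʳ Ka))) z≤n
    ... | true  = begin
      Ka * # (W n a₁) q′                                            ≡⟨ cong (λ k → Ka * # (W n k) q′) y+b≡a₁ ⟨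
      Ka * # (W n (y + b)) q′                                       ≡⟨ cong (Ka *_) (∑-words-+ (allFin n) y b _) ⟩
      Ka * ∑ (W n y) (λ x → # (W n b) (λ v → q′ (x ++ v)))          ≡⟨ ∑-*ˡ Ka (W n y) _ ⟩
      ∑ (W n y) (λ x → Ka * # (W n b) (λ v → q′ (x ++ v)))          ≤⟨ ∑-bound (W n y) few ⟩
      length (W n y) * n ^ b                                        ≡⟨ cong (_* n ^ b) (length-W n y) ⟩
      n ^ y * n ^ b                                                 ≡⟨ trans (sym (^-distribˡ-+-* n y b)) (cong (n ^_) y+b≡a₁) ⟩
      n ^ a₁                                                        ≡⟨ *-identityʳ _ ⟨
      n ^ a₁ * 1                                                    ∎
      where
      q′ : List (Fin n) → Bool
      q′ x = G (z ++ x) ∧ not (h3 (toSubset (z ++ x)))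
      few : ∀ {x} → x ∈ W n y → Ka * # (W n b) (λ v → q′ (x ++ v)) ≤ n ^ b
      few {x} x∈ = ≤-trans (*-monoʳ-≤ Ka (#-witness (W n b) (λ v → q′ (x ++ v)) {c = cnt} small′)) bounded
        where
        cnt = if fat b Ka (z ++ x) then 0 else dg b (z ++ x)
        small′ : ∀ {v} → v ∈ W n b → q′ (x ++ v) ≡ true → # (W n b) (λ v → q′ (x ++ v)) ≤ cnt
        small′ {v} v∈ h with fat b Ka (z ++ x) | ¬has⇒ a b (fat b Ka) (not-true (proj₂ (∧-true {G (z ++ x ++ v)} h))) (z ++ x) v
             (trans (length-++ z) (trans (cong₂ _+_ (len (suc b) z∈) (len y x∈)) (cong suc (trans (+-comm b y) y+b≡a₁)))) (len b v∈) (cong toSubset (++-assoc z x v))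
        ... | false | _ = #-mono (W n b) (λ {v′} _ h′ → trans (cong G (++-assoc z x v′)) (proj₁ (∧-true {G (z ++ x ++ v′)} h′)))
        bounded : Ka * cnt ≤ n ^ b
        bounded with fat b Ka (z ++ x) in eq
        ... | true  = ≤-trans (≤-reflexive (*-zeroʳ Ka)) z≤n
        ... | false = <⇒≤ (¬fat⇒ b Ka (z ++ x) eq)

  -- If `w` lies in `u`, then `w ∷ v` orders a (b+1)-subset of an edge of the class and is not fat,
  -- so at most a·n^a₁/Kb1 words `u` contain `w`.
  spread-V : 2 * e * suc m * a ≤ Kb1 → ∀ (p : List (Fin n) → List (Fin n) → Bool) →
    (∀ {u v} → p u v ≡ true → G (u ++ v) ≡ true × h4 (toSubset (u ++ v)) ≡ false) →
    ∀ v → v ∈ W n b → ∀ w → 2 * e * suc m * # (W n a) (λ u → p u v ∧ (w ∈ᵇ u)) ≤ n ^ a₁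
  spread-V small p hp v v∈ w = begin
    2 * e * suc m * # (W n a) (λ u → p u v ∧ (w ∈ᵇ u))      ≤⟨ *-monoʳ-≤ (2 * e * suc m) (#-witness (W n a) _ few) ⟩
    2 * e * suc m * (a * cnt)                               ≡⟨ *-assoc (2 * e * suc m) a cnt ⟨
    2 * e * suc m * a * cnt                                 ≤⟨ *-monoˡ-≤ cnt small ⟩
    Kb1 * cnt                                               ≤⟨ bounded ⟩
    n ^ a₁                                                  ∎
    where
    open ≤-Reasoning
    cnt = if fat a₁ Kb1 (w ∷ v) then 0 else dg a₁ (w ∷ v)
    bounded : Kb1 * cnt ≤ n ^ a₁
    bounded with fat a₁ Kb1 (w ∷ v) in eq
    ... | true  = ≤-trans (≤-reflexive (*-zeroʳ Kb1)) z≤n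
    ... | false = <⇒≤ (¬fat⇒ a₁ Kb1 (w ∷ v) eq)
    few : ∀ {u} → u ∈ W n a → p u v ∧ (w ∈ᵇ u) ≡ true → # (W n a) (λ u → p u v ∧ (w ∈ᵇ u)) ≤ a * cnt
    few {u} u∈ h with ∧-true {p u v} h
    ... | puv , w∈u with bring (∈ᵇ⇒∈ w u w∈u)
    ...   | u′ , perm with fat a₁ Kb1 (w ∷ v) | ¬has⇒ (suc b) a₁ (fat a₁ Kb1) (proj₂ (hp puv)) (w ∷ v) u′ (cong suc (len b v∈)) (remaining perm (len a u∈))
             (toSubset-↭ (↭-sym (↭-trans (Perm.++⁺ʳ v perm) (Perm.prep w (Perm.++-comm u′ v)))))
    ...     | false | _ = ≤-trans
              (#-mono (W n a) (λ {u″} _ h′ → let puv′ , w∈ = ∧-true {p u″ v} h′ in ∧-intro (proj₁ (hp puv′)) w∈))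
              (≤-trans (#-containing a (λ u → G (u ++ v)) (λ p → G-↭ (Perm.++⁺ʳ v p)) w)
                (*-monoʳ-≤ a (≤-reflexive (∑-cong (W n a₁) (λ u″ → cong 𝟙 (G-↭ (Perm.prep w (Perm.++-comm u″ v))))))))

  module _ {c : Subset n → Bool} {p : List (Fin n) → List (Fin n) → Bool} (small : 2 * e * suc m * a ≤ Kb1)
    (hp : ∀ {u v} → p u v ≡ true → G (u ++ v) ≡ true × h4 (toSubset (u ++ v)) ≡ false)
    (classify : ∀ {F} → F ∈ Es → c F ≡ true → ∃[ u ] ∃[ v ] length u ≡ a × length v ≡ b × toSubset (u ++ v) ≡ F × p u v ≡ true)
    (spread-U : ∀ u → u ∈ W n a → ∀ w → 2 * e * suc m * # (W n b) (λ v → p u v ∧ (w ∈ᵇ v)) ≤ n ^ b₁) where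

    -- All words of either length serve as keys. Each side costs X at its threshold, which gives the
    -- factor 2 in `D`.
    light-class : e * # Es c ≤ X
    light-class = ≮⇒≥ λ big → embed-edges (abundant big) (proj₁ ∘ hp)
      where
      open ≤-Reasoning
      abundant : X < e * # Es c → Abundant n a b p m
      abundant big = record
        { D = 2 * e ; Θᵤ = n ^ b₁ ; Θᵥ = n ^ a₁
        ; keysᵤ = W n a ; keysᵥ = W n b
        ; keyᵤ = λ u∈ _ _ → u∈
        ; keyᵥ = λ _ v∈ _ → v∈
        ; cost = begin-strict
            length (W n a) * n ^ b₁ + length (W n b) * n ^ a₁
              ≡⟨ cong₂ (λ x y → x * n ^ b₁ + y * n ^ a₁) (length-W n a) (length-W n b) ⟩
            n ^ a * n ^ b₁ + n ^ b * n ^ a₁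
              ≡⟨ cong₂ _+_ (sym X≡ᵦ) (trans (*-comm (n ^ b) (n ^ a₁)) (sym X≡ₐ)) ⟩
            X + X
              ≡⟨ cong (X +_) (+-identityʳ X) ⟨
            2 * X
              <⟨ *-monoʳ-< 2 big ⟩
            2 * (e * # Es c)
              ≡⟨ *-assoc 2 e _ ⟨
            2 * e * # Es c
              ≤⟨ *-monoʳ-≤ (2 * e) (edge-count a b c p classify) ⟩
            2 * e * ∑ (W n a) (λ u → # (W n b) (p u)) ∎
        ; spreadᵥ = spread-U
        ; spreadᵤ = spread-V small p hp
        }

  -- The argument of `spread-V` with the blobs exchanged: `w ∷ u` orders an (a+1)-subset of an edge.
  -- For b = 1 this would be the whole edge, which is always fat.
  no-heavy : 2 * e * suc m * a ≤ Kb1 → 2 * e * suc m * b ≤ Ka1 → e * # Es (λ F → not (h4 F) ∧ not (h5 F)) ≤ X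
  no-heavy small₄ small₅ = light-class {p = p} small₄
      (λ {u} {v} h → let g′ , h′ = ∧-true {G (u ++ v)} h in g′ , not-true (proj₁ (∧-true {not (h4 (toSubset (u ++ v)))} h′)))
      (λ {F} F∈ h → case ordering a b refl F∈ of λ { (u , v , lu , lv , refl) → u , v , lu , lv , refl , ∧-intro (∈⇒G (u ++ v) F∈) h })
      spread
    where
    open ≤-Reasoning
    p : List (Fin n) → List (Fin n) → Bool
    p u v = G (u ++ v) ∧ (not (h4 (toSubset (u ++ v))) ∧ not (h5 (toSubset (u ++ v))))
    spread : ∀ u → u ∈ W n a → ∀ w → 2 * e * suc m * # (W n b) (λ v → p u v ∧ (w ∈ᵇ v)) ≤ n ^ b₁
    spread u u∈ w = begin
      2 * e * suc m * # (W n b) (λ v → p u v ∧ (w ∈ᵇ v))      ≤⟨ *-monoʳ-≤ (2 * e * suc m) (#-witness (W n b) _ few) ⟩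
      2 * e * suc m * (b * cnt)                               ≡⟨ *-assoc (2 * e * suc m) b cnt ⟨
      2 * e * suc m * b * cnt                                 ≤⟨ *-monoˡ-≤ cnt small₅ ⟩
      Ka1 * cnt                                               ≤⟨ bounded ⟩
      n ^ b₁                                                  ∎
      where
      cnt = if fat b₁ Ka1 (w ∷ u) then 0 else dg b₁ (w ∷ u)
      bounded : Ka1 * cnt ≤ n ^ b₁
      bounded with fat b₁ Ka1 (w ∷ u) in eq
      ... | true  = ≤-trans (≤-reflexive (*-zeroʳ Ka1)) z≤n
      ... | false = <⇒≤ (¬fat⇒ b₁ Ka1 (w ∷ u) eq)
      few : ∀ {v} → v ∈ W n b → p u v ∧ (w ∈ᵇ v) ≡ true → # (W n b) (λ v → p u v ∧ (w ∈ᵇ v)) ≤ b * cnt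
      few {v} v∈ h with ∧-true {p u v} h
      ... | puv , w∈v with bring (∈ᵇ⇒∈ w v w∈v)
      ...   | v′ , perm with fat b₁ Ka1 (w ∷ u)
               | ¬has⇒ (suc a) b₁ (fat b₁ Ka1) (not-true (proj₂ (∧-true {not (h4 (toSubset (u ++ v)))} (proj₂ (∧-true {G (u ++ v)} puv))))) (w ∷ u) v′
                   (cong suc (len a u∈)) (remaining perm (len b v∈)) (toSubset-↭ (↭-sym (↭-trans (Perm.++⁺ˡ u perm) (Perm.shift w u v′))))
      ...     | false | _ = ≤-trans
                (#-mono (W n b) (λ {v″} _ h′ → let puv′ , w∈ = ∧-true {p u v″} h′ in ∧-intro (proj₁ (∧-true {G (u ++ v″)} puv′)) w∈))
                (≤-trans (#-containing b (λ v → G (u ++ v)) (λ p → G-↭ (Perm.++⁺ˡ u p)) w)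
                  (*-monoʳ-≤ b (≤-reflexive (∑-cong (W n b₁) (λ v″ → cong 𝟙 (G-↭ (Perm.shift w u v″)))))))

  -- Splitting the fat set w₁ ∷ w₂ ∷ u₀ between both blobs makes both of them extend in many disjoint ways.
  heavy-U+1 : ∀ b₂ → b₁ ≡ suc b₂ → 2 * e * suc m * a ≤ Kb1 → 2 * e * suc m * (b * Ka1) ≤ Ka →
    e * # Es (λ F → h5 F ∧ (not (h3 F) ∧ not (h4 F))) ≤ X
  heavy-U+1 b₂ b₁≡ small₄ small₃ = light-class {p = p} small₄ (λ {u} {v} → hp {u} {v}) classify spread
    where
    open ≤-Reasoning
    p : List (Fin n) → List (Fin n) → Bool
    -- Two vertices of the fat (a+1)-set go to V, which takes b ≥ 2; the place thus left in U is
    -- filled by a vertex `y` outside the fat set.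
    p (y ∷ u₀) (w₁ ∷ w₂ ∷ v₀) = fat b₁ Ka1 (w₁ ∷ w₂ ∷ u₀) ∧ (G (y ∷ u₀ ++ w₁ ∷ w₂ ∷ v₀) ∧
      (not (h3 (toSubset (y ∷ u₀ ++ w₁ ∷ w₂ ∷ v₀))) ∧ not (h4 (toSubset (y ∷ u₀ ++ w₁ ∷ w₂ ∷ v₀)))))
    p _ _ = false
    hp : ∀ {u v} → p u v ≡ true → G (u ++ v) ≡ true × h4 (toSubset (u ++ v)) ≡ false
    hp {y ∷ u₀} {w₁ ∷ w₂ ∷ v₀} h =
      let g′ , h′ = ∧-true {G (y ∷ u₀ ++ w₁ ∷ w₂ ∷ v₀)} (proj₂ (∧-true {fat b₁ Ka1 (w₁ ∷ w₂ ∷ u₀)} h))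
      in g′ , not-true (proj₂ (∧-true {not (h3 (toSubset (y ∷ u₀ ++ w₁ ∷ w₂ ∷ v₀)))} h′))
    perm₁ : ∀ y u₀ w₁ w₂ (v₀ : List (Fin n)) → y ∷ u₀ ++ w₁ ∷ w₂ ∷ v₀ ↭ w₁ ∷ u₀ ++ w₂ ∷ y ∷ v₀
    perm₁ y u₀ w₁ w₂ v₀ = ↭-trans (Perm.prep y (Perm.shift w₁ u₀ (w₂ ∷ v₀))) (↭-trans (Perm.swap y w₁ ↭-refl)
      (Perm.prep w₁ (↭-trans (↭-sym (Perm.shift y u₀ (w₂ ∷ v₀))) (Perm.++⁺ˡ u₀ (Perm.swap y w₂ ↭-refl)))))
    perm₂ : ∀ y u₀ w₁ w₂ (v₀ : List (Fin n)) → y ∷ u₀ ++ w₁ ∷ w₂ ∷ v₀ ↭ w₁ ∷ w₂ ∷ u₀ ++ y ∷ v₀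
    perm₂ y u₀ w₁ w₂ v₀ = ↭-trans (perm₁ y u₀ w₁ w₂ v₀) (Perm.prep w₁ (Perm.shift w₂ u₀ (y ∷ v₀)))
    classify : ∀ {F} → F ∈ Es → h5 F ∧ (not (h3 F) ∧ not (h4 F)) ≡ true →
      ∃[ u ] ∃[ v ] length u ≡ a × length v ≡ b × toSubset (u ++ v) ≡ F × p u v ≡ true
    classify {F} F∈ h with ∧-true {h5 F} h
    ... | is5 , ¬34 with has⇒ (suc a) b₁ (fat b₁ Ka1) F is5
    ...   | w₁ ∷ w₂ ∷ u₀ , y ∷ v₀ , lu , lv , refl , fu =
            y ∷ u₀ , w₁ ∷ w₂ ∷ v₀ , suc-injective lu , cong suc lv , eq ,
            ∧-intro fu (∧-intro (∈⇒G (y ∷ u₀ ++ w₁ ∷ w₂ ∷ v₀) (subst (_∈ Es) (sym eq) F∈)) (subst (λ F → not (h3 F) ∧ not (h4 F) ≡ true) (sym eq) ¬34))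
            where eq = toSubset-↭ (perm₂ y u₀ w₁ w₂ v₀)
    ...   | w₁ ∷ w₂ ∷ u₀ , [] , lu , lv , _ = case trans lv b₁≡ of λ ()
    ...   | w₁ ∷ [] , _ , () , _
    ...   | [] , _ , () , _
    spread : ∀ u → u ∈ W n a → ∀ w → 2 * e * suc m * # (W n b) (λ v → p u v ∧ (w ∈ᵇ v)) ≤ n ^ b₁
    spread []       u∈ w = case len a u∈ of λ ()
    spread (y ∷ u₀) u∈ w = *-cancelˡ-≤ (b * Ka1) {{m*n≢0 b Ka1}} (begin
      b * Ka1 * (2 * e * suc m * N)    ≡⟨ reorder (b * Ka1) (2 * e * suc m) N ⟩
      2 * e * suc m * (b * Ka1) * N    ≤⟨ *-monoˡ-≤ N small₃ ⟩
      Ka * N                           ≤⟨ #-pair-spread Es b₁ b₂ b₁≡ Ka Ka1 u₀ (p (y ∷ u₀)) hq w ⟩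
      b * Ka1 * n ^ b₁                 ∎)
      where
      N = # (W n b) (λ v → p (y ∷ u₀) v ∧ (w ∈ᵇ v))
      reorder : ∀ x y z → x * (y * z) ≡ y * x * z
      reorder = solve-∀
      hq : ∀ w₁ w₂ v₀ → suc (length v₀) ≡ b₁ → p (y ∷ u₀) (w₁ ∷ w₂ ∷ v₀) ≡ true → fat b₁ Ka1 (w₁ ∷ w₂ ∷ u₀) ≡ true ×
             fat b Ka (w₁ ∷ u₀) ≡ false × fat b Ka (w₂ ∷ u₀) ≡ false
      hq w₁ w₂ v₀ lv h with ∧-true {fat b₁ Ka1 (w₁ ∷ w₂ ∷ u₀)} h
      ... | f₁ , h′ with ∧-true {not (h3 (toSubset (y ∷ u₀ ++ w₁ ∷ w₂ ∷ v₀)))} (proj₂ (∧-true {G (y ∷ u₀ ++ w₁ ∷ w₂ ∷ v₀)} h′))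
      ...   | ¬3 , _ = f₁ ,
              ¬has⇒ a b (fat b Ka) (not-true ¬3) (w₁ ∷ u₀) (w₂ ∷ y ∷ v₀) (len a u∈) (cong suc lv) (sym (toSubset-↭ (perm₁ y u₀ w₁ w₂ v₀))) ,
              ¬has⇒ a b (fat b Ka) (not-true ¬3) (w₂ ∷ u₀) (w₁ ∷ y ∷ v₀) (len a u∈) (cong suc lv)
                (sym (toSubset-↭ (↭-trans (Perm.prep y (Perm.++⁺ˡ u₀ (Perm.swap w₁ w₂ (↭-refl {x = v₀})))) (perm₁ y u₀ w₂ w₁ v₀))))


  -- Charging edges to (r-1)-sets

  -- The head of the chosen ordering spec F is a fat vertex whenever F has one; the tail is the (r ∸ 1)-set charged with F.
  spec : Subset n → List (Fin n)
  spec F with search 1 r₁ allL F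
  ... | yes some = let (u , v) , _ = find some in u ++ v
  ... | no  _    = elems F

  spec-ok : ∀ {F} → F ∈ Es → toSubset (spec F) ≡ F × length (spec F) ≡ r
  spec-ok {F} F∈ with search 1 r₁ allL F
  ... | no  _    = toSubset-elems F , trans (length-elems F) (All.lookup uniform F∈)
  ... | yes some with find some
  ...   | (u , v) , uv∈ , eq , _ = let u∈ , v∈ = ∈-cartesianProduct⁻ (W n 1) (W n r₁) uv∈ in
          eq , trans (length-++ u) (cong₂ _+_ (len 1 u∈) (len r₁ v∈))

  spec-L : ∀ {F x w} → hL F ≡ true → spec F ≡ x ∷ w → inL x ≡ true
  spec-L {F} h eq with search 1 r₁ allL F
  ... | yes some with find some
  ...   | (u , v) , uv∈ , _ , L with u | len 1 (proj₁ (∈-cartesianProduct⁻ (W n 1) (W n r₁) uv∈))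
  ...     | y ∷ [] | _ with refl ← List.∷-injectiveˡ eq = proj₁ (∧-true {inL y} L)

  spec-cons : ∀ {F} → F ∈ Es → ∃[ x ] ∃[ w ] spec F ≡ x ∷ w × length w ≡ r₁ × toSubset (x ∷ w) ≡ F
  spec-cons {F} F∈ with spec F | spec-ok F∈
  ... | x ∷ w | eq , lw = x , w , refl , suc-injective lw , eq

  tailₛ : Subset n → Subset n
  tailₛ F = toSubset (drop 1 (spec F))

  tailₛ-cons : ∀ {F x w} → spec F ≡ x ∷ w → tailₛ F ≡ toSubset w
  tailₛ-cons eq = cong (λ l → toSubset (drop 1 l)) eq

  tailₛ∈ : ∀ {F} → F ∈ Es → tailₛ F ∈ subsets n r₁
  tailₛ∈ {F} F∈ with spec-cons F∈
  ... | x , w , eq , lw , refl = subst (λ k → tailₛ (toSubset (x ∷ w)) ∈ subsets n k) size-tail (∈-subsets _)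
    where
    size-tail : ∣ tailₛ (toSubset (x ∷ w)) ∣ ≡ r₁
    size-tail = trans (cong ∣_∣ (tailₛ-cons eq)) (≤-antisym (≤-trans (∣toSubset∣≤ w) (≤-reflexive lw))
      (≤-pred (≤-trans (≤-reflexive (sym (All.lookup uniform F∈))) (∣⁅x⁆∪p∣≤ x (toSubset w)))))

  G-unique : ∀ {w} → length w ≡ r → G w ≡ true → Unique w
  G-unique {w} lw h = ∣toSubset∣≡⇒Unique w (trans (All.lookup uniform (G⇒∈ w h)) (sym lw))

  -- The common link of the vertices in `A`.
  allG : List (Fin n) → List (Fin n) → Bool
  allG []      y = true
  allG (w ∷ A) y = G (w ∷ y) ∧ allG A y

  allG⇒ : ∀ A {y} → allG A y ≡ true → ∀ {w} → w ∈ A → G (w ∷ y) ≡ true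
  allG⇒ (x ∷ A) {y} h (here refl) = proj₁ (∧-true {G (x ∷ y)} h)
  allG⇒ (x ∷ A) {y} h (there w∈)  = allG⇒ A (proj₂ (∧-true {G (x ∷ y)} h)) w∈

  allG⁺ : ∀ {A y} → All (λ w → G (w ∷ y) ≡ true) A → allG A y ≡ true
  allG⁺ []       = refl
  allG⁺ (h ∷ hs) = ∧-intro h (allG⁺ hs)

  -- The `j`-th vertex of `A` enlarges the `j`-th V-blob. It lies outside all blobs of the smaller
  -- copy: every blob is part of an edge of that copy, and this edge together with the vertex forms
  -- an edge of `Es`, which has no repetition.
  attach : ∀ A → Unique A → length A ≡ t →
    Embedding E (λ u v → length u ≡ a × length v ≡ b₁ × allG A (u ++ v) ≡ true) → Embedding E (IsEdge Es a b)
  attach A uA lA (emb , dj , rel) = emb′ , dj′ , λ i j eij → let lu , lv , h = rel i j eij in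
      lu , cong suc lv , G⇒∈ (emb (inj₁ i) ++ emb′ (inj₂ j)) (trans (G-↭ (Perm.shift (α j) (emb (inj₁ i)) (emb (inj₂ j)))) (allG⇒ A h (∈-lookup _)))
    where
    α : Fin t → Fin n
    α j = lookup A (Fin.cast (sym lA) j)
    emb′ : Placement {n} {s} {t}
    emb′ (inj₁ i) = emb (inj₁ i)
    emb′ (inj₂ j) = α j ∷ emb (inj₂ j)
    edge∌ : ∀ {w} i j → w ∈ A → E i j ≡ true → w ∉ emb (inj₁ i) ++ emb (inj₂ j)
    edge∌ {w} i j w∈ eij w∈e with rel i j eij
    ... | lu , lv , h with G-unique {w ∷ emb (inj₁ i) ++ emb (inj₂ j)}
            (cong suc (trans (length-++ (emb (inj₁ i))) (trans (cong₂ _+_ lu lv) (sym (+-suc a₁ b₁))))) (allG⇒ A h w∈)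
    ...   | w∉ ∷ _ = All.lookup w∉ w∈e refl
    ∌ : ∀ z {w} → w ∈ A → w ∉ emb z
    ∌ (inj₁ i) w∈ w∈z with neighbour (connected (inj₁ i) (inj₂ j₀)) (λ ())
    ... | inj₂ j , eij = edge∌ i j w∈ eij (∈-++⁺ˡ w∈z)
    ∌ (inj₂ j) w∈ w∈z with neighbour (connected (inj₂ j) (inj₁ i₀)) (λ ())
    ... | inj₁ i , eij = edge∌ i j w∈ eij (∈-++⁺ʳ (emb (inj₁ i)) w∈z)
    dj′ : ∀ {x y} → x ≢ y → Disjoint (emb′ x) (emb′ y)
    dj′ {inj₁ i} {inj₁ i′} x≢y p = dj x≢y p
    dj′ {inj₁ i} {inj₂ j} x≢y (v∈ , here refl) = ∌ (inj₁ i) (∈-lookup {xs = A} _) v∈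
    dj′ {inj₁ i} {inj₂ j} x≢y (v∈ , there v∈′) = dj x≢y (v∈ , v∈′)
    dj′ {inj₂ j} {inj₁ i} x≢y (here refl , v∈) = ∌ (inj₁ i) (∈-lookup {xs = A} _) v∈
    dj′ {inj₂ j} {inj₁ i} x≢y (there v∈′ , v∈) = dj x≢y (v∈′ , v∈)
    dj′ {inj₂ j} {inj₂ j′} x≢y (here refl , here eq) = x≢y (cong inj₂ (cast-injective (sym lA) (lookup-injective uA _ _ eq)))
    dj′ {inj₂ j} {inj₂ j′} x≢y (here refl , there v∈) = ∌ (inj₂ j′) (∈-lookup {xs = A} _) v∈
    dj′ {inj₂ j} {inj₂ j′} x≢y (there v∈ , here refl) = ∌ (inj₂ j) (∈-lookup {xs = A} _) v∈
    dj′ {inj₂ j} {inj₂ j′} x≢y (there v∈ , there v∈′) = dj x≢y (v∈ , v∈′)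

  -- A positive proportion of all (r-1)-words makes the degrees after cleaning as large as possible
  -- up to a constant, while a single vertex lies in only a fraction O(1/n) of all words. Hence
  -- T(a,b-1) embeds without any condition on fat sets.
  common-few : ∀ D → 2 * D * suc m * r ≤ n → ∀ A → Unique A → length A ≡ t → D * # (W n r₁) (allG A) ≤ X
  common-few D Dr≤n A uA lA = ≮⇒≥ λ big →
      free (attach A uA lA (abundant-embed E (abundant big) (m≤m+n a b) (≤-trans (n≤1+n b₁) (m≤n+m b a)) g P≤m all))
    where
    open ≤-Reasoning
    abundant : X < D * # (W n r₁) (allG A) → Abundant n a b₁ (λ u v → allG A (u ++ v)) m
    abundant big = record
      { D = 2 * D ; Θᵤ = n ^ b₁ ; Θᵥ = n ^ a
      ; keysᵤ = W n a ; keysᵥ = W n b₁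
      ; keyᵤ = λ u∈ _ _ → u∈
      ; keyᵥ = λ _ v∈ _ → v∈
      ; cost = begin-strict
          length (W n a) * n ^ b₁ + length (W n b₁) * n ^ a
            ≡⟨ cong₂ (λ x y → x * n ^ b₁ + y * n ^ a) (length-W n a) (length-W n b₁) ⟩
          n ^ a * n ^ b₁ + n ^ b₁ * n ^ a
            ≡⟨ cong₂ _+_ (sym X≡ᵦ) (trans (*-comm (n ^ b₁) (n ^ a)) (sym X≡ᵦ)) ⟩
          X + X
            ≡⟨ cong (X +_) (+-identityʳ X) ⟨
          2 * X
            <⟨ *-monoʳ-< 2 big ⟩
          2 * (D * # (W n r₁) (allG A))
            ≡⟨ *-assoc 2 D _ ⟨
          2 * D * # (W n r₁) (allG A)
            ≡⟨ cong (2 * D *_) (trans (cong (λ k → # (W n k) (allG A)) (+-suc a₁ b₁)) (∑-words-+ (allFin n) a b₁ _)) ⟩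
          2 * D * ∑ (W n a) (λ u → # (W n b₁) (λ v → allG A (u ++ v))) ∎
      ; spreadᵥ = λ u _ w → #-containing-any b₁ (λ v → allG A (u ++ v)) (2 * D * suc m)
                    (≤-trans (*-monoʳ-≤ (2 * D * suc m) (≤-trans (n≤1+n b₁) (m≤n+m b a))) Dr≤n) w
      ; spreadᵤ = λ v _ w → #-containing-any a (λ u → allG A (u ++ v)) (2 * D * suc m)
                    (≤-trans (*-monoʳ-≤ (2 * D * suc m) (m≤m+n a b)) Dr≤n) w
      }

  -- Cleaning at threshold q = t - 1 loses at most q edges per (r-1)-set, the main term. The
  -- (r-1)-set of each survivor lies in the common link of some list `A` of t fat vertices. With at
  -- most M^t lists and M heads, a bound X/(e·M·M^t) on each common link leaves at most X/e
  -- survivors.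
  few-L : ∀ q → t ≡ suc q → K1 * Z ≤ M → 2 * (e * (M * M ^ t)) * suc m * r ≤ n → e * # Es hL ≤ e * (q * (n C r₁)) + X
  few-L q t≡ K1Z≤M n-large = ≮⇒≥ contra
    where
    open ≤-Reasoning
    Ls : List (Fin n)
    Ls = select inL (allFin n)
    Ls≤M : length Ls ≤ M
    Ls≤M = ≤-trans (≤-reflexive (length-select inL (allFin n))) (≤-trans #L K1Z≤M)
    unique? : (A : List (Fin n)) → Dec (Unique A)
    unique? = AllPairs.allPairs? (λ x y → ¬? (x Fin.≟ y))
    As : List (List (Fin n))
    As = filter unique? (words Ls t)
    As≤ : length As ≤ M ^ t
    As≤ = ≤-trans (List.length-filter unique? (words Ls t)) (≤-trans (≤-reflexive (length-words Ls t)) (^-monoˡ-≤ t Ls≤M))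
    contra : ¬ (e * (q * (n C r₁)) + X < e * # Es hL)
    contra big with clean 1 Es (λ Y F → does (tailₛ F ≟ₛ Y)) (λ _ → q) (subsets n r₁) hL
    ... | p′ , p′⇒hL , bound , kept = <⇒≱ many (*-cancelˡ-≤ (M ^ t) {{m^n≢0 M t}} (begin
        M ^ t * (e * # Es p′)                                            ≤⟨ *-monoʳ-≤ (M ^ t) (*-monoʳ-≤ e covered) ⟩
        M ^ t * (e * ∑ As (λ A → M * # (W n r₁) (allG A)))               ≡⟨ *-assoc (M ^ t) e _ ⟨
        M ^ t * e * ∑ As (λ A → M * # (W n r₁) (allG A))                 ≡⟨ ∑-*ˡ (M ^ t * e) As _ ⟩
        ∑ As (λ A → M ^ t * e * (M * # (W n r₁) (allG A)))               ≤⟨ ∑-bound As (λ {A} A∈ → each A A∈) ⟩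
        length As * X                                                    ≤⟨ *-monoˡ-≤ X As≤ ⟩
        M ^ t * X                                                        ∎))
      where
      many : X < e * # Es p′
      many = +-cancelˡ-< (e * (q * (n C r₁))) X (e * # Es p′) (begin-strict
        e * (q * (n C r₁)) + X                                           <⟨ big ⟩
        e * # Es hL                                                      ≡⟨ cong (e *_) (+-identityʳ _) ⟨
        e * (1 * # Es hL)                                                ≤⟨ *-monoʳ-≤ e bound ⟩
        e * (1 * # Es p′ + ∑ (subsets n r₁) (λ _ → q))                   ≡⟨ cong (λ x → e * (1 * # Es p′ + x)) (trans (∑-const (subsets n r₁) q) (cong (_* q) (length-subsets n r₁))) ⟩
        e * (1 * # Es p′ + (n C r₁) * q)                                 ≡⟨ reorder e (# Es p′) (n C r₁) q ⟩
        e * (q * (n C r₁)) + e * # Es p′                                 ∎)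
        where
        reorder : ∀ e p c q → e * (1 * p + c * q) ≡ e * (q * c) + e * p
        reorder = solve-∀
      each : ∀ A → A ∈ As → M ^ t * e * (M * # (W n r₁) (allG A)) ≤ X
      each A A∈ with ∈-filter⁻ unique? {xs = words Ls t} A∈
      ... | A∈words , uA = ≤-trans (≤-reflexive (reorder (M ^ t) e M _))
              (common-few (e * (M * M ^ t)) n-large A uA (∈-words⇒length t A∈words))
        where
        reorder : ∀ t e m x → t * e * (m * x) ≡ e * (m * t) * x
        reorder = solve-∀
      Triple : Set
      Triple = List (Fin n) × Fin n × List (Fin n)
      triples : List Triple
      triples = cartesianProduct As (cartesianProduct Ls (W n r₁))
      locate : ∀ {F} → F ∈ Es → p′ F ≡ true → ∃[ τ ] τ ∈ triples × allG (proj₁ τ) (proj₂ (proj₂ τ)) ≡ true × toSubset (proj₁ (proj₂ τ) ∷ proj₂ (proj₂ τ)) ≡ F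
      locate {F} F∈ p′F with spec-cons F∈
      ... | x , y , eq , ly , F≡ = (A₀ , x , y) ,
            ∈-cartesianProduct⁺ (∈-filter⁺ unique? A∈words A-unique)
              (∈-cartesianProduct⁺ (∈-select⁺ inL (∈-allFin x) (spec-L (p′⇒hL F p′F) eq)) (∈-W y ly)) ,
            allG⁺ (All.map (λ h → proj₂ (∧-true {inL _} (proj₂ (∈-select⁻ good {allFin n} h)))) A-good) , F≡
        where
        good : Fin n → Bool
        good z = inL z ∧ G (z ∷ y)
        A₀ : List (Fin n)
        A₀ = take t (select good (allFin n))
        A-unique : Unique A₀
        A-unique = Unique.take⁺ t (Unique.filter⁺ _ (Unique.allFin⁺ n))
        A-good : All (_∈ select good (allFin n)) A₀
        A-good = All.take⁺ t (All.tabulate id)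
        -- Edges charged to the same (r-1)-set have different heads.
        rich : t ≤ length (select good (allFin n))
        rich = begin
          t                                                                       ≡⟨ t≡ ⟩
          suc q                                                                   ≤⟨ kept (tailₛ∈ F∈) {F} p′F (dec-true (tailₛ F ≟ₛ tailₛ F) refl) ⟩
          1 * # Es (λ F′ → p′ F′ ∧ does (tailₛ F′ ≟ₛ tailₛ F))                    ≡⟨ +-identityʳ _ ⟩
          # Es (λ F′ → p′ F′ ∧ does (tailₛ F′ ≟ₛ tailₛ F))                        ≤⟨ #-injection _≟ₛ_ (allFin n) (λ z → toSubset (z ∷ y)) _ good distinct head ⟩
          # (allFin n) good                                                       ≡⟨ length-select good (allFin n) ⟨
          length (select good (allFin n))                                         ∎
          where
          head : ∀ {F′} → F′ ∈ Es → p′ F′ ∧ does (tailₛ F′ ≟ₛ tailₛ F) ≡ true → ∃[ z ] z ∈ allFin n × good z ≡ true × toSubset (z ∷ y) ≡ F′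
          head {F′} F′∈ h with ∧-true {p′ F′} h | spec-cons F′∈
          ... | p′F′ , same | z , y′ , eq′ , _ , F′≡ =
                z , ∈-allFin z , ∧-intro (spec-L (p′⇒hL F′ p′F′) eq′) (∈⇒G (z ∷ y) (subst (_∈ Es) (sym z∷y) F′∈)) , z∷y
            where
            z∷y : toSubset (z ∷ y) ≡ F′
            z∷y = trans (cong (⁅ z ⁆ ∪_) (trans (sym (tailₛ-cons eq)) (trans (sym (does⇒ (tailₛ F′ ≟ₛ tailₛ F) same)) (tailₛ-cons eq′)))) F′≡
        lA : length A₀ ≡ t
        lA = trans (length-take t (select good (allFin n))) (m≤n⇒m⊓n≡m rich)
        A∈words : A₀ ∈ words Ls t
        A∈words = subst (λ k → A₀ ∈ words Ls k) lA (∈-words (All.map (λ h → let z∈ , gz = ∈-select⁻ good {allFin n} h in ∈-select⁺ inL z∈ (proj₁ (∧-true gz))) A-good))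
      covered : # Es p′ ≤ ∑ As (λ A → M * # (W n r₁) (allG A))
      covered = begin
        # Es p′
          ≤⟨ #-injection _≟ₛ_ triples (λ (A , x , y) → toSubset (x ∷ y)) p′ (λ (A , x , y) → allG A y) distinct locate ⟩
        # triples (λ (A , x , y) → allG A y)
          ≡⟨ trans (∑-cartesianProductWith _,_ As _ _) (∑-cong As (λ A → trans (∑-cartesianProductWith _,_ Ls (W n r₁) _) (∑-const Ls _))) ⟩
        ∑ As (λ A → length Ls * # (W n r₁) (allG A))
          ≤⟨ ∑-mono As (λ {A} _ → *-monoˡ-≤ (# (W n r₁) (allG A)) Ls≤M) ⟩
        ∑ As (λ A → M * # (W n r₁) (allG A)) ∎

  headIs : Fin n → List (Fin n) → Bool
  headIs x []      = false
  headIs x (y ∷ _) = does (y Fin.≟ x)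

  -- Cleaning acts on (r-1)-sets and on heads at once, so afterwards each tail has at least t heads.
  -- The tails of a head x are spread out: if x is fat, because they form a positive proportion of
  -- all words of length r - 1; otherwise because their edges have no fat vertex and therefore no
  -- fat pair {x,w}. So each single head is a core, as `core-embed` requires.
  single-V : b₁ ≡ 0 → ∀ q → t ≡ suc q → K1 * Z ≤ M → 2 * e * suc m * a ≤ Kb1 → 2 * (e * M) * suc m * a ≤ n →
    coreBound t a (length P) 0 t ≤ m → e * # Es (λ F → hL F ∨ not (h4 F)) ≤ e * (q * (n C r₁)) + X
  single-V b₁≡0 q t≡ K1Z≤M small₄ n-large core≤m = ≮⇒≥ contra
    where
    open ≤-Reasoning
    r₁≡a : r₁ ≡ a
    r₁≡a = trans (cong (λ k → a₁ + suc k) b₁≡0) (trans (+-suc a₁ 0) (cong suc (+-identityʳ a₁)))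
    D : ℕ
    D = 2 * (e * M)
    c : Subset n → Bool
    c F = hL F ∨ not (h4 F)
    keys : List (Subset n ⊎ Fin n)
    keys = map inj₁ (subsets n r₁) ++ map inj₂ (allFin n)
    hasKey : Subset n ⊎ Fin n → Subset n → Bool
    hasKey (inj₁ Y) F = does (tailₛ F ≟ₛ Y)
    hasKey (inj₂ x) F = headIs x (spec F)
    θ : Fin n → ℕ
    -- At most M fat heads at X and n other heads at M·n^a₁ cost at most 2·M·X together; dividing by
    -- D = 2·e·M leaves X/e. Accordingly the threshold `D * q` of an (r-1)-set stands for q edges.
    θ x = if inL x then X else M * n ^ a₁
    Θ : Subset n ⊎ Fin n → ℕ
    Θ (inj₁ _) = D * q
    Θ (inj₂ x) = θ x
    ∑θ : ∑ (allFin n) θ ≤ 2 * (M * X)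
    ∑θ = begin
      ∑ (allFin n) θ                                                    ≤⟨ ∑-mono (allFin n) (λ {x} _ → at x) ⟩
      ∑ (allFin n) (λ x → X * 𝟙 (inL x) + M * n ^ a₁)                   ≡⟨ trans (∑-+ (allFin n) _ _) (cong₂ _+_ (sym (∑-*ˡ X (allFin n) _)) (∑-const (allFin n) _)) ⟩
      X * # (allFin n) inL + length (allFin n) * (M * n ^ a₁)           ≤⟨ +-mono-≤ (*-monoʳ-≤ X (≤-trans #L K1Z≤M)) (≤-reflexive (cong (_* (M * n ^ a₁)) (length-tabulate {n = n} id))) ⟩
      X * M + n * (M * n ^ a₁)                                          ≡⟨ reorder X M n (n ^ a₁) ⟩
      M * X + M * (n * n ^ a₁)                                          ≡⟨ cong (λ k → M * X + M * k) (cong (n ^_) r₁≡a) ⟨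
      M * X + M * X                                                     ≡⟨ cong (M * X +_) (+-identityʳ _) ⟨
      2 * (M * X)                                                       ∎
      where
      reorder : ∀ x m n k → x * m + n * (m * k) ≡ m * x + m * (n * k)
      reorder = solve-∀
      at : ∀ x → θ x ≤ X * 𝟙 (inL x) + M * n ^ a₁
      at x with inL x
      ... | true  = ≤-trans (≤-reflexive (sym (*-identityʳ X))) (m≤m+n _ _)
      ... | false = m≤n+m _ _
    ∑Θ : ∑ keys Θ ≤ (n C r₁) * (D * q) + 2 * (M * X)
    ∑Θ = ≤-trans (≤-reflexive (trans (∑-++ (map inj₁ (subsets n r₁)) _ Θ) (cong₂ _+_
          (trans (∑-map inj₁ (subsets n r₁) Θ) (trans (∑-const (subsets n r₁) (D * q)) (cong (_* (D * q)) (length-subsets n r₁))))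
          (∑-map inj₂ (allFin n) Θ))))
      (+-monoʳ-≤ ((n C r₁) * (D * q)) ∑θ)
    contra : ¬ (e * (q * (n C r₁)) + X < e * # Es c)
    contra big with clean D Es hasKey Θ keys c
    ... | p′ , p′⇒c , bound , kept = case #-pos Es p′ nonempty of λ (F , F∈ , p′F) →
          case spec-cons F∈ of λ (x , w , eq , lw , _) →
          CoreEmbedding.core-embed E R a (length P) R-∉ g ≤-refl all kernel {w} {x} (trans lw r₁≡a , proj₁ (R-intro F∈ p′F w eq refl))
            λ (emb , dj , rel) → free (emb , dj , λ i j eij → let x , eq , (lu , h) = rel i j eij in
              lu , trans (cong length eq) (cong suc (sym b₁≡0)) ,
              subst (λ v → toSubset (emb (inj₁ i) ++ v) ∈ Es) (sym eq)
                (subst (_∈ Es) (toSubset-↭ (Perm.∷↭∷ʳ x (emb (inj₁ i)))) (proj₁ (R-elim (emb (inj₁ i)) x h))))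
      where
      nonempty : 0 < # Es p′
      nonempty = ≰⇒> λ ≤0 → <⇒≱ (begin-strict
        (n C r₁) * (D * q) + 2 * (M * X)              ≡⟨ reorder (n C r₁) e M q X ⟩
        2 * M * (e * (q * (n C r₁)) + X)              <⟨ *-monoʳ-< (2 * M) {{m*n≢0 2 M}} big ⟩
        2 * M * (e * # Es c)                          ≡⟨ reassoc M e (# Es c) ⟩
        D * # Es c                                    ∎)
        (begin
        D * # Es c                                    ≤⟨ bound ⟩
        D * # Es p′ + ∑ keys Θ                        ≡⟨ cong (λ k → D * k + ∑ keys Θ) (n≤0⇒n≡0 ≤0) ⟩
        D * 0 + ∑ keys Θ                              ≡⟨ cong (_+ ∑ keys Θ) (*-zeroʳ D) ⟩
        ∑ keys Θ                                      ≤⟨ ∑Θ ⟩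
        (n C r₁) * (D * q) + 2 * (M * X)              ∎)
        where
        reorder : ∀ c e m q x → c * (2 * (e * m) * q) + 2 * (m * x) ≡ 2 * m * (e * (q * c) + x)
        reorder = solve-∀
        reassoc : ∀ m e c → 2 * m * (e * c) ≡ 2 * (e * m) * c
        reassoc = solve-∀
      Rᵇ : List (Fin n) → Fin n → Bool
      Rᵇ u x = (G (x ∷ u) ∧ p′ (toSubset (x ∷ u))) ∧ (headIs x (spec (toSubset (x ∷ u))) ∧ does (tailₛ (toSubset (x ∷ u)) ≟ₛ toSubset u))
      record R (u : List (Fin n)) (x : Fin n) : Set where
        eta-equality
        constructor _,_
        field
          length-u : length u ≡ a
          relation : Rᵇ u x ≡ true
      R-intro : ∀ {F} → F ∈ Es → p′ F ≡ true → ∀ {x w} u → spec F ≡ x ∷ w → toSubset w ≡ toSubset u → Rᵇ u x ≡ true × toSubset (x ∷ u) ≡ F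
      R-intro {F} F∈ p′F {x} {w} u eq w≡u = is , F≡
        where
        F≡ : toSubset (x ∷ u) ≡ F
        F≡ = trans (cong (⁅ x ⁆ ∪_) (sym w≡u)) (trans (cong toSubset (sym eq)) (proj₁ (spec-ok F∈)))
        is : Rᵇ u x ≡ true
        is = subst (λ F′ → (G (x ∷ u) ∧ p′ F′) ∧ (headIs x (spec F′) ∧ does (tailₛ F′ ≟ₛ toSubset u)) ≡ true) (sym F≡)
          (∧-intro (∧-intro (∈⇒G (x ∷ u) (subst (_∈ Es) (sym F≡) F∈)) p′F)
            (∧-intro (trans (cong (headIs x) eq) (dec-true (x Fin.≟ x) refl)) (dec-true (tailₛ F ≟ₛ toSubset u) (trans (tailₛ-cons eq) w≡u))))
      R-elim : ∀ u x → Rᵇ u x ≡ true → toSubset (x ∷ u) ∈ Es × p′ (toSubset (x ∷ u)) ≡ true ×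
        headIs x (spec (toSubset (x ∷ u))) ≡ true × tailₛ (toSubset (x ∷ u)) ≡ toSubset u
      R-elim u x h with ∧-true {G (x ∷ u) ∧ p′ (toSubset (x ∷ u))} h
      ... | h₁ , h₂ with ∧-true {G (x ∷ u)} h₁ | ∧-true {headIs x (spec (toSubset (x ∷ u)))} h₂
      ...   | g′ , p′F | hd , tl = G⇒∈ (x ∷ u) g′ , p′F , hd , does⇒ (tailₛ (toSubset (x ∷ u)) ≟ₛ toSubset u) tl
      R-∉ : ∀ {u x} → R u x → x ∉ u
      R-∉ {u} {x} (lu , h) x∈ with G-unique {x ∷ u} (cong suc (trans lu (sym r₁≡a))) (∈⇒G (x ∷ u) (proj₁ (R-elim u x h)))
      ... | x∉ ∷ _ = All.lookup x∉ x∈ refl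
      rich : ∀ {u x} → R u x → length u ≤ a × (∃[ S ] Unique S × length S ≡ t × All (R u) S)
      rich {u} {x} (lu , h) = ≤-reflexive lu , take t (select (Rᵇ u) (allFin n)) ,
          Unique.take⁺ t (Unique.filter⁺ _ (Unique.allFin⁺ n)) ,
          trans (length-take t (select (Rᵇ u) (allFin n))) (m≤n⇒m⊓n≡m enough) ,
          All.take⁺ t (All.tabulate (λ z∈ → lu , proj₂ (∈-select⁻ (Rᵇ u) {allFin n} z∈)))
        where
        F₀ = toSubset (x ∷ u)
        partner : ∀ {F} → F ∈ Es → p′ F ∧ does (tailₛ F ≟ₛ tailₛ F₀) ≡ true → ∃[ z ] z ∈ allFin n × Rᵇ u z ≡ true × toSubset (z ∷ u) ≡ F
        partner {F} F∈ hF with ∧-true {p′ F} hF | spec-cons F∈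
        ... | p′F , same | z , w , eq , _ , _ = z , ∈-allFin z ,
              R-intro F∈ p′F u eq (trans (sym (tailₛ-cons eq)) (trans (does⇒ (tailₛ F ≟ₛ tailₛ F₀) same) (proj₂ (proj₂ (proj₂ (R-elim u x h))))))
        enough : t ≤ length (select (Rᵇ u) (allFin n))
        enough = begin
          t                                                           ≡⟨ t≡ ⟩
          suc q                                                       ≤⟨ *-cancelˡ-< D q _ (kept {inj₁ (tailₛ F₀)} (∈-++⁺ˡ (∈-map⁺ inj₁ (tailₛ∈ (proj₁ (R-elim u x h))))) {F₀}
                                                                            (proj₁ (proj₂ (R-elim u x h))) (dec-true (tailₛ F₀ ≟ₛ tailₛ F₀) refl)) ⟩
          # Es (λ F → p′ F ∧ does (tailₛ F ≟ₛ tailₛ F₀))              ≤⟨ #-injection _≟ₛ_ (allFin n) (λ z → toSubset (z ∷ u)) _ (Rᵇ u) distinct partner ⟩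
          # (allFin n) (Rᵇ u)                                         ≡⟨ length-select (Rᵇ u) (allFin n) ⟨
          length (select (Rᵇ u) (allFin n))                           ∎
      spread : ∀ x w → D * suc m * # (W n a) (λ u → Rᵇ u x ∧ (w ∈ᵇ u)) ≤ θ x
      spread x w with inL x in eq
      ... | true  = ≤-trans (#-containing-any a (λ u → Rᵇ u x) (D * suc m) n-large w) (≤-reflexive (cong (n ^_) (sym r₁≡a)))
      ... | false = begin
        D * suc m * # (W n a) (λ u → Rᵇ u x ∧ (w ∈ᵇ u))       ≤⟨ *-monoʳ-≤ (D * suc m) (#-witness (W n a) _ few) ⟩
        D * suc m * (a * cnt)                                 ≡⟨ reorder e M (suc m) a cnt ⟩
        M * (2 * e * suc m * a * cnt)                         ≤⟨ *-monoʳ-≤ M (*-monoˡ-≤ cnt small₄) ⟩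
        M * (Kb1 * cnt)                                       ≤⟨ *-monoʳ-≤ M bounded ⟩
        M * n ^ a₁                                            ∎
        where
        reorder : ∀ e k m a c → 2 * (e * k) * m * (a * c) ≡ k * (2 * e * m * a * c)
        reorder = solve-∀
        cnt = if fat a₁ Kb1 (x ∷ w ∷ []) then 0 else dg a₁ (x ∷ w ∷ [])
        bounded : Kb1 * cnt ≤ n ^ a₁
        bounded with fat a₁ Kb1 (x ∷ w ∷ []) in eq
        ... | true  = ≤-trans (≤-reflexive (*-zeroʳ Kb1)) z≤n
        ... | false = <⇒≤ (¬fat⇒ a₁ Kb1 (x ∷ w ∷ []) eq)
        ¬h4 : ∀ u → Rᵇ u x ≡ true → h4 (toSubset (x ∷ u)) ≡ false
        ¬h4 u h with R-elim u x h
        ... | F∈ , p′F , hd , _ with hL (toSubset (x ∷ u)) in isL | p′⇒c (toSubset (x ∷ u)) p′F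
        ...   | false | ¬4 = not-true ¬4
        -- An edge with a fat vertex has a fat head, but `x` is not fat.
        ...   | true  | _ with spec-cons F∈
        ...     | y , v , eq′ , _ with does⇒ (y Fin.≟ x) (trans (sym (cong (headIs x) eq′)) hd)
        ...       | refl = ⊥-elim (true≢false (spec-L isL eq′) eq)
        few : ∀ {u} → u ∈ W n a → Rᵇ u x ∧ (w ∈ᵇ u) ≡ true → # (W n a) (λ u → Rᵇ u x ∧ (w ∈ᵇ u)) ≤ a * cnt
        few {u} u∈ h with ∧-true {Rᵇ u x} h
        ... | ru , w∈u with bring (∈ᵇ⇒∈ w u w∈u)
        ...   | u′ , perm with fat a₁ Kb1 (x ∷ w ∷ [])
                 | ¬has⇒ (suc b) a₁ (fat a₁ Kb1) (¬h4 u ru) (x ∷ w ∷ []) u′ (cong (λ k → suc (suc k)) (sym b₁≡0)) (remaining perm (len a u∈)) (toSubset-↭ (Perm.prep x (↭-sym perm)))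
        ...     | false | _ = ≤-trans
                  (#-mono (W n a) (λ {u″} _ h′ → let ru′ , w∈ = ∧-true {Rᵇ u″ x} h′ in ∧-intro (∈⇒G (x ∷ u″) (proj₁ (R-elim u″ x ru′))) w∈))
                  (#-containing a (λ u → G (x ∷ u)) (λ p → G-↭ (Perm.prep x p)) w)
      kernel : ∀ {u x} → R u x → CoreEmbedding.Core E R a (length P) R-∉ (x ∷ []) (coreBound t a (length P) 0 t)
      kernel {u} {x} (lu , h) w lw k with R-elim u x h
      ... | F∈ , p′F , hd , _ with #-avoid (W n a) (λ u′ → Rᵇ u′ x) D m (θ x)
              (≤-trans (kept {inj₂ x} (∈-++⁺ʳ (map inj₁ (subsets n r₁)) (∈-map⁺ inj₂ (∈-allFin x))) {toSubset (x ∷ u)} p′F hd)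
                (*-monoʳ-≤ D (#-injection _≟ₛ_ (W n a) (λ u′ → toSubset (x ∷ u′)) _ (λ u′ → Rᵇ u′ x) distinct tails)))
              (spread x) w (≤-trans lw core≤m)
        where
        tails : ∀ {F} → F ∈ Es → p′ F ∧ headIs x (spec F) ≡ true → ∃[ u′ ] u′ ∈ W n a × Rᵇ u′ x ≡ true × toSubset (x ∷ u′) ≡ F
        tails {F} F∈ hF with ∧-true {p′ F} hF | spec-cons F∈
        ... | p′F , hd | y , v , eq , lv , _ with does⇒ (y Fin.≟ x) (trans (sym (cong (headIs x) eq)) hd)
        ...   | refl = v , ∈-W v (trans lv r₁≡a) , R-intro F∈ p′F v eq refl
      ...   | u′ , u′∈ , ru′ , u′#w = k u′ u′#w (rich (len a u′∈ , ru′)) ((len a u′∈ , ru′) ∷ [])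

  -- Each `cover` is a truth table placing every edge in some class. Only the class treated by
  -- `single-V` or `few-L` contributes to the main term.
  edge-bound : ∀ q y D → t ≡ suc q → y + b ≡ a₁ → D ≡ e * (Ka * Z + 1) → D * suc m * a * Ka ≤ K1 → e * (Kb1 * Z) ≤ Ka →
    2 * e * suc m * (b * Ka1) ≤ Ka → 2 * e * suc m * a ≤ Kb1 → 2 * e * suc m * b ≤ Ka1 → K1 * Z ≤ M →
    coreBound t a (length P) 0 t ≤ m → D * suc m * b ≤ n → 2 * (e * (M * M ^ t)) * suc m * r ≤ n → 2 * (e * M) * suc m * a ≤ n →
    e * length Es ≤ e * (q * (n C r₁)) + 5 * X
  edge-bound q y D t≡ y+b≡a₁ D≡ DK1 Kb1Ka Ka1Ka aKb1 bKa1 K1Z≤M core≤m n₁ n₂ n₃ = classes b₁ refl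
    where
    open ≤-Reasoning
    heavy : e * # Es (λ F → not (hL F) ∧ h3 F) ≤ X
    heavy = heavy-U D D≡ n₁ DK1
    light : e * # Es (λ F → not (h3 F) ∧ h4 F) ≤ X
    light = light-U y y+b≡a₁ Kb1Ka
    count-all : e * length Es ≡ e * # Es (λ _ → true)
    count-all = cong (e *_) (sym (trans (∑-const Es 1) (*-identityʳ (length Es))))
    classes : ∀ b′ → b₁ ≡ b′ → e * length Es ≤ e * (q * (n C r₁)) + 5 * X
    classes zero b₁≡0 = begin
      e * length Es
        ≡⟨ count-all ⟩
      e * # Es (λ _ → true)
        ≤⟨ *-monoʳ-≤ e (∑-mono Es (λ {F} _ → cover (hL F) (h3 F) (h4 F))) ⟩
      e * ∑ Es (λ F → 𝟙 (hL F ∨ not (h4 F)) + (𝟙 (not (hL F) ∧ h3 F) + 𝟙 (not (h3 F) ∧ h4 F)))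
        ≡⟨ cong (e *_) (trans (∑-+ Es _ _) (cong (# Es (λ F → hL F ∨ not (h4 F)) +_) (∑-+ Es _ _))) ⟩
      e * (# Es (λ F → hL F ∨ not (h4 F)) + (# Es (λ F → not (hL F) ∧ h3 F) + # Es (λ F → not (h3 F) ∧ h4 F)))
        ≡⟨ trans (*-distribˡ-+ e _ _) (cong (e * # Es (λ F → hL F ∨ not (h4 F)) +_) (*-distribˡ-+ e _ _)) ⟩
      e * # Es (λ F → hL F ∨ not (h4 F)) + (e * # Es (λ F → not (hL F) ∧ h3 F) + e * # Es (λ F → not (h3 F) ∧ h4 F))
        ≤⟨ +-mono-≤ (single-V b₁≡0 q t≡ K1Z≤M aKb1 n₃ core≤m)
             (+-mono-≤ heavy light) ⟩
      e * (q * (n C r₁)) + X + (X + X)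
        -- Padding from three error terms to the five of the case b ≥ 2.
        ≤⟨ m≤m+n _ (X + X) ⟩
      e * (q * (n C r₁)) + X + (X + X) + (X + X)
        ≡⟨ collect (e * (q * (n C r₁))) X ⟩
      e * (q * (n C r₁)) + 5 * X ∎
      where
      collect : ∀ c x → c + x + (x + x) + (x + x) ≡ c + 5 * x
      collect = solve-∀
      cover : ∀ l h₃ h₄ → 1 ≤ 𝟙 (l ∨ not h₄) + (𝟙 (not l ∧ h₃) + 𝟙 (not h₃ ∧ h₄))
      cover true  _     _     = s≤s z≤n
      cover false _     false = s≤s z≤n
      cover false true  true  = s≤s z≤n
      cover false false true  = s≤s z≤n
    classes (suc b₂) b₁≡ = begin
      e * length Es
        ≡⟨ count-all ⟩
      e * # Es (λ _ → true)
        ≤⟨ *-monoʳ-≤ e (∑-mono Es (λ {F} _ → cover (hL F) (h3 F) (h4 F) (h5 F))) ⟩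
      e * ∑ Es (λ F → 𝟙 (hL F) + (𝟙 (not (hL F) ∧ h3 F) + (𝟙 (not (h3 F) ∧ h4 F) + (𝟙 (h5 F ∧ (not (h3 F) ∧ not (h4 F))) + 𝟙 (not (h4 F) ∧ not (h5 F))))))
        ≡⟨ cong (e *_) (trans (∑-+ Es _ _) (cong (# Es hL +_) (trans (∑-+ Es _ _) (cong (# Es (λ F → not (hL F) ∧ h3 F) +_)
             (trans (∑-+ Es _ _) (cong (# Es (λ F → not (h3 F) ∧ h4 F) +_) (∑-+ Es _ _))))))) ⟩
      e * (# Es hL + (# Es (λ F → not (hL F) ∧ h3 F) + (# Es (λ F → not (h3 F) ∧ h4 F) +
        (# Es (λ F → h5 F ∧ (not (h3 F) ∧ not (h4 F))) + # Es (λ F → not (h4 F) ∧ not (h5 F))))))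
        ≡⟨ distribute e (# Es hL) (# Es (λ F → not (hL F) ∧ h3 F)) (# Es (λ F → not (h3 F) ∧ h4 F))
             (# Es (λ F → h5 F ∧ (not (h3 F) ∧ not (h4 F)))) (# Es (λ F → not (h4 F) ∧ not (h5 F))) ⟩
      e * # Es hL + (e * # Es (λ F → not (hL F) ∧ h3 F) + (e * # Es (λ F → not (h3 F) ∧ h4 F) +
        (e * # Es (λ F → h5 F ∧ (not (h3 F) ∧ not (h4 F))) + e * # Es (λ F → not (h4 F) ∧ not (h5 F)))))
        ≤⟨ +-mono-≤ (few-L q t≡ K1Z≤M n₂)
             (+-mono-≤ heavy (+-mono-≤ light (+-mono-≤ (heavy-U+1 b₂ b₁≡ aKb1 Ka1Ka) (no-heavy aKb1 bKa1)))) ⟩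
      e * (q * (n C r₁)) + X + (X + (X + (X + X)))
        ≡⟨ collect (e * (q * (n C r₁))) X ⟩
      e * (q * (n C r₁)) + 5 * X ∎
      where
      collect : ∀ c x → c + x + (x + (x + (x + x))) ≡ c + 5 * x
      collect = solve-∀
      distribute : ∀ e a b c d f → e * (a + (b + (c + (d + f)))) ≡ e * a + (e * b + (e * c + (e * d + e * f)))
      distribute = solve-∀
      cover : ∀ l h₃ h₄ h₅ → 1 ≤ 𝟙 l + (𝟙 (not l ∧ h₃) + (𝟙 (not h₃ ∧ h₄) + (𝟙 (h₅ ∧ (not h₃ ∧ not h₄)) + 𝟙 (not h₄ ∧ not h₅))))
      cover true  _     _     _     = s≤s z≤n
      cover false true  _     _     = s≤s z≤n
      cover false false true  _     = s≤s z≤n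
      cover false false false true  = s≤s z≤n
      cover false false false false = s≤s z≤n

-- The constants are chosen in the order Ka1, Kb1, Ka, D, K1, M, N, each large compared with the preceding ones.
record Constants (k q r a b p : ℕ) : Set where
  field
    e m Z Ka1 Kb1 Ka D K1 M N : ℕ
    -- Five error terms of X/e add up to X/(k+1).
    e≡      : e ≡ 5 * suc k
    p≤m     : p * r ≤ m
    core≤m  : coreBound (suc q) a p 0 (suc q) ≤ m
    -- At most (2 + q)·n^(r-1) edges are kept, each with at most r^r orderings.
    Z-large : (2 + q) * r ^ r ≤ Z
    aKb1    : 2 * e * suc m * a ≤ Kb1
    bKa1    : 2 * e * suc m * b ≤ Ka1
    Kb1Ka   : e * (Kb1 * Z) ≤ Ka
    Ka1Ka   : 2 * e * suc m * (b * Ka1) ≤ Ka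
    D≡      : D ≡ e * (Ka * Z + 1)
    DK1     : D * suc m * a * Ka ≤ K1
    K1Z≤M   : K1 * Z ≤ M
    N₀      : 1 ≤ N
    N₁      : D * suc m * b ≤ N
    N₂      : 2 * (e * (M * M ^ suc q)) * suc m * r ≤ N
    N₃      : 2 * (e * M) * suc m * a ≤ N
    Z≢0     : NonZero Z
    Ka≢0    : NonZero Ka
    Ka1≢0   : NonZero Ka1
    Kb1≢0   : NonZero Kb1
    M≢0     : NonZero M

abstract
  constants : ∀ k q r a b p → Constants k q r a b p
  constants k q r a b p = record
    { e = e ; m = m ; Z = Z ; Ka1 = Ka1 ; Kb1 = Kb1 ; Ka = Ka ; D = D ; K1 = K1 ; M = M ; N = suc (x + (y + z))
    ; e≡ = refl
    ; p≤m = m≤m+n (p * r) core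
    ; core≤m = m≤n+m core (p * r)
    ; Z-large = n≤1+n _
    ; aKb1 = n≤1+n _
    ; bKa1 = n≤1+n _
    ; Kb1Ka = m≤n⇒m≤1+n (m≤m+n (e * (Kb1 * Z)) (2 * e * suc m * (b * Ka1)))
    ; Ka1Ka = m≤n⇒m≤1+n (m≤n+m (2 * e * suc m * (b * Ka1)) (e * (Kb1 * Z)))
    ; D≡ = refl
    ; DK1 = ≤-refl
    ; K1Z≤M = n≤1+n _
    ; N₀ = s≤s z≤n
    ; N₁ = m≤n⇒m≤1+n (m≤m+n x (y + z))
    ; N₂ = m≤n⇒m≤1+n (≤-trans (m≤m+n y z) (m≤n+m (y + z) x))
    ; N₃ = m≤n⇒m≤1+n (≤-trans (m≤n+m z y) (m≤n+m (y + z) x))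
    ; Z≢0 = _ ; Ka≢0 = _ ; Ka1≢0 = _ ; Kb1≢0 = _ ; M≢0 = _
    }
    where
    core e m Z Ka1 Kb1 Ka D K1 M x y z : ℕ
    core = coreBound (suc q) a p 0 (suc q)
    e    = 5 * suc k
    m    = p * r + core
    Z    = suc ((2 + q) * r ^ r)
    Ka1  = suc (2 * e * suc m * b)
    Kb1  = suc (2 * e * suc m * a)
    Ka   = suc (e * (Kb1 * Z) + 2 * e * suc m * (b * Ka1))
    D    = e * (Ka * Z + 1)
    K1   = D * suc m * a * Ka
    M    = suc (K1 * Z)
    x    = D * suc m * b
    y    = 2 * (e * (M * M ^ suc q)) * suc m * r
    z    = 2 * (e * M) * suc m * a

module _ {n s q a₁ b₁ k : ℕ} (E : Fin s → Fin (suc q) → Bool) (connected : Connected E) (i₀ : Fin s)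
  {P} (g : Grow E P) (all : ∀ z → z ∈ P) (y : ℕ) (y+b≡a₁ : y + suc b₁ ≡ a₁)
  (cs : Constants k q (suc a₁ + suc b₁) (suc a₁) (suc b₁) (length P)) where

  open Constants cs
  private
    a b r r₁ : ℕ
    a  = suc a₁
    b  = suc b₁
    r  = a + b
    r₁ = a₁ + b

  bounded-edges : N ≤ n → (Es : List (Subset n)) → Unique Es → All (λ F → ∣ F ∣ ≡ r) Es → length Es ≤ (2 + q) * n ^ r₁ →
    ¬ Embedding E (IsEdge Es a b) → suc k * length Es ≤ suc k * (q * (n C r₁)) + n ^ r₁
  bounded-edges n-large Es distinct uniform Es≤ free = *-cancelˡ-≤ 5 (begin
      5 * (suc k * length Es)                                ≡⟨ *-assoc 5 (suc k) (length Es) ⟨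
      5 * suc k * length Es                                  ≡⟨ cong (_* length Es) e≡ ⟨
      e * length Es                                          ≤⟨ classified ⟩
      e * (q * (n C r₁)) + 5 * n ^ r₁                        ≡⟨ cong (λ e → e * (q * (n C r₁)) + 5 * n ^ r₁) e≡ ⟩
      5 * suc k * (q * (n C r₁)) + 5 * n ^ r₁                ≡⟨ cong (_+ 5 * n ^ r₁) (*-assoc 5 (suc k) (q * (n C r₁))) ⟩
      5 * (suc k * (q * (n C r₁))) + 5 * n ^ r₁              ≡⟨ *-distribˡ-+ 5 (suc k * (q * (n C r₁))) (n ^ r₁) ⟨
      5 * (suc k * (q * (n C r₁)) + n ^ r₁)                  ∎)
    where
    open ≤-Reasoning
    instance
      n≢0 : NonZero n
      n≢0 = >-nonZero (≤-trans N₀ n-large)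
    total : length Es * r ^ r ≤ Z * n ^ r₁
    total = begin
      length Es * r ^ r                ≤⟨ *-monoˡ-≤ (r ^ r) Es≤ ⟩
      (2 + q) * n ^ r₁ * r ^ r         ≡⟨ swap₁ (2 + q) (n ^ r₁) (r ^ r) ⟩
      (2 + q) * r ^ r * n ^ r₁         ≤⟨ *-monoˡ-≤ (n ^ r₁) Z-large ⟩
      Z * n ^ r₁                       ∎
      where
      swap₁ : ∀ x y z → x * y * z ≡ x * z * y
      swap₁ = solve-∀
    classified : e * length Es ≤ e * (q * (n C r₁)) + 5 * n ^ r₁
    classified = Cases.edge-bound {s = s} {suc q} {a₁} {b₁} E connected i₀ zero g all Es distinct uniform free e m Z Ka Ka1 Kb1 K1 M
      {{Z≢0}} {{Ka≢0}} {{Ka1≢0}} {{Kb1≢0}} {{M≢0}} total p≤m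
      q y D refl y+b≡a₁ D≡ DK1 Kb1Ka Ka1Ka aKb1 bKa1 K1Z≤M core≤m (≤-trans N₁ n-large) (≤-trans N₂ n-large) (≤-trans N₃ n-large)

  -- Only q * (n C r₁) + n ^ r₁ + 1 edges are kept, so that the number of edges is O(n ^ r₁).
  upper-bound : N ≤ n → (H : RGraph r n) → BlowupFree s (suc q) a b E H →
    suc k * size H ≤ suc k * (q * (n C r₁)) + n ^ r₁
  upper-bound n-large H free = case ⊓-sel ℓ (size H) of λ where
      (inj₂ eq) → subst (λ l → suc k * l ≤ suc k * (q * (n C r₁)) + n ^ r₁) (trans (length-take ℓ (edges H)) eq) bound
      -- If all `ℓ` places are filled, the kept edges alone exceed the bound; in the other case
      -- nothing was cut off.
      (inj₁ eq) → contradiction (subst (λ l → suc k * l ≤ suc k * (q * (n C r₁)) + n ^ r₁) (trans (length-take ℓ (edges H)) eq) bound) (<⇒≱ large)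
    where
    open ≤-Reasoning
    ℓ : ℕ
    ℓ = suc (q * (n C r₁) + n ^ r₁)
    instance
      n≢0 : NonZero n
      n≢0 = >-nonZero (≤-trans N₀ n-large)
    Es : List (Subset n)
    Es = take ℓ (edges H)
    ⊆H : ∀ {F} → F ∈ Es → F ∈ edges H
    ⊆H F∈ = subst (_ ∈_) (List.take++drop≡id ℓ (edges H)) (∈-++⁺ˡ F∈)
    Es≤ : length Es ≤ (2 + q) * n ^ r₁
    Es≤ = begin
      length Es                          ≡⟨ length-take ℓ (edges H) ⟩
      _                                  ≤⟨ m⊓n≤m ℓ (size H) ⟩
      1 + (q * (n C r₁) + n ^ r₁)        ≤⟨ +-mono-≤ (m^n>0 n r₁) (+-monoˡ-≤ (n ^ r₁) (*-monoʳ-≤ q (C≤^ n r₁))) ⟩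
      n ^ r₁ + (q * n ^ r₁ + n ^ r₁)     ≡⟨ collect q (n ^ r₁) ⟩
      (2 + q) * n ^ r₁                   ∎
      where
      collect : ∀ q x → x + (q * x + x) ≡ (2 + q) * x
      collect = solve-∀
    bound : suc k * length Es ≤ suc k * (q * (n C r₁)) + n ^ r₁
    bound = bounded-edges n-large Es (Unique.take⁺ ℓ (distinct H)) (All.take⁺ ℓ (uniform H)) Es≤
      λ (emb , dj , rel) → free (embedding⇒blowup E connected i₀ zero H
        (emb , dj , λ i j eij → let lu , lv , e∈ = rel i j eij in lu , lv , ⊆H e∈))
    large : suc k * (q * (n C r₁)) + n ^ r₁ < suc k * ℓ
    large = begin-strict
      suc k * (q * (n C r₁)) + n ^ r₁                  ≤⟨ +-monoʳ-≤ _ (m≤n*m (n ^ r₁) (suc k)) ⟩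
      suc k * (q * (n C r₁)) + suc k * n ^ r₁          ≡⟨ *-distribˡ-+ (suc k) (q * (n C r₁)) (n ^ r₁) ⟨
      suc k * (q * (n C r₁) + n ^ r₁)                  <⟨ *-monoʳ-< (suc k) (n<1+n _) ⟩
      suc k * ℓ                                        ∎

theorem2 : (r s t a b : ℕ) → 3 ≤ r → 2 ≤ s → 2 ≤ t → a + b ≡ r → b < a → a < r →
    (E : Fin s → Fin t → Bool) → IsTree E →
    ((k : ℕ) → Σ ℕ λ N → (n : ℕ) → N ≤ n → (H : RGraph r n) → BlowupFree s t a b E H →
    suc k * size H ≤ suc k * ((t ∸ 1) * (n C (r ∸ 1))) + n ^ (r ∸ 1))
    ×
    (t ≤ s → (k : ℕ) → Σ ℕ λ N → (n : ℕ) → N ≤ n → Σ (RGraph r n) λ H → BlowupFree s t a b E H ×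
    suc k * ((t ∸ 1) * (n C (r ∸ 1))) ≤ suc k * size H + n ^ (r ∸ 1))
theorem2 _ _ _ a zero _ _ _ refl _ a<r _ _ = contradiction (subst (a <_) (+-identityʳ a) a<r) (<-irrefl refl)
theorem2 _ (suc s) (suc q) (suc a₁) (suc b₁) _ _ _ refl (s≤s b≤a₁) _ E (connected , acyclic) =
    (λ k → let P , g , all = spanning E acyclic connected zero
               -- Here b < a enters: `y` is the number of vertices that a (b+1)-set lacks to an
               -- a-set.
               y , b+y≡a₁ = m≤n⇒∃[o]m+o≡n b≤a₁
               y+b≡a₁ = trans (+-comm y (suc b₁)) b+y≡a₁
               cs = constants k q (suc a₁ + suc b₁) (suc a₁) (suc b₁) (length P)
           in Constants.N cs , λ n → upper-bound E connected zero g all y y+b≡a₁ cs)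
  , λ t≤s k → q + suc k * (q * q) , lower (a₁ + suc b₁) (a₁ + b₁) (+-suc a₁ b₁) t≤s k
  where
  -- The uniformity in `lower-bound` has the form `suc (suc j)`, whereas r - 1 is `a₁ + suc b₁`
  -- here; abstracting it as `l` bridges the two.
  lower : ∀ l j → l ≡ suc j → suc q ≤ suc s → ∀ k n → q + suc k * (q * q) ≤ n →
    Σ (RGraph (suc l) n) λ H → BlowupFree (suc s) (suc q) (suc a₁) (suc b₁) E H × suc k * (q * (n C l)) ≤ suc k * size H + n ^ l
  lower .(suc j) j refl t≤s k = lower-bound j q E connected t≤s k
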